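{- There is a universal constant $A>0$ such that for all integers $m\ge \ell\ge 8$ and all integers $k$ with $2\le k\le \ell m/2$, $$ p_k(\ell,m)-p_{k-1}(\ell,m)\ >\ A\,\frac{2^{\sqrt{s}}}{s^{9/4}},\qquad\text{where } s=\min\{2k,\ell^2\}. $$
   Context: The numbers $p_n(\ell,m)$ are the coefficients of the $q$-binomial (Gaussian) coefficient: $$\binom{m+\ell}{m}_q=\frac{(q^{m+1}-1)\cdots(q^{m+\ell}-1)}{(q-1)\cdots(q^\ell-1)}=\sum_{n=0}^{\ell m} p_n(\ell,m)\,q^n;$$ equivalently $p_n(\ell,m)$ is the number of partitions of $n$ whose Young diagram fits inside an $\ell\times m$ rectangle. -}

module Defs where

open import Data.Nat using (ℕ; zero; suc; _+_; _*_; _∸_; _^_; _≤_; _<_; _≤ᵇ_; _≡ᵇ_)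
open import Data.Bool using (Bool; true; false; _∧_; if_then_else_)
open import Data.List using (List; []; _∷_; [_]; map; concatMap; upTo)
open import Data.Vec using (Vec; []; _∷_; sum)
open import Data.Product using (Σ; _×_)

boxVecs : (ℓ m : ℕ) → List (Vec ℕ ℓ)
boxVecs zero    m = [ [] ]
boxVecs (suc ℓ) m = concatMap (λ x → map (x ∷_) (boxVecs ℓ m)) (upTo (suc m))

-- weakly decreasing (a partition written as its ℓ parts, zeros allowed)
nonincreasing : ∀ {ℓ} → Vec ℕ ℓ → Bool
nonincreasing []            = true
nonincreasing (x ∷ [])      = true
nonincreasing (x ∷ y ∷ v)   = (y ≤ᵇ x) ∧ nonincreasing (y ∷ v)

count : ∀ {A : Set} → (A → Bool) → List A → ℕ
count f []       = 0
count f (x ∷ xs) = (if f x then 1 else 0) + count f xs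

p : (n ℓ m : ℕ) → ℕ
p n ℓ m = count (λ v → nonincreasing v ∧ (sum v ≡ᵇ n)) (boxVecs ℓ m)

-- Real inequality  x - y > (u/v) · 2^{√s} / s^{9/4}  encoded in ℕ:
-- x - y > 0 and there is a rational a/b > √s (i.e. a² > s b²) with
-- x - y > (u/v) · 2^{a/b} / s^{9/4}, i.e. u^{4b} 2^{4a} < (v (x - y))^{4b} s^{9b}.
-- (By continuity/monotonicity of t ↦ 2^t this is equivalent to the real inequality.)
BoundHolds : (u v x y s : ℕ) → Set
BoundHolds u v x y s =
  (y < x) ×
  Σ ℕ (λ a → Σ ℕ (λ b →
    (1 ≤ b) × (s * (b * b) < a * a) ×
    (u ^ (4 * b) * 2 ^ (4 * a) < (v * (x ∸ y)) ^ (4 * b) * s ^ (9 * b))))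

{-# OPTIONS --safe #-}
-- Let d_k(ℓ,m) = p_k(ℓ,m) − p_{k−1}(ℓ,m) and 2k ≤ ℓm. The symmetric polynomials in ℓ variables with exponents at
-- most m form an sl₂-module with lowering operator D = Σ ∂/∂xᵢ, and d_k(ℓ,m) is the dimension of ker D in degree k.
-- Products of elements of ker D lie in ker D and multiplication by a nonzero polynomial is injective, so
-- d_{k₁}(ℓ,m₁) > 0 implies d_{k₁+k₂}(ℓ,m₁+m₂) ≥ d_{k₂}(ℓ,m₂). Together with p_n(ℓ,m) = p_n(m,ℓ), this reduces
-- d_k(ℓ,m) > 0 for ℓ, m ≥ 8 to the finitely many boxes with 8 ≤ ℓ, m ≤ 15, where it is computed.
--
-- For the growth, put N = 2n + 1. The q-binomial theorem at z = q⁻ⁿ gives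
-- Σⱼ d_{j(N−j)/2}(j,N−j) = s₀² + Σᵢ (sᵢ − sᵢ₊₁)², where sᵢ is the number of subsets of {1,…,n} with sum i.
-- Since Σᵢ sᵢ = 2ⁿ, the right-hand side is at least 4ⁿ up to a polynomial factor, so some summand is as well.
-- As 2^m p_n(ℓ,m) ≤ 3^(ℓ+m), neither j nor N − j is then close to N. Taking N close to 4ℓ/3, this box fits inside
-- the ℓ × m box with room to spare, and the inequality above carries its difference over to d_k(ℓ,m) ≥ 2^(ℓ+1)
-- for k near ℓm/2. Smaller k are reduced to this case in a smaller box, and small ℓ are absorbed in the constant.
module Submission where

open import Defs
open import Data.Bool using (Bool; true; false; _∧_; if_then_else_)
open import Data.Bool.Properties as Bool using (T-≡; ∧-conicalˡ; ∧-conicalʳ)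
open import Data.Empty using (⊥; ⊥-elim)
open import Data.Integer as ℤ using (ℤ; +_; -[1+_])
import Data.Integer.Properties as ℤ
open import Data.Integer.Tactic.RingSolver using () renaming (solve-∀ to ℤ-solve-∀)
open import Data.List using (List; []; _∷_; map; concatMap; upTo; length; _++_; filter; replicate; drop;
  cartesianProductWith)
open import Data.List.Membership.Propositional using (_∈_; find)
open import Data.List.Membership.Propositional.Properties
  using (∈-map⁺; ∈-map⁻; ∈-++⁺ˡ; ∈-++⁺ʳ; ∈-++⁻; ∈-upTo⁺; ∈-upTo⁻; ∈-filter⁺; ∈-filter⁻;
    ∈-cartesianProductWith⁺; ∈-cartesianProductWith⁻)
open import Data.List.Membership.Propositional.Properties.WithK using (unique∧set⇒bag)
open import Data.List.Properties using (length-map; length-++)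
open import Data.List.Relation.Unary.All as All using (All; []; _∷_)
open import Data.List.Relation.Unary.Any using (here; there)
import Data.List.Relation.Unary.All.Properties as All
open import Data.List.Relation.Unary.AllPairs using ([]; _∷_)
open import Data.List.Relation.Unary.Unique.Propositional using (Unique)
import Data.List.Relation.Unary.Unique.Propositional.Properties as Unique
open import Data.List.Relation.Binary.BagAndSetEquality using (∼bag⇒↭)
open import Data.List.Relation.Binary.Permutation.Propositional.Properties using (↭-length)
open import Data.Nat using (ℕ; zero; suc; _+_; _*_; _∸_; _^_; _≤_; _<_; _≤ᵇ_; _<ᵇ_; _≡ᵇ_;
  ⌊_/2⌋; _⊓_; _⊔_; z≤n; s≤s; pred; >-nonZero; ∣_-_∣)
open import Data.Nat.DivMod using (_/_; _%_; m≡m%n+[m/n]*n; m%n<n; /-monoˡ-≤)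
open import Data.Nat.Induction using (<-rec)
open import Data.Nat.Properties
open import Data.Nat.Tactic.RingSolver using () renaming (solve-∀ to ℕ-solve-∀)
open import Data.Product using (Σ; Σ-syntax; ∃; ∃-syntax; _×_; _,_; proj₁; proj₂)
open import Data.Sum using (_⊎_; inj₁; inj₂; [_,_]′)
open import Data.Sum.Properties using (inj₁-injective; inj₂-injective) renaming (≡-dec to ⊎-≡-dec)
open import Data.Unit using (⊤; tt)
open import Data.Vec as Vec using (Vec; []; _∷_)
import Data.Vec.Properties as Vec
open import Function using (_∘_; mk⇔; Equivalence)
open import Relation.Binary.Definitions using (DecidableEquality; tri<; tri≈; tri>)
open import Relation.Binary.PropositionalEquality hiding (J)
open import Relation.Nullary using (¬_; Dec; yes; no; does; contradiction)

private variable
  ℓ : ℕ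

-- That the difference is dim ker `D` rests on `D` being onto below the middle degree. Neither
-- dimension nor surjectivity is developed: over ℤ the only tool is that a homogeneous system with
-- more unknowns than equations has a nonzero solution. Injectivity of DU, with `U` the raising
-- operator, takes the place of surjectivity: `U` puts a copy of degree k - 1 into degree k that
-- meets ker `D` only in 0. The persistent obstacle is degree 1, because p_1 = p_0: whenever a
-- degree is split between two boxes, a strictly positive difference is available only in degree 0
-- or in degrees from 2 on, and only in boxes with both sides at least 8. This explains the margins
-- of 8 and the shifted splittings. Origin of the ratio 4/3: for N = 8t + 1 and ℓ near 6t the
-- right-hand side of the identity is 2^(8t) up to a polynomial factor. A box of width K has p at
-- most 3^(8t + 1) / 2^K, and 3^8 < 2^13, so a difference above roughly 2^(7t) forces K below 6t. An
-- exponent between 7t and 8t minus logarithmic losses serves both purposes, and it exceeds ℓ.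

ℤ-interchange : ∀ a b c d → a ℤ.+ b ℤ.+ (c ℤ.+ d) ≡ a ℤ.+ c ℤ.+ (b ℤ.+ d)
ℤ-interchange = ℤ-solve-∀

-- Linear algebra over ℤ

infixl 6 _⊕_
infixl 7 _⊙_

_⊕_ : ∀ {n} → Vec ℤ n → Vec ℤ n → Vec ℤ n
_⊕_ = Vec.zipWith ℤ._+_

_⊙_ : ∀ {n} → ℤ → Vec ℤ n → Vec ℤ n
c ⊙ x = Vec.map (c ℤ.*_) x

zeros : ∀ {n} → Vec ℤ n
zeros = Vec.replicate _ (+ 0)

Linear : ∀ {n} → (Vec ℤ n → ℤ) → Set
Linear L = (∀ x y → L (x ⊕ y) ≡ L x ℤ.+ L y) × (∀ c x → L (c ⊙ x) ≡ c ℤ.* L x)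

zero-⊙ : ∀ {n} (x : Vec ℤ n) → + 0 ⊙ x ≡ zeros
zero-⊙ []      = refl
zero-⊙ (_ ∷ x) = cong (_ ∷_) (zero-⊙ x)

⊙-zeros : ∀ {n} c → c ⊙ zeros {n} ≡ zeros
⊙-zeros {zero}  c = refl
⊙-zeros {suc n} c = cong₂ _∷_ (ℤ.*-zeroʳ c) (⊙-zeros c)

linear-zeros : ∀ {n} {L : Vec ℤ n → ℤ} → Linear L → L zeros ≡ + 0
linear-zeros {n} {L} (_ , scale) = trans (cong L (sym (zero-⊙ zeros))) (scale (+ 0) zeros)

linear-ext : ∀ {n} {L M : Vec ℤ n → ℤ} → (∀ x → L x ≡ M x) → Linear M → Linear L
linear-ext e (add , scale) =
  (λ x y → trans (e _) (trans (add x y) (sym (cong₂ ℤ._+_ (e x) (e y))))) ,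
  (λ c x → trans (e _) (trans (scale c x) (cong (c ℤ.*_) (sym (e x)))))

linear-0 : ∀ {n} → Linear {n} (λ _ → + 0)
linear-0 = (λ _ _ → refl) , (λ c _ → sym (ℤ.*-zeroʳ c))

linear-+ : ∀ {n} {L M : Vec ℤ n → ℤ} → Linear L → Linear M → Linear (λ x → L x ℤ.+ M x)
linear-+ {L = L} {M} (addL , scaleL) (addM , scaleM) =
  (λ x y → trans (cong₂ ℤ._+_ (addL x y) (addM x y)) (ℤ-interchange (L x) (L y) (M x) (M y))) ,
  (λ c x → trans (cong₂ ℤ._+_ (scaleL c x) (scaleM c x)) (sym (ℤ.*-distribˡ-+ c _ _)))

-- Certifies that the kernel of `L` has rank at least `b` without a notion of rank: one equation
-- costs one unknown.
record Embedding (b : ℕ) (L : Vec ℤ (suc b) → ℤ) : Set where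
  field
    embed     : Vec ℤ b → Vec ℤ (suc b)
    embed-⊕   : ∀ x y → embed (x ⊕ y) ≡ embed x ⊕ embed y
    embed-⊙   : ∀ c x → embed (c ⊙ x) ≡ c ⊙ embed x
    injective : ∀ x → embed x ≡ zeros → x ≡ zeros
    kills     : ∀ x → L (embed x) ≡ + 0

⊙-injective : ∀ {n} c → c ≢ + 0 → (x : Vec ℤ n) → c ⊙ x ≡ zeros → x ≡ zeros
⊙-injective c c≢0 []      e = refl
⊙-injective c c≢0 (a ∷ x) e with ℤ.i*j≡0⇒i≡0∨j≡0 c (Vec.∷-injectiveˡ e)
... | inj₁ c≡0 = contradiction c≡0 c≢0
... | inj₂ a≡0 = cong₂ _∷_ a≡0 (⊙-injective c c≢0 x (Vec.∷-injectiveʳ e))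

e₀ : ∀ {b} → Vec ℤ (suc b)
e₀ = + 1 ∷ zeros

-- Elimination without division. If the pivot `L e₀` is nonzero, the other coordinates are scaled by
-- it and the first one compensates; if it is zero, the first coordinate is free and the elimination
-- continues on the rest.
hyperplane : ∀ b (L : Vec ℤ (suc b) → ℤ) → Linear L → Embedding b L
hyperplane b L lin with L e₀ ℤ.≟ + 0
hyperplane b L lin@(add , scale) | no p≢0 = record
  { embed     = λ x → ℤ.- L (+ 0 ∷ x) ∷ L e₀ ⊙ x
  ; embed-⊕   = λ x y → cong₂ _∷_
      (trans (cong ℤ.-_ (add (+ 0 ∷ x) (+ 0 ∷ y))) (ℤ.neg-distrib-+ (L (+ 0 ∷ x)) (L (+ 0 ∷ y))))
      (⊙-⊕ (L e₀) x y)
  ; embed-⊙   = λ c x → cong₂ _∷_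
      (trans (cong ℤ.-_ (trans (cong (λ z → L (z ∷ c ⊙ x)) (sym (ℤ.*-zeroʳ c))) (scale c (+ 0 ∷ x))))
             (ℤ.neg-distribʳ-* c (L (+ 0 ∷ x))))
      (⊙-comm (L e₀) c x)
  ; injective = λ x e → ⊙-injective (L e₀) p≢0 x (Vec.∷-injectiveʳ e)
  ; kills     = kills
  }
  where
  ⊙-⊕ : ∀ {n} a (x y : Vec ℤ n) → a ⊙ (x ⊕ y) ≡ (a ⊙ x) ⊕ (a ⊙ y)
  ⊙-⊕ a []      []      = refl
  ⊙-⊕ a (u ∷ x) (v ∷ y) = cong₂ _∷_ (ℤ.*-distribˡ-+ a u v) (⊙-⊕ a x y)
  ⊙-comm : ∀ {n} a c (x : Vec ℤ n) → a ⊙ (c ⊙ x) ≡ c ⊙ (a ⊙ x)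
  ⊙-comm a c []      = refl
  ⊙-comm a c (u ∷ x) = cong₂ _∷_ (swap a c u) (⊙-comm a c x)
    where
    swap : ∀ a c l → a ℤ.* (c ℤ.* l) ≡ c ℤ.* (a ℤ.* l)
    swap = ℤ-solve-∀
  split : ∀ {n} s a (x : Vec ℤ n) → s ∷ a ⊙ x ≡ s ⊙ e₀ ⊕ a ⊙ (+ 0 ∷ x)
  split s a x = cong₂ _∷_ (lem s a) (sym (trans (cong (_⊕ a ⊙ x) (⊙-zeros s)) (Vec.zipWith-identityˡ ℤ.+-identityˡ (a ⊙ x))))
    where
    lem : ∀ s a → s ≡ s ℤ.* + 1 ℤ.+ a ℤ.* + 0
    lem = ℤ-solve-∀
  cancel : ∀ q p → ℤ.- q ℤ.* p ℤ.+ p ℤ.* q ≡ + 0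
  cancel = ℤ-solve-∀
  kills : ∀ x → L (ℤ.- L (+ 0 ∷ x) ∷ L e₀ ⊙ x) ≡ + 0
  kills x = trans (cong L (split (ℤ.- L (+ 0 ∷ x)) (L e₀) x))
    (trans (add _ _) (trans (cong₂ ℤ._+_ (scale (ℤ.- L (+ 0 ∷ x)) e₀) (scale (L e₀) (+ 0 ∷ x))) (cancel (L (+ 0 ∷ x)) (L e₀))))
hyperplane zero L lin | yes p≡0 = record
  { embed     = λ _ → zeros
  ; embed-⊕   = λ _ _ → refl
  ; embed-⊙   = λ c _ → sym (⊙-zeros c)
  ; injective = λ { [] _ → refl }
  ; kills     = λ _ → linear-zeros lin
  }
hyperplane (suc b) L lin@(add , scale) | yes p≡0 = record
  { embed     = λ { (a ∷ x) → a ∷ E.embed x }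
  ; embed-⊕   = λ { (a ∷ x) (c ∷ y) → cong (_ ∷_) (E.embed-⊕ x y) }
  ; embed-⊙   = λ { c (a ∷ x) → cong (_ ∷_) (E.embed-⊙ c x) }
  ; injective = λ { (a ∷ x) e → cong₂ _∷_ (Vec.∷-injectiveˡ e) (E.injective x (Vec.∷-injectiveʳ e)) }
  ; kills     = λ { (a ∷ x) → kills a x }
  }
  where
  module E = Embedding (hyperplane b (λ x → L (+ 0 ∷ x))
    ((λ x y → add (+ 0 ∷ x) (+ 0 ∷ y)) ,
     (λ c x → trans (cong (λ z → L (z ∷ c ⊙ x)) (sym (ℤ.*-zeroʳ c))) (scale c (+ 0 ∷ x)))))
  split : ∀ {n} a (y : Vec ℤ n) → a ∷ y ≡ a ⊙ e₀ ⊕ (+ 0 ∷ y)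
  split a y = cong₂ _∷_ (lem a) (sym (trans (cong (_⊕ y) (⊙-zeros a)) (Vec.zipWith-identityˡ ℤ.+-identityˡ y)))
    where
    lem : ∀ a → a ≡ a ℤ.* + 1 ℤ.+ + 0
    lem = ℤ-solve-∀
  kills : ∀ a x → L (a ∷ E.embed x) ≡ + 0
  kills a x = trans (cong L (split a (E.embed x)))
    (trans (add _ _) (cong₂ ℤ._+_ (trans (scale a e₀) (trans (cong (a ℤ.*_) p≡0) (ℤ.*-zeroʳ a))) (E.kills x)))

nontrivial-solution : ∀ {n} (Ls : List (Vec ℤ n → ℤ)) → All Linear Ls → length Ls < n →
  ∃[ x ] x ≢ zeros × All (λ L → L x ≡ + 0) Ls
nontrivial-solution {suc n} []       _            _         = e₀ , (λ ()) , []
nontrivial-solution {suc n} (L ∷ Ls) (lin ∷ lins) (s≤s lt)  =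
  let x , x≢0 , sol = nontrivial-solution (map (_∘ embed) Ls)
        (All.map⁺ (All.map pull-back lins)) (subst (_< n) (sym (length-map (_∘ embed) Ls)) lt)
  in embed x , x≢0 ∘ injective x , kills x ∷ All.map⁻ sol
  where
  open Embedding (hyperplane n L lin)
  pull-back : ∀ {M} → Linear M → Linear (M ∘ embed)
  pull-back {M} (add , scale) =
    (λ x y → trans (cong M (embed-⊕ x y)) (add _ _)) , (λ c x → trans (cong M (embed-⊙ c x)) (scale c (embed x)))

dimension-bound : ∀ {n} (Ls : List (Vec ℤ n → ℤ)) → All Linear Ls →
  (∀ x → All (λ L → L x ≡ + 0) Ls → x ≡ zeros) → n ≤ length Ls
dimension-bound {n} Ls lins trivial with n ≤? length Ls
... | yes n≤ = n≤
... | no  n≰ = let x , x≢0 , sol = nontrivial-solution Ls lins (≰⇒> n≰) in contradiction (trivial x sol) x≢0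

-- Formal combinations of the entries of a list

module Combination {X : Set} (_≟_ : DecidableEquality X) where

  -- The coefficient of `x` in the formal sum of the entries of `B` weighted by `c`. An earlier
  -- entry shadows a later equal one, so independence needs `Unique B`.
  combination : (B : List X) → Vec ℤ (length B) → X → ℤ
  combination []      _        _ = + 0
  combination (b ∷ B) (c ∷ cs) x = if does (x ≟ b) then c else combination B cs x

  combination-linear : ∀ B x → Linear (λ c → combination B c x)
  combination-linear []      x = linear-0
  combination-linear (b ∷ B) x = linear-ext (λ { (_ ∷ _) → refl }) (branch (does (x ≟ b)))
    where
    branch : ∀ t → Linear {length (b ∷ B)}
      (λ { (c ∷ cs) → if t then c else combination B cs x })
    branch true  = (λ { (_ ∷ _) (_ ∷ _) → refl }) , (λ { _ (_ ∷ _) → refl })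
    branch false = (λ { (_ ∷ c) (_ ∷ d) → proj₁ (combination-linear B x) c d })
                 , (λ { a (_ ∷ c) → proj₂ (combination-linear B x) a c })

  combination-support : ∀ B c x → combination B c x ≢ + 0 → x ∈ B
  combination-support []      c        x ne = contradiction refl ne
  combination-support (b ∷ B) (_ ∷ cs) x ne with x ≟ b
  ... | yes x≡b = here x≡b
  ... | no  _   = there (combination-support B cs x ne)

  combination-injective : ∀ {B} → Unique B → ∀ c → (∀ x → x ∈ B → combination B c x ≡ + 0) → c ≡ zeros
  combination-injective []          []       _ = refl
  combination-injective {b ∷ B} (b∉B ∷ u) (c ∷ cs) h = cong₂ _∷_ head (combination-injective u cs tail)
    where
    head : c ≡ + 0
    head with b ≟ b | h b (here refl)
    ... | yes _  | e = e
    ... | no b≢b | _ = contradiction refl b≢b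
    tail : ∀ x → x ∈ B → combination B cs x ≡ + 0
    tail x x∈B with x ≟ b | h x (there x∈B)
    ... | yes refl | _ = contradiction refl (All.lookup b∉B x∈B)
    ... | no _     | e = e

  combination-nonzero : ∀ {B} → Unique B → ∀ c → c ≢ zeros → ∃[ x ] combination B c x ≢ + 0
  combination-nonzero {B} u c c≢0 with All.all? (λ x → combination B c x ℤ.≟ + 0) B
  ... | yes all = contradiction (combination-injective u c (λ x → All.lookup all)) c≢0
  ... | no ¬all = let x , _ , ne = find (All.¬All⇒Any¬ (λ x → combination B c x ℤ.≟ + 0) B ¬all) in x , ne

-- Polynomials in ℓ variables, given by their coefficients at exponent vectors

Poly : ℕ → Set
Poly ℓ = Vec ℕ ℓ → ℤ

slice : Poly (suc ℓ) → ℕ → Poly ℓ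
slice f x v = f (x ∷ v)

-- Σᵢ ∂/∂xᵢ
D : Poly ℓ → Poly ℓ
D {zero}  f []      = + 0
D {suc _} f (x ∷ v) = + suc x ℤ.* f (suc x ∷ v) ℤ.+ D (slice f x) v

-- The operator m x - x² d/dx in the first variable, on coefficients: it sends x^a to (m - a)
-- x^(a+1).
raise : ℕ → Poly (suc ℓ) → ℕ → Poly ℓ
raise m f zero    v = + 0
raise m f (suc x) v = (+ m ℤ.- + x) ℤ.* f (x ∷ v)

-- Σᵢ (m xᵢ − xᵢ² ∂/∂xᵢ), which together with D spans a copy of sl₂
U : ℕ → Poly ℓ → Poly ℓ
U {zero}  m f []      = + 0
U {suc _} m f (x ∷ v) = raise m f x v ℤ.+ U m (slice f x) v

D-cong : {f g : Poly ℓ} → (∀ v → f v ≡ g v) → ∀ v → D f v ≡ D g v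
D-cong {zero}  e []      = refl
D-cong {suc _} e (x ∷ v) = cong₂ ℤ._+_ (cong (+ suc x ℤ.*_) (e _)) (D-cong (e ∘ (x ∷_)) v)

D-0 : (v : Vec ℕ ℓ) → D (λ _ → + 0) v ≡ + 0
D-0 []      = refl
D-0 (x ∷ v) = cong₂ ℤ._+_ (ℤ.*-zeroʳ (+ suc x)) (D-0 v)

D-+ : (f g : Poly ℓ) → ∀ v → D (λ u → f u ℤ.+ g u) v ≡ D f v ℤ.+ D g v
D-+ f g []      = refl
D-+ f g (x ∷ v) = trans (cong (ℤ._+_ (+ suc x ℤ.* (f (suc x ∷ v) ℤ.+ g (suc x ∷ v)))) (D-+ (slice f x) (slice g x) v))
  (lem (+ suc x) (f (suc x ∷ v)) (g (suc x ∷ v)) (D (slice f x) v) (D (slice g x) v))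
  where
  lem : ∀ k a b c d → k ℤ.* (a ℤ.+ b) ℤ.+ (c ℤ.+ d) ≡ k ℤ.* a ℤ.+ c ℤ.+ (k ℤ.* b ℤ.+ d)
  lem = ℤ-solve-∀

D-* : ∀ a (f : Poly ℓ) v → D (λ u → a ℤ.* f u) v ≡ a ℤ.* D f v
D-* a f []      = sym (ℤ.*-zeroʳ a)
D-* a f (x ∷ v) = trans (cong (ℤ._+_ (+ suc x ℤ.* (a ℤ.* f (suc x ∷ v)))) (D-* a (slice f x) v)) (lem (+ suc x) a (f (suc x ∷ v)) (D (slice f x) v))
  where
  lem : ∀ k a b c → k ℤ.* (a ℤ.* b) ℤ.+ a ℤ.* c ≡ a ℤ.* (k ℤ.* b ℤ.+ c)
  lem = ℤ-solve-∀

raise-cong : ∀ m {f g : Poly (suc ℓ)} → (∀ v → f v ≡ g v) → ∀ x v → raise m f x v ≡ raise m g x v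
raise-cong m e zero    v = refl
raise-cong m e (suc x) v = cong ((+ m ℤ.- + x) ℤ.*_) (e (x ∷ v))

raise-+ : ∀ m (f g : Poly (suc ℓ)) x v → raise m (λ u → f u ℤ.+ g u) x v ≡ raise m f x v ℤ.+ raise m g x v
raise-+ m f g zero    v = refl
raise-+ m f g (suc x) v = ℤ.*-distribˡ-+ (+ m ℤ.- + x) (f (x ∷ v)) (g (x ∷ v))

raise-* : ∀ m a (f : Poly (suc ℓ)) x v → raise m (λ u → a ℤ.* f u) x v ≡ a ℤ.* raise m f x v
raise-* m a f zero    v = sym (ℤ.*-zeroʳ a)
raise-* m a f (suc x) v = lem (+ m ℤ.- + x) a (f (x ∷ v))
  where
  lem : ∀ k a b → k ℤ.* (a ℤ.* b) ≡ a ℤ.* (k ℤ.* b)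
  lem = ℤ-solve-∀

U-cong : ∀ m {f g : Poly ℓ} → (∀ v → f v ≡ g v) → ∀ v → U m f v ≡ U m g v
U-cong m e []      = refl
U-cong m e (x ∷ v) = cong₂ ℤ._+_ (raise-cong m e x v) (U-cong m (e ∘ (x ∷_)) v)

U-0 : ∀ m (v : Vec ℕ ℓ) → U m (λ _ → + 0) v ≡ + 0
U-0 m []          = refl
U-0 m (zero ∷ v)  = cong (ℤ._+_ (+ 0)) (U-0 m v)
U-0 m (suc x ∷ v) = cong₂ ℤ._+_ (ℤ.*-zeroʳ (+ m ℤ.- + x)) (U-0 m v)

U-+ : ∀ m (f g : Poly ℓ) v → U m (λ u → f u ℤ.+ g u) v ≡ U m f v ℤ.+ U m g v
U-+ m f g []      = refl
U-+ m f g (x ∷ v) = trans (cong₂ ℤ._+_ (raise-+ m f g x v) (U-+ m (slice f x) (slice g x) v))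
  (ℤ-interchange (raise m f x v) (raise m g x v) (U m (slice f x) v) (U m (slice g x) v))

U-* : ∀ m a (f : Poly ℓ) v → U m (λ u → a ℤ.* f u) v ≡ a ℤ.* U m f v
U-* m a f []      = sym (ℤ.*-zeroʳ a)
U-* m a f (x ∷ v) = trans (cong₂ ℤ._+_ (raise-* m a f x v) (U-* m a (slice f x) v))
  (sym (ℤ.*-distribˡ-+ a (raise m f x v) (U m (slice f x) v)))

weight : ℕ → Vec ℕ ℓ → ℤ
weight m []      = + 0
weight m (x ∷ v) = + m ℤ.- + 2 ℤ.* + x ℤ.+ weight m v

weight-sum : ∀ m (v : Vec ℕ ℓ) → weight m v ≡ + (ℓ * m) ℤ.- + (2 * Vec.sum v)
weight-sum m []              = refl
weight-sum {suc ℓ} m (x ∷ v) = trans (cong (ℤ._+_ (+ m ℤ.- + 2 ℤ.* + x)) (weight-sum m v)) (trans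
  (lem (+ m) (+ (ℓ * m)) (+ 2 ℤ.* + x) (+ (2 * Vec.sum v)))
  (cong (λ z → + m ℤ.+ + (ℓ * m) ℤ.- z)
    (trans (cong (ℤ._+ + (2 * Vec.sum v)) (sym (ℤ.pos-* 2 x)))
           (cong +_ (sym (*-distribˡ-+ 2 x (Vec.sum v)))))))
  where
  lem : ∀ a b c d → a ℤ.- c ℤ.+ (b ℤ.- d) ≡ a ℤ.+ b ℤ.- (c ℤ.+ d)
  lem = ℤ-solve-∀

-- Operators in different variables commute. In a single variable the two orders differ by (x + 1)(m
-- - x) - x(m - x + 1) = m - 2x, which is the summand in `weight`.
commutator : ∀ m (f : Poly ℓ) v → D (U m f) v ≡ U m (D f) v ℤ.+ weight m v ℤ.* f v
commutator m f []      = refl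
commutator {suc ℓ} m f (x ∷ v) = begin
  X+1 ℤ.* ((M ℤ.- X) ℤ.* F ℤ.+ U m (slice f (suc x)) v) ℤ.+ D (λ u → raise m f x u ℤ.+ U m (slice f x) u) v
    ≡⟨ cong (ℤ._+_ (X+1 ℤ.* ((M ℤ.- X) ℤ.* F ℤ.+ U m (slice f (suc x)) v)))
          (trans (D-+ (raise m f x) (U m (slice f x)) v)
                 (cong (ℤ._+_ (D (raise m f x) v)) (commutator m (slice f x) v))) ⟩
  X+1 ℤ.* ((M ℤ.- X) ℤ.* F ℤ.+ U m (slice f (suc x)) v)
    ℤ.+ (D (raise m f x) v ℤ.+ (U m (D (slice f x)) v ℤ.+ weight m v ℤ.* F))
    ≡⟨ regroup X M F (U m (slice f (suc x)) v) (D (raise m f x) v) (U m (D (slice f x)) v) (weight m v) ⟩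
  (D (raise m f x) v ℤ.+ X ℤ.* (M ℤ.- X ℤ.+ + 1) ℤ.* F)
    ℤ.+ (X+1 ℤ.* U m (slice f (suc x)) v ℤ.+ U m (D (slice f x)) v) ℤ.+ (M ℤ.- + 2 ℤ.* X ℤ.+ weight m v) ℤ.* F
    ≡⟨ cong (ℤ._+ (M ℤ.- + 2 ℤ.* X ℤ.+ weight m v) ℤ.* F) (sym (cong₂ ℤ._+_ (raise-D x) U-D)) ⟩
  raise m (D f) x v ℤ.+ U m (slice (D f) x) v ℤ.+ weight m (x ∷ v) ℤ.* F ∎
  where
  open ≡-Reasoning
  X = + x
  X+1 = + suc x
  M = + m
  F = f (x ∷ v)
  regroup : ∀ X M F u r d w →
    (+ 1 ℤ.+ X) ℤ.* ((M ℤ.- X) ℤ.* F ℤ.+ u) ℤ.+ (r ℤ.+ (d ℤ.+ w ℤ.* F)) ≡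
    (r ℤ.+ X ℤ.* (M ℤ.- X ℤ.+ + 1) ℤ.* F) ℤ.+ ((+ 1 ℤ.+ X) ℤ.* u ℤ.+ d) ℤ.+ (M ℤ.- + 2 ℤ.* X ℤ.+ w) ℤ.* F
  regroup = ℤ-solve-∀
  raise-D : ∀ x → raise m (D f) x v ≡ D (raise m f x) v ℤ.+ + x ℤ.* (M ℤ.- + x ℤ.+ + 1) ℤ.* f (x ∷ v)
  raise-D zero    = sym (cong₂ ℤ._+_ (D-0 v) (ℤ.*-zeroˡ (f (0 ∷ v))))
  raise-D (suc y) = trans (lem (+ y) M (f (suc y ∷ v)) (D (slice f y) v))
    (cong (ℤ._+ + suc y ℤ.* (M ℤ.- + suc y ℤ.+ + 1) ℤ.* f (suc y ∷ v)) (sym (D-* (M ℤ.- + y) (slice f y) v)))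
    where
    lem : ∀ Y M F d → (M ℤ.- Y) ℤ.* ((+ 1 ℤ.+ Y) ℤ.* F ℤ.+ d) ≡
      (M ℤ.- Y) ℤ.* d ℤ.+ (+ 1 ℤ.+ Y) ℤ.* (M ℤ.- (+ 1 ℤ.+ Y) ℤ.+ + 1) ℤ.* F
    lem = ℤ-solve-∀
  U-D : U m (slice (D f) x) v ≡ X+1 ℤ.* U m (slice f (suc x)) v ℤ.+ U m (D (slice f x)) v
  U-D = trans (U-+ m (λ u → X+1 ℤ.* f (suc x ∷ u)) (D (slice f x)) v)
              (cong (ℤ._+ U m (D (slice f x)) v) (U-* m X+1 (slice f (suc x)) v))

-- Eigenvalues of UD up to the middle degree

infix 4 _⋖_

data _⋖_ : Vec ℕ ℓ → Vec ℕ ℓ → Set where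
  here  : ∀ {x} {v : Vec ℕ ℓ} → x ∷ v ⋖ suc x ∷ v
  there : ∀ {x} {u v : Vec ℕ ℓ} → u ⋖ v → x ∷ u ⋖ x ∷ v

⋖-sum : {u v : Vec ℕ ℓ} → u ⋖ v → Vec.sum v ≡ suc (Vec.sum u)
⋖-sum here            = refl
⋖-sum (there {x = x} u⋖v) = trans (cong (_+_ x) (⋖-sum u⋖v)) (+-suc x _)

maximum : Vec ℕ ℓ → ℕ
maximum []      = 0
maximum (x ∷ v) = x ⊔ maximum v

⋖-maximum : {u v : Vec ℕ ℓ} → u ⋖ v → maximum u ≤ maximum v
⋖-maximum {v = suc x ∷ v} here = ⊔-monoˡ-≤ (maximum v) (n≤1+n x)
⋖-maximum (there {x = x} u⋖v)      = ⊔-monoʳ-≤ x (⋖-maximum u⋖v)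

D-vanishes : (f : Poly ℓ) (v : Vec ℕ ℓ) → (∀ u → v ⋖ u → f u ≡ + 0) → D f v ≡ + 0
D-vanishes f []      h = refl
D-vanishes f (x ∷ v) h = cong₂ ℤ._+_
  (trans (cong (+ suc x ℤ.*_) (h _ here)) (ℤ.*-zeroʳ (+ suc x)))
  (D-vanishes (slice f x) v (λ u v⋖u → h (x ∷ u) (there v⋖u)))

-- The coefficient m − x of the raising operator stops exponents from growing beyond m.
U-vanishes : ∀ m (f : Poly ℓ) (v : Vec ℕ ℓ) →
  (∀ u → u ⋖ v → (maximum u ≤ m → maximum v ≤ m) → f u ≡ + 0) → U m f v ≡ + 0
U-vanishes m f []      h = refl
U-vanishes m f (x ∷ v) h = cong₂ ℤ._+_ (head x h)
  (U-vanishes m (slice f x) v (λ u u⋖v bd → h (x ∷ u) (there u⋖v)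
    (λ xu≤m → ⊔-lub (m⊔n≤o⇒m≤o x _ xu≤m) (bd (m⊔n≤o⇒n≤o x _ xu≤m)))))
  where
  head : ∀ x → (∀ u → u ⋖ x ∷ v → (maximum u ≤ m → maximum (x ∷ v) ≤ m) → f u ≡ + 0) → raise m f x v ≡ + 0
  head zero    h = refl
  head (suc x) h with x ≟ m
  ... | yes refl = trans (cong (ℤ._* f (x ∷ v)) (ℤ.+-inverseʳ (+ x))) (ℤ.*-zeroˡ (f (x ∷ v)))
  ... | no  x≢m  = trans (cong ((+ m ℤ.- + x) ℤ.*_)
    (h _ here (λ xv≤m → ⊔-lub (≤∧≢⇒< (m⊔n≤o⇒m≤o x _ xv≤m) x≢m) (m⊔n≤o⇒n≤o x _ xv≤m))))
    (ℤ.*-zeroʳ (+ m ℤ.- + x))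

Homogeneous : ℕ → Poly ℓ → Set
Homogeneous k f = ∀ v → Vec.sum v ≢ k → f v ≡ + 0

-- UD has no negative eigenvalue in degrees up to ℓm/2: D carries an eigenvector to one with a smaller eigenvalue.
eigenvalue-nonnegative : ∀ m j c (f : Poly ℓ) → Homogeneous j f → 2 * j ≤ ℓ * m →
  (∀ v → U m (D f) v ℤ.+ + suc c ℤ.* f v ≡ + 0) → ∀ v → f v ≡ + 0
eigenvalue-nonnegative {ℓ} m j c f hom 2j≤ eig v = conclude (D-is-0 j hom 2j≤)
  where
  conclude : (∀ u → D f u ≡ + 0) → f v ≡ + 0
  conclude Df≡0 with ℤ.i*j≡0⇒i≡0∨j≡0 (+ suc c)
    (trans (sym (ℤ.+-identityˡ _)) (trans (cong (ℤ._+ + suc c ℤ.* f v) (sym (trans (U-cong m Df≡0 v) (U-0 m v)))) (eig v)))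
  ... | inj₂ fv≡0 = fv≡0
  D-is-0 : ∀ j → Homogeneous j f → 2 * j ≤ ℓ * m → ∀ u → D f u ≡ + 0
  D-is-0 zero    hom _   u = D-vanishes f u (λ w u⋖w → hom w (λ e → 0≢1+n (trans (sym e) (⋖-sum u⋖w))))
  D-is-0 (suc j) hom 2j≤ = eigenvalue-nonnegative m j (c + (ℓ * m ∸ 2 * j)) (D f) homD 2j≤′ eigD
    where
    homD : Homogeneous j (D f)
    homD u ne = D-vanishes f u (λ w u⋖w → hom w (λ e → ne (suc-injective (trans (sym (⋖-sum u⋖w)) e))))
    2j≤′ : 2 * j ≤ ℓ * m
    2j≤′ = ≤-trans (*-monoʳ-≤ 2 (n≤1+n j)) 2j≤
    shifted : ∀ u → weight m u ℤ.* D f u ≡ + (ℓ * m ∸ 2 * j) ℤ.* D f u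
    shifted u with Vec.sum u ≟ j
    ... | no  ne   = trans (cong (weight m u ℤ.*_) (homD u ne))
      (trans (ℤ.*-zeroʳ (weight m u)) (sym (trans (cong (+ (ℓ * m ∸ 2 * j) ℤ.*_) (homD u ne)) (ℤ.*-zeroʳ (+ (ℓ * m ∸ 2 * j))))))
    ... | yes refl = cong (ℤ._* D f u)
      (trans (weight-sum m u) (trans (ℤ.m-n≡m⊖n (ℓ * m) (2 * j)) (ℤ.⊖-≥ 2j≤′)))
    -- `D` is applied to the eigenvalue equation; moving it past `U` adds the weight ℓm - 2j, which
    -- is nonnegative, so the eigenvalue of `D f` is at least as negative as that of `f`.
    eigD : ∀ u → U m (D (D f)) u ℤ.+ + suc (c + (ℓ * m ∸ 2 * j)) ℤ.* D f u ≡ + 0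
    eigD u = begin
      U m (D (D f)) u ℤ.+ (+ suc c ℤ.+ W) ℤ.* D f u                ≡⟨ regroup (U m (D (D f)) u) (+ suc c) W (D f u) ⟩
      U m (D (D f)) u ℤ.+ W ℤ.* D f u ℤ.+ + suc c ℤ.* D f u         ≡⟨ cong (λ z → U m (D (D f)) u ℤ.+ z ℤ.+ + suc c ℤ.* D f u) (shifted u) ⟨
      U m (D (D f)) u ℤ.+ weight m u ℤ.* D f u ℤ.+ + suc c ℤ.* D f u ≡⟨ cong₂ ℤ._+_ (commutator m (D f) u) (D-* (+ suc c) f u) ⟨
      D (U m (D f)) u ℤ.+ D (λ w → + suc c ℤ.* f w) u              ≡⟨ D-+ (U m (D f)) (λ w → + suc c ℤ.* f w) u ⟨
      D (λ w → U m (D f) w ℤ.+ + suc c ℤ.* f w) u                  ≡⟨ D-cong eig u ⟩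
      D (λ _ → + 0) u                                              ≡⟨ D-0 u ⟩
      + 0                                                          ∎
      where
      open ≡-Reasoning
      W = + (ℓ * m ∸ 2 * j)
      regroup : ∀ a c w d → a ℤ.+ (c ℤ.+ w) ℤ.* d ≡ a ℤ.+ w ℤ.* d ℤ.+ c ℤ.* d
      regroup = ℤ-solve-∀

-- In degree j the commutator gives DU = UD + (ℓm - 2j) with a positive shift, so a kernel element
-- would be an eigenvector of UD with a negative eigenvalue.
DU-injective : ∀ m j (f : Poly ℓ) → Homogeneous j f → 2 * j < ℓ * m → (∀ v → D (U m f) v ≡ + 0) → ∀ v → f v ≡ + 0
DU-injective {ℓ} m j f hom 2j< DUf≡0 = eigenvalue-nonnegative m j (pred (ℓ * m ∸ 2 * j)) f hom (<⇒≤ 2j<) eig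
  where
  eig : ∀ v → U m (D f) v ℤ.+ + suc (pred (ℓ * m ∸ 2 * j)) ℤ.* f v ≡ + 0
  eig v with Vec.sum v ≟ j
  ... | yes refl = trans (cong (λ z → U m (D f) v ℤ.+ z ℤ.* f v)
                     (trans (cong +_ (suc-pred (ℓ * m ∸ 2 * j) {{>-nonZero (m<n⇒0<n∸m 2j<)}}))
                       (sym (trans (weight-sum m v) (trans (ℤ.m-n≡m⊖n (ℓ * m) (2 * j)) (ℤ.⊖-≥ (<⇒≤ 2j<)))))))
                     (trans (sym (commutator m f v)) (DUf≡0 v))
  ... | no  ne   = trans (cong (ℤ._+_ (U m (D f) v)) (trans (cong (+ suc (pred (ℓ * m ∸ 2 * j)) ℤ.*_) (hom v ne)) (ℤ.*-zeroʳ (+ suc (pred (ℓ * m ∸ 2 * j))))))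
                  (trans (cong (ℤ._+_ (U m (D f) v)) (sym (trans (cong (weight m v ℤ.*_) (hom v ne)) (ℤ.*-zeroʳ (weight m v)))))
                  (trans (sym (commutator m f v)) (DUf≡0 v)))

-- Multiplication of polynomials

antidiagonal : (ℕ → ℕ → ℤ) → ℕ → ℤ
antidiagonal F zero    = F 0 0
antidiagonal F (suc n) = F 0 (suc n) ℤ.+ antidiagonal (λ a b → F (suc a) b) n

anti-cong : ∀ {F G} n → (∀ a b → a + b ≡ n → F a b ≡ G a b) → antidiagonal F n ≡ antidiagonal G n
anti-cong zero    e = e 0 0 refl
anti-cong (suc n) e = cong₂ ℤ._+_ (e 0 (suc n) refl) (anti-cong n (λ a b ab → e (suc a) b (cong suc ab)))

anti-0 : ∀ n → antidiagonal (λ _ _ → + 0) n ≡ + 0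
anti-0 zero    = refl
anti-0 (suc n) = trans (ℤ.+-identityˡ _) (anti-0 n)

anti-+ : ∀ F G n → antidiagonal (λ a b → F a b ℤ.+ G a b) n ≡ antidiagonal F n ℤ.+ antidiagonal G n
anti-+ F G zero    = refl
anti-+ F G (suc n) = trans
  (cong (ℤ._+_ (F 0 (suc n) ℤ.+ G 0 (suc n))) (anti-+ (λ a → F (suc a)) (λ a → G (suc a)) n))
  (ℤ-interchange (F 0 (suc n)) (G 0 (suc n)) (antidiagonal (λ a → F (suc a)) n) (antidiagonal (λ a → G (suc a)) n))

anti-* : ∀ c F n → antidiagonal (λ a b → c ℤ.* F a b) n ≡ c ℤ.* antidiagonal F n
anti-* c F zero    = refl
anti-* c F (suc n) = trans (cong (ℤ._+_ (c ℤ.* F 0 (suc n))) (anti-* c (λ a → F (suc a)) n))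
  (sym (ℤ.*-distribˡ-+ c (F 0 (suc n)) (antidiagonal (λ a → F (suc a)) n)))

anti-last : ∀ F n → antidiagonal F (suc n) ≡ antidiagonal (λ a b → F a (suc b)) n ℤ.+ F (suc n) 0
anti-last F zero    = refl
anti-last F (suc n) = trans (cong (ℤ._+_ (F 0 (suc (suc n)))) (anti-last (λ a → F (suc a)) n))
  (sym (ℤ.+-assoc (F 0 (suc (suc n))) (antidiagonal (λ a b → F (suc a) (suc b)) n) (F (suc (suc n)) 0)))

anti-single : ∀ F x b → (∀ a c → a + c ≡ x + b → a ≢ x → F a c ≡ + 0) → antidiagonal F (x + b) ≡ F x b
anti-single F zero zero          h = refl
anti-single F zero (suc b)       h = trans (cong (ℤ._+_ (F 0 (suc b)))
  (trans (anti-cong b (λ a c e → h (suc a) c (cong suc e) (λ ()))) (anti-0 b))) (ℤ.+-identityʳ (F 0 (suc b)))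
anti-single F (suc x) b h = trans (cong (ℤ._+ antidiagonal (λ a → F (suc a)) (x + b)) (h 0 (suc x + b) refl (λ ())))
  (trans (ℤ.+-identityˡ _)
    (anti-single (λ a → F (suc a)) x b (λ a c e ne → h (suc a) c (cong suc e) (ne ∘ suc-injective))))

anti-swap : ∀ (F : ℕ → ℕ → ℕ → ℕ → ℤ) m n →
  antidiagonal (λ a b → antidiagonal (F a b) m) n ≡
  antidiagonal (λ c d → antidiagonal (λ a b → F a b c d) n) m
anti-swap F m zero    = refl
anti-swap F m (suc n) = trans
  (cong (ℤ._+_ (antidiagonal (F 0 (suc n)) m)) (anti-swap (λ a → F (suc a)) m n))
  (sym (anti-+ (F 0 (suc n)) (λ c d → antidiagonal (λ a b → F (suc a) b c d) n) m))

anti-weighted : ∀ F n → antidiagonal (λ a b → + a ℤ.* F a b ℤ.+ + b ℤ.* F a b) n ≡ + n ℤ.* antidiagonal F n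
anti-weighted F n = trans (anti-cong n weigh) (anti-* (+ n) F n)
  where
  weigh : ∀ a b → a + b ≡ n → + a ℤ.* F a b ℤ.+ + b ℤ.* F a b ≡ + n ℤ.* F a b
  weigh a b refl = trans (sym (ℤ.*-distribʳ-+ (F a b) (+ a) (+ b))) (cong (ℤ._* F a b) (sym (ℤ.pos-+ a b)))

-- The product rule for d/dx.
anti-derivative : ∀ F n → + suc n ℤ.* antidiagonal F (suc n) ≡
  antidiagonal (λ a b → + suc a ℤ.* F (suc a) b) n ℤ.+ antidiagonal (λ a b → + suc b ℤ.* F a (suc b)) n
anti-derivative F n = trans (sym (anti-weighted F (suc n)))
  (trans (anti-+ (λ a b → + a ℤ.* F a b) (λ a b → + b ℤ.* F a b) (suc n)) (cong₂ ℤ._+_ left right))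
  where
  left : antidiagonal (λ a b → + a ℤ.* F a b) (suc n) ≡ antidiagonal (λ a b → + suc a ℤ.* F (suc a) b) n
  left = trans (cong (ℤ._+ antidiagonal (λ a b → + suc a ℤ.* F (suc a) b) n) (ℤ.*-zeroˡ (F 0 (suc n)))) (ℤ.+-identityˡ _)
  right : antidiagonal (λ a b → + b ℤ.* F a b) (suc n) ≡ antidiagonal (λ a b → + suc b ℤ.* F a (suc b)) n
  right = trans (anti-last (λ a b → + b ℤ.* F a b) n)
    (trans (cong (ℤ._+_ (antidiagonal (λ a b → + suc b ℤ.* F a (suc b)) n)) (ℤ.*-zeroˡ (F (suc n) 0))) (ℤ.+-identityʳ _))

infixl 7 _⋆_

_⋆_ : Poly ℓ → Poly ℓ → Poly ℓ
_⋆_ {zero}  f g []      = f [] ℤ.* g []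
_⋆_ {suc _} f g (x ∷ v) = antidiagonal (λ a b → (slice f a ⋆ slice g b) v) x

⋆-cong : {f f′ g g′ : Poly ℓ} → (∀ v → f v ≡ f′ v) → (∀ v → g v ≡ g′ v) → ∀ v → (f ⋆ g) v ≡ (f′ ⋆ g′) v
⋆-cong ef eg []      = cong₂ ℤ._*_ (ef []) (eg [])
⋆-cong ef eg (x ∷ v) = anti-cong x (λ a b _ → ⋆-cong (ef ∘ (a ∷_)) (eg ∘ (b ∷_)) v)

⋆-+ˡ : (f f′ g : Poly ℓ) → ∀ v → ((λ u → f u ℤ.+ f′ u) ⋆ g) v ≡ (f ⋆ g) v ℤ.+ (f′ ⋆ g) v
⋆-+ˡ f f′ g []      = ℤ.*-distribʳ-+ (g []) (f []) (f′ [])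
⋆-+ˡ f f′ g (x ∷ v) = trans (anti-cong x (λ a b _ → ⋆-+ˡ (slice f a) (slice f′ a) (slice g b) v))
  (anti-+ (λ a b → (slice f a ⋆ slice g b) v) (λ a b → (slice f′ a ⋆ slice g b) v) x)

⋆-+ʳ : (f g g′ : Poly ℓ) → ∀ v → (f ⋆ (λ u → g u ℤ.+ g′ u)) v ≡ (f ⋆ g) v ℤ.+ (f ⋆ g′) v
⋆-+ʳ f g g′ []      = ℤ.*-distribˡ-+ (f []) (g []) (g′ [])
⋆-+ʳ f g g′ (x ∷ v) = trans (anti-cong x (λ a b _ → ⋆-+ʳ (slice f a) (slice g b) (slice g′ b) v))
  (anti-+ (λ a b → (slice f a ⋆ slice g b) v) (λ a b → (slice f a ⋆ slice g′ b) v) x)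

⋆-*ˡ : ∀ c (f g : Poly ℓ) v → ((λ u → c ℤ.* f u) ⋆ g) v ≡ c ℤ.* (f ⋆ g) v
⋆-*ˡ c f g []      = ℤ.*-assoc c (f []) (g [])
⋆-*ˡ c f g (x ∷ v) = trans (anti-cong x (λ a b _ → ⋆-*ˡ c (slice f a) (slice g b) v))
  (anti-* c (λ a b → (slice f a ⋆ slice g b) v) x)

⋆-*ʳ : ∀ c (f g : Poly ℓ) v → (f ⋆ (λ u → c ℤ.* g u)) v ≡ c ℤ.* (f ⋆ g) v
⋆-*ʳ c f g []      = lem (f []) c (g [])
  where
  lem : ∀ a c b → a ℤ.* (c ℤ.* b) ≡ c ℤ.* (a ℤ.* b)
  lem = ℤ-solve-∀
⋆-*ʳ c f g (x ∷ v) = trans (anti-cong x (λ a b _ → ⋆-*ʳ c (slice f a) (slice g b) v))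
  (anti-* c (λ a b → (slice f a ⋆ slice g b) v) x)

infixl 6 _⊞_

_⊞_ : Vec ℕ ℓ → Vec ℕ ℓ → Vec ℕ ℓ
_⊞_ = Vec.zipWith _+_

⊞-sum : (u v : Vec ℕ ℓ) → Vec.sum (u ⊞ v) ≡ Vec.sum u + Vec.sum v
⊞-sum []      []      = refl
⊞-sum (x ∷ u) (y ∷ v) = trans (cong (λ z → x + y + z) (⊞-sum u v)) (lem x y (Vec.sum u) (Vec.sum v))
  where
  lem : ∀ a b c d → a + b + (c + d) ≡ a + c + (b + d)
  lem = ℕ-solve-∀

⊞-maximum : (u v : Vec ℕ ℓ) → maximum (u ⊞ v) ≤ maximum u + maximum v
⊞-maximum []      []      = z≤n
⊞-maximum (x ∷ u) (y ∷ v) = ⊔-lub (+-mono-≤ (m≤m⊔n x _) (m≤m⊔n y _))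
  (≤-trans (⊞-maximum u v) (+-mono-≤ (m≤n⊔m x _) (m≤n⊔m y _)))

⋆-vanishes : (f g : Poly ℓ) (v : Vec ℕ ℓ) →
  (∀ u w → u ⊞ w ≡ v → f u ≡ + 0 ⊎ g w ≡ + 0) → (f ⋆ g) v ≡ + 0
⋆-vanishes f g [] h with h [] [] refl
... | inj₁ e = trans (cong (ℤ._* g []) e) (ℤ.*-zeroˡ (g []))
... | inj₂ e = trans (cong (f [] ℤ.*_) e) (ℤ.*-zeroʳ (f []))
⋆-vanishes f g (x ∷ v) h = trans (anti-cong x (λ a b ab → ⋆-vanishes (slice f a) (slice g b) v
  (λ u w uw → h (a ∷ u) (b ∷ w) (cong₂ _∷_ ab uw)))) (anti-0 x)

D-antidiagonal : (H : ℕ → ℕ → Poly ℓ) → ∀ x v →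
  D (λ u → antidiagonal (λ a b → H a b u) x) v ≡ antidiagonal (λ a b → D (H a b) v) x
D-antidiagonal H zero    v = refl
D-antidiagonal H (suc x) v = trans (D-+ (H 0 (suc x)) (λ u → antidiagonal (λ a b → H (suc a) b u) x) v)
  (cong (ℤ._+_ (D (H 0 (suc x)) v)) (D-antidiagonal (λ a → H (suc a)) x v))

leibniz : (f g : Poly ℓ) → ∀ v → D (f ⋆ g) v ≡ (D f ⋆ g) v ℤ.+ (f ⋆ D g) v
leibniz f g []      = sym (cong₂ ℤ._+_ (ℤ.*-zeroˡ (g [])) (ℤ.*-zeroʳ (f [])))
leibniz f g (x ∷ v) = begin
  + suc x ℤ.* antidiagonal (λ a b → (slice f a ⋆ slice g b) v) (suc x)
    ℤ.+ D (λ u → antidiagonal (λ a b → (slice f a ⋆ slice g b) u) x) v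
    ≡⟨ cong₂ ℤ._+_ (anti-derivative (λ a b → (slice f a ⋆ slice g b) v) x)
        (trans (D-antidiagonal (λ a b → slice f a ⋆ slice g b) x v)
          (trans (anti-cong x (λ a b _ → leibniz (slice f a) (slice g b) v))
            (anti-+ (λ a b → (D (slice f a) ⋆ slice g b) v) (λ a b → (slice f a ⋆ D (slice g b)) v) x))) ⟩
  (A₁ ℤ.+ B₁) ℤ.+ (A₂ ℤ.+ B₂)
    ≡⟨ ℤ-interchange A₁ B₁ A₂ B₂ ⟩
  (A₁ ℤ.+ A₂) ℤ.+ (B₁ ℤ.+ B₂)
    ≡⟨ cong₂ ℤ._+_ left right ⟨
  (D f ⋆ g) (x ∷ v) ℤ.+ (f ⋆ D g) (x ∷ v) ∎
  where
  open ≡-Reasoning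
  A₁ = antidiagonal (λ a b → + suc a ℤ.* (slice f (suc a) ⋆ slice g b) v) x
  B₁ = antidiagonal (λ a b → + suc b ℤ.* (slice f a ⋆ slice g (suc b)) v) x
  A₂ = antidiagonal (λ a b → (D (slice f a) ⋆ slice g b) v) x
  B₂ = antidiagonal (λ a b → (slice f a ⋆ D (slice g b)) v) x
  left : (D f ⋆ g) (x ∷ v) ≡ A₁ ℤ.+ A₂
  left = trans (anti-cong x (λ a b _ → trans
      (⋆-+ˡ (λ u → + suc a ℤ.* f (suc a ∷ u)) (D (slice f a)) (slice g b) v)
      (cong (ℤ._+ (D (slice f a) ⋆ slice g b) v) (⋆-*ˡ (+ suc a) (slice f (suc a)) (slice g b) v))))
    (anti-+ (λ a b → + suc a ℤ.* (slice f (suc a) ⋆ slice g b) v) (λ a b → (D (slice f a) ⋆ slice g b) v) x)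
  right : (f ⋆ D g) (x ∷ v) ≡ B₁ ℤ.+ B₂
  right = trans (anti-cong x (λ a b _ → trans
      (⋆-+ʳ (slice f a) (λ u → + suc b ℤ.* g (suc b ∷ u)) (D (slice g b)) v)
      (cong (ℤ._+ (slice f a ⋆ D (slice g b)) v) (⋆-*ʳ (+ suc b) (slice f a) (slice g (suc b)) v))))
    (anti-+ (λ a b → + suc b ℤ.* (slice f a ⋆ slice g (suc b)) v) (λ a b → (slice f a ⋆ D (slice g b)) v) x)

-- v is the lexicographically least exponent of f.
Leading : Poly ℓ → Vec ℕ ℓ → Set
Leading f []      = f [] ≢ + 0
Leading f (x ∷ v) = (∀ a → a < x → ∀ u → f (a ∷ u) ≡ + 0) × Leading (slice f x) v

-- The bound on the exponents makes the search for a least exponent finite, so the alternative can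
-- be decided.
zero-or-leading : ∀ m (f : Poly ℓ) → (∀ v → f v ≢ + 0 → maximum v ≤ m) → (∀ v → f v ≡ + 0) ⊎ ∃ (Leading f)
zero-or-leading {zero}  m f bounded with f [] ℤ.≟ + 0
... | yes e  = inj₁ (λ { [] → e })
... | no  ne = inj₂ ([] , ne)
zero-or-leading {suc _} m f bounded = [ (λ low → inj₁ λ { (x ∷ v) → all low x v }) , inj₂ ]′ (search (suc m))
  where
  search : ∀ n → (∀ a → a < n → ∀ u → f (a ∷ u) ≡ + 0) ⊎ ∃ (Leading f)
  search zero    = inj₁ (λ _ ())
  search (suc n) with search n
  ... | inj₂ l   = inj₂ l
  ... | inj₁ low with zero-or-leading m (slice f n) (λ v ne → m⊔n≤o⇒n≤o n _ (bounded (n ∷ v) ne))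
  ...   | inj₂ (v , l) = inj₂ (n ∷ v , low , l)
  ...   | inj₁ z       = inj₁ λ a a≤n u → [ (λ a<n → low a a<n u) , (λ { refl → z u }) ]′ (m≤n⇒m<n∨m≡n (≤-pred a≤n))
  all : (∀ a → a < suc m → ∀ u → f (a ∷ u) ≡ + 0) → ∀ x v → f (x ∷ v) ≡ + 0
  all low x v with f (x ∷ v) ℤ.≟ + 0
  ... | yes e  = e
  ... | no  ne = low x (s≤s (m⊔n≤o⇒m≤o x _ (bounded (x ∷ v) ne))) v

-- Strong induction on the exponent `b` of the first variable in `g`. In the slice at `x + b` of the
-- product, any other pair of slices has a factor from `f` below `x` or a factor from `g` below `b`,
-- hence vanishes; the surviving product has one variable less.
⋆-cancel : (f g : Poly ℓ) → ∀ v → Leading f v → (∀ u → (f ⋆ g) u ≡ + 0) → ∀ u → g u ≡ + 0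
⋆-cancel f g []      f≢0 fg≡0 [] with ℤ.i*j≡0⇒i≡0∨j≡0 (f []) (fg≡0 [])
... | inj₁ e = contradiction e f≢0
... | inj₂ e = e
⋆-cancel f g (x ∷ v) (low , lead) fg≡0 (b ∷ u) = <-rec (λ b → ∀ u → g (b ∷ u) ≡ + 0) step b u
  where
  step : ∀ b → (∀ {c} → c < b → ∀ u → g (c ∷ u) ≡ + 0) → ∀ u → g (b ∷ u) ≡ + 0
  step b ih = ⋆-cancel (slice f x) (slice g b) v lead (λ u →
    trans (sym (anti-single (λ a c → (slice f a ⋆ slice g c) u) x b (other u))) (fg≡0 (x + b ∷ u)))
    where
    other : ∀ u a c → a + c ≡ x + b → a ≢ x → (slice f a ⋆ slice g c) u ≡ + 0
    other u a c e a≢x with <-cmp a x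
    ... | tri< a<x _ _ = ⋆-vanishes (slice f a) (slice g c) u (λ w _ _ → inj₁ (low a a<x w))
    ... | tri≈ _ a≡x _ = contradiction a≡x a≢x
    ... | tri> _ _ x<a = ⋆-vanishes (slice f a) (slice g c) u (λ _ w _ → inj₂ (ih c<b w))
      where
      c<b : c < b
      c<b = +-cancelˡ-< x c b (<-≤-trans (+-monoˡ-< c x<a) (≤-reflexive e))

-- Partitions in a box

boxVecs-suc : ∀ ℓ m → boxVecs (suc ℓ) m ≡ cartesianProductWith _∷_ (upTo (suc m)) (boxVecs ℓ m)
boxVecs-suc ℓ m = go (upTo (suc m))
  where
  go : ∀ xs → concatMap (λ x → map (x ∷_) (boxVecs ℓ m)) xs ≡ cartesianProductWith _∷_ xs (boxVecs ℓ m)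
  go []       = refl
  go (x ∷ xs) = cong (map (x ∷_) (boxVecs ℓ m) ++_) (go xs)

boxVecs-unique : ∀ ℓ m → Unique (boxVecs ℓ m)
boxVecs-unique zero    m = [] ∷ []
boxVecs-unique (suc ℓ) m = subst Unique (sym (boxVecs-suc ℓ m))
  (Unique.cartesianProductWith⁺ _∷_ Vec.∷-injective (Unique.upTo⁺ (suc m)) (boxVecs-unique ℓ m))

∈-boxVecs⁺ : ∀ {m} (v : Vec ℕ ℓ) → maximum v ≤ m → v ∈ boxVecs ℓ m
∈-boxVecs⁺         []      _  = here refl
∈-boxVecs⁺ {suc ℓ} {m} (x ∷ v) le = subst (x ∷ v ∈_) (sym (boxVecs-suc ℓ m))
  (∈-cartesianProductWith⁺ _∷_ (∈-upTo⁺ (s≤s (m⊔n≤o⇒m≤o x _ le))) (∈-boxVecs⁺ v (m⊔n≤o⇒n≤o x _ le)))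

∈-boxVecs⁻ : ∀ {m} (v : Vec ℕ ℓ) → v ∈ boxVecs ℓ m → maximum v ≤ m
∈-boxVecs⁻         []      _  = z≤n
∈-boxVecs⁻ {suc ℓ} {m} v v∈ with ∈-cartesianProductWith⁻ _∷_ (upTo (suc m)) (boxVecs ℓ m) (subst (v ∈_) (boxVecs-suc ℓ m) v∈)
... | x , w , x∈ , w∈ , refl = ⊔-lub (≤-pred (∈-upTo⁻ x∈)) (∈-boxVecs⁻ w w∈)

record IsPartition (n m : ℕ) {ℓ} (v : Vec ℕ ℓ) : Set where
  constructor isPartition
  field
    decreasing : nonincreasing v ≡ true
    bounded    : maximum v ≤ m
    size       : Vec.sum v ≡ n

private
  test : ℕ → Vec ℕ ℓ → Bool
  test n v = nonincreasing v ∧ (Vec.sum v ≡ᵇ n)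

partitions : ∀ n ℓ m → List (Vec ℕ ℓ)
partitions n ℓ m = filter (λ v → test n v Bool.≟ true) (boxVecs ℓ m)

length-partitions : ∀ n ℓ m → length (partitions n ℓ m) ≡ p n ℓ m
length-partitions n ℓ m = go (boxVecs ℓ m)
  where
  go : ∀ vs → length (filter (λ v → test n v Bool.≟ true) vs) ≡ count (test n) vs
  go []       = refl
  go (v ∷ vs) with test n v
  ... | true  = cong suc (go vs)
  ... | false = go vs

partitions-unique : ∀ n ℓ m → Unique (partitions n ℓ m)
partitions-unique n ℓ m = Unique.filter⁺ (λ v → test n v Bool.≟ true) (boxVecs-unique ℓ m)

∈-partitions⁺ : ∀ {n m} {v : Vec ℕ ℓ} → IsPartition n m v → v ∈ partitions n ℓ m
∈-partitions⁺ {n = n} {v = v} (isPartition dec bd size) = ∈-filter⁺ (λ v → test n v Bool.≟ true) (∈-boxVecs⁺ v bd)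
  (cong₂ _∧_ dec (Equivalence.to T-≡ (≡⇒≡ᵇ (Vec.sum v) n size)))

∈-partitions⁻ : ∀ {n m} {v : Vec ℕ ℓ} → v ∈ partitions n ℓ m → IsPartition n m v
∈-partitions⁻ {ℓ = ℓ} {n = n} {m} {v} v∈ =
  let v∈box , ok = ∈-filter⁻ (λ v → test n v Bool.≟ true) {xs = boxVecs ℓ m} v∈ in
  isPartition (∧-conicalˡ (nonincreasing v) _ ok) (∈-boxVecs⁻ v v∈box)
    (≡ᵇ⇒≡ (Vec.sum v) n (Equivalence.from T-≡ (∧-conicalʳ (nonincreasing v) _ ok)))

nonincreasing-∷⁺ : ∀ {x} (v : Vec ℕ ℓ) → maximum v ≤ x → nonincreasing v ≡ true → nonincreasing (x ∷ v) ≡ true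
nonincreasing-∷⁺ []      _  _   = refl
nonincreasing-∷⁺ (y ∷ v) le dec = cong₂ _∧_ (Equivalence.to T-≡ (≤⇒≤ᵇ (m⊔n≤o⇒m≤o y _ le))) dec

nonincreasing-tail : ∀ {x} (v : Vec ℕ ℓ) → nonincreasing (x ∷ v) ≡ true → nonincreasing v ≡ true
nonincreasing-tail         []      _ = refl
nonincreasing-tail {x = x} (y ∷ v) e = ∧-conicalʳ (y ≤ᵇ x) _ e

nonincreasing-head : ∀ {x} (v : Vec ℕ ℓ) → nonincreasing (x ∷ v) ≡ true → maximum v ≤ x
nonincreasing-head         []      _ = z≤n
nonincreasing-head {x = x} (y ∷ v) e = ⊔-lub y≤x (≤-trans (nonincreasing-head v (nonincreasing-tail {x = x} (y ∷ v) e)) y≤x)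
  where
  y≤x : y ≤ x
  y≤x = ≤ᵇ⇒≤ y x (Equivalence.from T-≡ (∧-conicalˡ (y ≤ᵇ x) _ e))

unique-same-length : {A : Set} {xs ys : List A} → Unique xs → Unique ys →
  (∀ {x} → x ∈ xs → x ∈ ys) → (∀ {x} → x ∈ ys → x ∈ xs) → length xs ≡ length ys
unique-same-length ux uy to from = ↭-length (∼bag⇒↭ (unique∧set⇒bag ux uy (mk⇔ to from)))

p-no-parts : ∀ n m → p n 0 m ≡ (if 0 ≡ᵇ n then 1 else 0)
p-no-parts zero    m = refl
p-no-parts (suc n) m = refl

p-no-columns : ∀ n ℓ → p n (suc ℓ) 0 ≡ p n ℓ 0
p-no-columns n ℓ = trans (sym (length-partitions n (suc ℓ) 0)) (trans
  (unique-same-length (partitions-unique n (suc ℓ) 0) (Unique.map⁺ Vec.∷-injectiveʳ (partitions-unique n ℓ 0)) to from)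
  (trans (length-map (0 ∷_) (partitions n ℓ 0)) (length-partitions n ℓ 0)))
  where
  to : ∀ {v} → v ∈ partitions n (suc ℓ) 0 → v ∈ map (0 ∷_) (partitions n ℓ 0)
  to {x ∷ v} v∈ with ∈-partitions⁻ v∈
  ... | isPartition dec bd size with m⊔n≤o⇒m≤o x (maximum v) bd
  ... | z≤n = ∈-map⁺ (0 ∷_) (∈-partitions⁺ (isPartition (nonincreasing-tail v dec) bd size))
  from : ∀ {v} → v ∈ map (0 ∷_) (partitions n ℓ 0) → v ∈ partitions n (suc ℓ) 0
  from v∈ with ∈-map⁻ (0 ∷_) v∈
  ... | v , v∈′ , refl with ∈-partitions⁻ v∈′
  ... | isPartition dec bd size = ∈-partitions⁺ (isPartition (nonincreasing-∷⁺ v bd dec) bd size)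

-- The two classes behind the q-Pascal rule: partitions with all parts at most `m`, and partitions
-- whose first part is `suc m`.
module LargestPart (n ℓ m : ℕ) where

  without : List (Vec ℕ (suc ℓ))
  without = partitions n (suc ℓ) m

  with-part : ∀ k → List (Vec ℕ (suc ℓ))
  with-part k = map (suc m ∷_) (partitions k ℓ (suc m))

  with-part⁻ : ∀ {k v} → v ∈ with-part k → suc m ≤ maximum v × IsPartition (suc m + k) (suc m) v
  with-part⁻ v∈ with ∈-map⁻ (suc m ∷_) v∈
  ... | v , v∈′ , refl with ∈-partitions⁻ v∈′
  ... | isPartition dec bd size = m≤m⊔n (suc m) (maximum v) ,
    isPartition (nonincreasing-∷⁺ v bd dec) (⊔-lub ≤-refl bd) (cong (_+_ (suc m)) size)

  without⇒ : ∀ {v} → v ∈ without → v ∈ partitions n (suc ℓ) (suc m)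
  without⇒ v∈ with ∈-partitions⁻ v∈
  ... | isPartition dec bd size = ∈-partitions⁺ (isPartition dec (m≤n⇒m≤1+n bd) size)

  disjoint : ∀ {k v} → ¬ (v ∈ without × v ∈ with-part k)
  disjoint (v∈ , v∈′) = <⇒≱ (proj₁ (with-part⁻ v∈′)) (IsPartition.bounded (∈-partitions⁻ v∈))

  split : ∀ {v} → v ∈ partitions n (suc ℓ) (suc m) →
    v ∈ without ⊎ Σ[ w ∈ Vec ℕ ℓ ] v ≡ suc m ∷ w × suc m + Vec.sum w ≡ n × w ∈ partitions (Vec.sum w) ℓ (suc m)
  split {x ∷ v} v∈ with ∈-partitions⁻ v∈
  ... | isPartition dec bd size with m≤n⇒m<n∨m≡n (m⊔n≤o⇒m≤o x _ bd)
  ...   | inj₁ (s≤s x≤m) = inj₁ (∈-partitions⁺ (isPartition dec (⊔-lub x≤m (≤-trans (nonincreasing-head v dec) x≤m)) size))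
  ...   | inj₂ refl      = inj₂ (v , refl , size ,
    ∈-partitions⁺ (isPartition (nonincreasing-tail v dec) (nonincreasing-head v dec) refl))

p-largest-part-< : ∀ n ℓ m → n < suc m → p n (suc ℓ) (suc m) ≡ p n (suc ℓ) m
p-largest-part-< n ℓ m n<m = trans (sym (length-partitions n (suc ℓ) (suc m))) (trans
  (unique-same-length (partitions-unique n (suc ℓ) (suc m)) (partitions-unique n (suc ℓ) m) to without⇒)
  (length-partitions n (suc ℓ) m))
  where
  open LargestPart n ℓ m
  to : ∀ {v} → v ∈ partitions n (suc ℓ) (suc m) → v ∈ without
  to v∈ with split v∈
  ... | inj₁ v∈′              = v∈′
  ... | inj₂ (w , _ , e , _)  = contradiction (≤-trans (m≤m+n (suc m) (Vec.sum w)) (≤-reflexive e)) (<⇒≱ n<m)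

p-largest-part : ∀ k ℓ m → p (suc m + k) (suc ℓ) (suc m) ≡ p (suc m + k) (suc ℓ) m + p k ℓ (suc m)
p-largest-part k ℓ m = trans (sym (length-partitions n (suc ℓ) (suc m))) (trans
  (unique-same-length (partitions-unique n (suc ℓ) (suc m))
    (Unique.++⁺ (partitions-unique n (suc ℓ) m) (Unique.map⁺ Vec.∷-injectiveʳ (partitions-unique k ℓ (suc m))) disjoint) to from)
  (trans (length-++ without) (cong₂ _+_ (length-partitions n (suc ℓ) m)
    (trans (length-map (suc m ∷_) (partitions k ℓ (suc m))) (length-partitions k ℓ (suc m))))))
  where
  n = suc m + k
  open LargestPart n ℓ m
  to : ∀ {v} → v ∈ partitions n (suc ℓ) (suc m) → v ∈ without ++ with-part k
  to v∈ with split v∈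
  ... | inj₁ v∈′                 = ∈-++⁺ˡ v∈′
  ... | inj₂ (w , refl , e , w∈) = ∈-++⁺ʳ without (∈-map⁺ (suc m ∷_)
    (subst (λ s → w ∈ partitions s ℓ (suc m)) (+-cancelˡ-≡ (suc m) (Vec.sum w) k e) w∈))
  from : ∀ {v} → v ∈ without ++ with-part k → v ∈ partitions n (suc ℓ) (suc m)
  from v∈ with ∈-++⁻ without v∈
  ... | inj₁ v∈′ = without⇒ v∈′
  ... | inj₂ v∈′ = ∈-partitions⁺ (proj₂ (with-part⁻ v∈′))

-- Symmetric polynomials

HeadSwap : Poly ℓ → Set
HeadSwap {zero}        f = ⊤
HeadSwap {suc zero}    f = ⊤
HeadSwap {suc (suc _)} f = ∀ x y v → f (x ∷ y ∷ v) ≡ f (y ∷ x ∷ v)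

-- Invariance under adjacent transpositions, which generate the symmetric group: the first is
-- `HeadSwap`, the others come from the slices.
Symmetric : Poly ℓ → Set
Symmetric {zero}  f = ⊤
Symmetric {suc _} f = HeadSwap f × (∀ x → Symmetric (slice f x))

symmetric-+ : {f g : Poly ℓ} → Symmetric f → Symmetric g → Symmetric (λ v → f v ℤ.+ g v)
symmetric-+ {zero}        _        _          = tt
symmetric-+ {suc zero}    (_ , fs) (_ , gs)   = tt , λ _ → tt
symmetric-+ {suc (suc _)} (hf , fs) (hg , gs) =
  (λ x y v → cong₂ ℤ._+_ (hf x y v) (hg x y v)) , λ x → symmetric-+ (fs x) (gs x)

symmetric-* : ∀ c {f : Poly ℓ} → Symmetric f → Symmetric (λ v → c ℤ.* f v)
symmetric-* {zero}        c _         = tt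
symmetric-* {suc zero}    c (_ , fs)  = tt , λ _ → tt
symmetric-* {suc (suc _)} c (hf , fs) = (λ x y v → cong (c ℤ.*_) (hf x y v)) , λ x → symmetric-* c (fs x)

symmetric-0 : Symmetric {ℓ} (λ _ → + 0)
symmetric-0 {zero}        = tt
symmetric-0 {suc zero}    = tt , λ _ → tt
symmetric-0 {suc (suc ℓ)} = (λ _ _ _ → refl) , λ _ → symmetric-0 {suc ℓ}

symmetric-D : (f : Poly ℓ) → Symmetric f → Symmetric (D f)
symmetric-D {zero}  f _         = tt
symmetric-D {suc ℓ} f (hf , fs) = swap ℓ f hf , λ x → symmetric-+ (symmetric-* (+ suc x) (fs (suc x))) (symmetric-D (slice f x) (fs x))
  where
  swap : ∀ ℓ (f : Poly (suc ℓ)) → HeadSwap f → HeadSwap (D f)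
  swap zero    f hf = tt
  swap (suc _) f hf x y v = trans
    (cong₂ ℤ._+_ (cong (+ suc x ℤ.*_) (hf (suc x) y v))
      (cong₂ ℤ._+_ (cong (+ suc y ℤ.*_) (hf x (suc y) v)) (D-cong (hf x y) v)))
    (lem (+ suc x ℤ.* f (y ∷ suc x ∷ v)) (+ suc y ℤ.* f (suc y ∷ x ∷ v)) (D (λ u → f (y ∷ x ∷ u)) v))
    where
    lem : ∀ a b c → a ℤ.+ (b ℤ.+ c) ≡ b ℤ.+ (a ℤ.+ c)
    lem = ℤ-solve-∀

symmetric-U : ∀ m (f : Poly ℓ) → Symmetric f → Symmetric (U m f)
symmetric-U {zero}  m f _         = tt
symmetric-U {suc ℓ} m f (hf , fs) = swap ℓ f hf , λ x → symmetric-+ (raised x) (symmetric-U m (slice f x) (fs x))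
  where
  raised : ∀ x → Symmetric (raise m f x)
  raised zero    = symmetric-0 {ℓ}
  raised (suc x) = symmetric-* (+ m ℤ.- + x) (fs x)
  swap : ∀ ℓ (f : Poly (suc ℓ)) → HeadSwap f → HeadSwap (U m f)
  swap zero    f hf = tt
  swap (suc _) f hf x y v = trans
    (cong₂ ℤ._+_ (outer x y) (cong₂ ℤ._+_ (sym (outer′ y x)) (U-cong m (hf x y) v)))
    (lem (raise m (slice f y) x v) (raise m f y (x ∷ v)) (U m (λ u → f (y ∷ x ∷ u)) v))
    where
    lem : ∀ a b c → a ℤ.+ (b ℤ.+ c) ≡ b ℤ.+ (a ℤ.+ c)
    lem = ℤ-solve-∀
    outer : ∀ x y → raise m f x (y ∷ v) ≡ raise m (slice f y) x v
    outer zero    y = refl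
    outer (suc x) y = cong ((+ m ℤ.- + x) ℤ.*_) (hf x y v)
    outer′ : ∀ y x → raise m f y (x ∷ v) ≡ raise m (slice f x) y v
    outer′ = outer

symmetric-antidiagonal : (H : ℕ → ℕ → Poly ℓ) → (∀ a b → Symmetric (H a b)) →
  ∀ x → Symmetric (λ v → antidiagonal (λ a b → H a b v) x)
symmetric-antidiagonal H s zero    = s 0 0
symmetric-antidiagonal H s (suc x) = symmetric-+ (s 0 (suc x)) (symmetric-antidiagonal (λ a → H (suc a)) (s ∘ suc) x)

symmetric-⋆ : (f g : Poly ℓ) → Symmetric f → Symmetric g → Symmetric (f ⋆ g)
symmetric-⋆ {zero}  f g _         _         = tt
symmetric-⋆ {suc ℓ} f g (hf , fs) (hg , gs) = swap ℓ f g hf hg ,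
  symmetric-antidiagonal (λ a b → slice f a ⋆ slice g b) (λ a b → symmetric-⋆ (slice f a) (slice g b) (fs a) (gs b))
  where
  swap : ∀ ℓ (f g : Poly (suc ℓ)) → HeadSwap f → HeadSwap g → HeadSwap (f ⋆ g)
  swap zero    f g hf hg = tt
  swap (suc _) f g hf hg x y v = trans
    (anti-swap (λ a b c d → (slice (slice f a) c ⋆ slice (slice g b) d) v) y x)
    (anti-cong y (λ c d _ → anti-cong x (λ a b _ → ⋆-cong (hf a c) (hg b d) v)))

-- Sorting exponent vectors

insert : ℕ → Vec ℕ ℓ → Vec ℕ (suc ℓ)
insert x []      = x ∷ []
insert x (y ∷ v) = if y ≤ᵇ x then x ∷ y ∷ v else y ∷ insert x v

sort : Vec ℕ ℓ → Vec ℕ ℓ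
sort []      = []
sort (x ∷ v) = insert x (sort v)

insert-≤ : ∀ {x y} (v : Vec ℕ ℓ) → y ≤ x → insert x (y ∷ v) ≡ x ∷ y ∷ v
insert-≤ {x = x} {y} v y≤x rewrite Equivalence.to T-≡ (≤⇒≤ᵇ y≤x) = refl

insert-> : ∀ {x y} (v : Vec ℕ ℓ) → x < y → insert x (y ∷ v) ≡ y ∷ insert x v
insert-> {x = x} {y} v x<y with y ≤ᵇ x in eq
... | false = refl
... | true  = contradiction (≤ᵇ⇒≤ y x (Equivalence.from T-≡ eq)) (<⇒≱ x<y)

insert-comm : ∀ x y (v : Vec ℕ ℓ) → insert x (insert y v) ≡ insert y (insert x v)
insert-comm x y [] with <-cmp x y
... | tri< x<y _ _  = trans (insert-> [] x<y) (sym (insert-≤ [] (<⇒≤ x<y)))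
... | tri≈ _ refl _ = refl
... | tri> _ _ y<x  = trans (insert-≤ [] (<⇒≤ y<x)) (sym (insert-> [] y<x))
insert-comm x y (z ∷ v) with z ≤? x | z ≤? y
... | yes z≤x | yes z≤y = trans (cong (insert x) (insert-≤ v z≤y)) (trans both (sym (cong (insert y) (insert-≤ v z≤x))))
  where
  both : insert x (y ∷ z ∷ v) ≡ insert y (x ∷ z ∷ v)
  both with <-cmp x y
  ... | tri< x<y _ _  = trans (insert-> (z ∷ v) x<y) (trans (cong (y ∷_) (insert-≤ v z≤x)) (sym (insert-≤ (z ∷ v) (<⇒≤ x<y))))
  ... | tri≈ _ refl _ = refl
  ... | tri> _ _ y<x  = trans (insert-≤ (z ∷ v) (<⇒≤ y<x)) (sym (trans (insert-> (z ∷ v) y<x) (cong (x ∷_) (insert-≤ v z≤y))))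
... | yes z≤x | no  z≰y = trans (cong (insert x) (insert-> v (≰⇒> z≰y))) (trans (insert-≤ (insert y v) z≤x)
  (sym (trans (cong (insert y) (insert-≤ v z≤x)) (trans (insert-> (z ∷ v) (<-≤-trans (≰⇒> z≰y) z≤x))
    (cong (x ∷_) (insert-> v (≰⇒> z≰y)))))))
... | no  z≰x | yes z≤y = sym (trans (cong (insert y) (insert-> v (≰⇒> z≰x))) (trans (insert-≤ (insert x v) z≤y)
  (sym (trans (cong (insert x) (insert-≤ v z≤y)) (trans (insert-> (z ∷ v) (<-≤-trans (≰⇒> z≰x) z≤y))
    (cong (y ∷_) (insert-> v (≰⇒> z≰x))))))))
... | no  z≰x | no  z≰y = trans (cong (insert x) (insert-> v (≰⇒> z≰y))) (trans (insert-> (insert y v) (≰⇒> z≰x))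
  (trans (cong (z ∷_) (insert-comm x y v))
  (sym (trans (cong (insert y) (insert-> v (≰⇒> z≰x))) (insert-> (insert x v) (≰⇒> z≰y))))))

insert-sum : ∀ x (v : Vec ℕ ℓ) → Vec.sum (insert x v) ≡ x + Vec.sum v
insert-sum x []      = refl
insert-sum x (y ∷ v) with y ≤ᵇ x
... | true  = refl
... | false = trans (cong (_+_ y) (insert-sum x v)) (lem y x (Vec.sum v))
  where
  lem : ∀ a b c → a + (b + c) ≡ b + (a + c)
  lem = ℕ-solve-∀

insert-maximum : ∀ x (v : Vec ℕ ℓ) → maximum (insert x v) ≡ x ⊔ maximum v
insert-maximum x []      = refl
insert-maximum x (y ∷ v) with y ≤ᵇ x
... | true  = refl
... | false = trans (cong (y ⊔_) (insert-maximum x v))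
  (trans (sym (⊔-assoc y x (maximum v))) (trans (cong (_⊔ maximum v) (⊔-comm y x)) (⊔-assoc x y (maximum v))))

insert-nonincreasing : ∀ x (v : Vec ℕ ℓ) → nonincreasing v ≡ true → nonincreasing (insert x v) ≡ true
insert-nonincreasing x []      _   = refl
insert-nonincreasing x (y ∷ v) dec with y ≤? x
... | yes y≤x rewrite insert-≤ v y≤x = cong₂ _∧_ (Equivalence.to T-≡ (≤⇒≤ᵇ y≤x)) dec
... | no  y≰x rewrite insert-> v (≰⇒> y≰x) = nonincreasing-∷⁺ (insert x v)
  (≤-trans (≤-reflexive (insert-maximum x v)) (⊔-lub (<⇒≤ (≰⇒> y≰x)) (nonincreasing-head v dec)))
  (insert-nonincreasing x v (nonincreasing-tail v dec))

sort-sum : (v : Vec ℕ ℓ) → Vec.sum (sort v) ≡ Vec.sum v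
sort-sum []      = refl
sort-sum (x ∷ v) = trans (insert-sum x (sort v)) (cong (_+_ x) (sort-sum v))

sort-maximum : (v : Vec ℕ ℓ) → maximum (sort v) ≡ maximum v
sort-maximum []      = refl
sort-maximum (x ∷ v) = trans (insert-maximum x (sort v)) (cong (x ⊔_) (sort-maximum v))

sort-nonincreasing : (v : Vec ℕ ℓ) → nonincreasing (sort v) ≡ true
sort-nonincreasing []      = refl
sort-nonincreasing (x ∷ v) = insert-nonincreasing x (sort v) (sort-nonincreasing v)

nonincreasing-sort : (v : Vec ℕ ℓ) → nonincreasing v ≡ true → sort v ≡ v
nonincreasing-sort []          _   = refl
nonincreasing-sort (x ∷ [])    _   = refl
nonincreasing-sort (x ∷ y ∷ v) dec = trans (cong (insert x) (nonincreasing-sort (y ∷ v) (nonincreasing-tail {x = x} (y ∷ v) dec)))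
  (insert-≤ v (m⊔n≤o⇒m≤o y _ (nonincreasing-head (y ∷ v) dec)))

-- `c ∘ sort` is the combination of monomial symmetric functions with coefficients `c`. This is how
-- a list of unknowns indexed by partitions becomes a symmetric polynomial.
symmetric-∘sort : (c : Poly ℓ) → Symmetric (c ∘ sort)
symmetric-∘sort {zero}        c = tt
symmetric-∘sort {suc zero}    c = tt , λ x → symmetric-∘sort (c ∘ insert x)
symmetric-∘sort {suc (suc _)} c = (λ x y v → cong c (insert-comm x y (sort v))) , λ x → symmetric-∘sort (c ∘ insert x)

symmetric-insert : (f : Poly (suc ℓ)) → Symmetric f → ∀ x v → f (x ∷ v) ≡ f (insert x v)
symmetric-insert f _         x []      = refl
symmetric-insert f (hf , fs) x (y ∷ v) with y ≤ᵇ x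
... | true  = refl
... | false = trans (hf x y v) (symmetric-insert (slice f y) (fs y) x v)

symmetric-sort : (f : Poly ℓ) → Symmetric f → ∀ v → f v ≡ f (sort v)
symmetric-sort f _            []      = refl
symmetric-sort f sf@(_ , fs) (x ∷ v) = trans (symmetric-sort (slice f x) (fs x) v) (symmetric-insert f sf x (sort v))

-- Products of highest weight vectors

-- The value at `n − 1`, and 0 for `n = 0`. With truncated subtraction the difference in degree 0
-- would be 0 instead of 1, and `zero-strict` would fail.
pPred : (n ℓ m : ℕ) → ℕ
pPred zero    ℓ m = 0
pPred (suc n) ℓ m = p n ℓ m

partitionsPred : (n ℓ m : ℕ) → List (Vec ℕ ℓ)
partitionsPred zero    ℓ m = []
partitionsPred (suc n) ℓ m = partitions n ℓ m

length-partitionsPred : ∀ n ℓ m → length (partitionsPred n ℓ m) ≡ pPred n ℓ m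
length-partitionsPred zero    ℓ m = refl
length-partitionsPred (suc n) ℓ m = length-partitions n ℓ m

partitionsPred-unique : ∀ n ℓ m → Unique (partitionsPred n ℓ m)
partitionsPred-unique zero    ℓ m = []
partitionsPred-unique (suc n) ℓ m = partitions-unique n ℓ m

∈-partitions-sort : ∀ {n m} {v : Vec ℕ ℓ} → v ∈ partitions n ℓ m → sort v ≡ v
∈-partitions-sort {v = v} v∈ = nonincreasing-sort v (IsPartition.decreasing (∈-partitions⁻ v∈))

∈-partitionsPred-sort : ∀ {n m} {v : Vec ℕ ℓ} → v ∈ partitionsPred n ℓ m → sort v ≡ v
∈-partitionsPred-sort {n = suc _} = ∈-partitions-sort

Supported : (k m : ℕ) → Poly ℓ → Set
Supported k m f = ∀ v → f v ≢ + 0 → maximum v ≤ m × Vec.sum v ≡ k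

-- Degree `k − 1`, phrased with `suc` so that for `k = 0` only the zero polynomial qualifies.
SupportedPred : (k m : ℕ) → Poly ℓ → Set
SupportedPred k m f = ∀ v → f v ≢ + 0 → maximum v ≤ m × suc (Vec.sum v) ≡ k

supported : ∀ {k m} (f : Poly ℓ) → (∀ v → ¬ (maximum v ≤ m × Vec.sum v ≡ k) → f v ≡ + 0) → Supported k m f
supported {k = k} {m} f h v ne with maximum v ≤? m | Vec.sum v ≟ k
... | yes bd | yes size = bd , size
... | no ¬bd | _        = contradiction (h v (¬bd ∘ proj₁)) ne
... | yes _  | no ¬size = contradiction (h v (¬size ∘ proj₂)) ne

nonzero-case : ∀ (z : ℤ) → (z ≢ + 0 → z ≡ + 0) → z ≡ + 0
nonzero-case z h with z ℤ.≟ + 0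
... | yes e = e
... | no ne = h ne

determined : ∀ {k m} (f : Poly ℓ) → Symmetric f → Supported k m f →
  All (λ b → f b ≡ + 0) (partitions k ℓ m) → ∀ v → f v ≡ + 0
determined f sym-f supp zero-on v = nonzero-case (f v) λ ne →
  let bd , size = supp v ne in
  trans (symmetric-sort f sym-f v) (All.lookup zero-on (∈-partitions⁺
    (isPartition (sort-nonincreasing v) (≤-trans (≤-reflexive (sort-maximum v)) bd) (trans (sort-sum v) size))))

determinedPred : ∀ {k m} (f : Poly ℓ) → Symmetric f → SupportedPred k m f →
  All (λ b → f b ≡ + 0) (partitionsPred k ℓ m) → ∀ v → f v ≡ + 0
determinedPred {k = zero}  f _     supp _ v = nonzero-case (f v) λ ne → contradiction (sym (proj₂ (supp v ne))) 0≢1+n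
determinedPred {k = suc k} f sym-f supp   = determined f sym-f (λ v ne → let bd , e = supp v ne in bd , suc-injective e)

sort-supported : ∀ {k m} (c : Poly ℓ) → (∀ v → c v ≢ + 0 → v ∈ partitions k ℓ m) → Supported k m (c ∘ sort)
sort-supported c supp v ne with ∈-partitions⁻ (supp (sort v) ne)
... | isPartition _ bd size = ≤-trans (≤-reflexive (sym (sort-maximum v))) bd , trans (sym (sort-sum v)) size

sort-supportedPred : ∀ {k m} (c : Poly ℓ) → (∀ v → c v ≢ + 0 → v ∈ partitionsPred k ℓ m) → SupportedPred k m (c ∘ sort)
sort-supportedPred {k = zero}  c supp v ne = contradiction (supp (sort v) ne) λ ()
sort-supportedPred {k = suc k} c supp v ne = let bd , size = sort-supported c supp v ne in bd , cong suc size

D-supported : ∀ {k m} (f : Poly ℓ) → Supported k m f → SupportedPred k m (D f)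
D-supported {k = k} {m} f supp v ne with maximum v ≤? m | suc (Vec.sum v) ≟ k
... | yes bd | yes size = bd , size
... | no ¬bd | _        = contradiction (D-vanishes f v λ u v⋖u → nonzero-case (f u) λ fu≢0 →
                            contradiction (≤-trans (⋖-maximum v⋖u) (proj₁ (supp u fu≢0))) ¬bd) ne
... | yes _  | no ¬size = contradiction (D-vanishes f v λ u v⋖u → nonzero-case (f u) λ fu≢0 →
                            contradiction (trans (sym (⋖-sum v⋖u)) (proj₂ (supp u fu≢0))) ¬size) ne

U-supported : ∀ {k m} (f : Poly ℓ) → SupportedPred k m f → Supported k m (U m f)
U-supported {m = m} f supp = supported (U m f) λ v outside → U-vanishes m f v λ u u⋖v bounded →
  nonzero-case (f u) λ fu≢0 → let bd , size = supp u fu≢0 in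
  contradiction (bounded bd , trans (⋖-sum u⋖v) size) outside

⋆-supported : ∀ {k₁ k₂ m₁ m₂} (f g : Poly ℓ) → Supported k₁ m₁ f → Supported k₂ m₂ g →
  Supported (k₁ + k₂) (m₁ + m₂) (f ⋆ g)
⋆-supported f g suppf suppg = supported (f ⋆ g) λ v outside → ⋆-vanishes f g v (factor v outside)
  where
  factor : ∀ v → ¬ _ → ∀ u w → u ⊞ w ≡ v → f u ≡ + 0 ⊎ g w ≡ + 0
  factor v outside u w refl with f u ℤ.≟ + 0 | g w ℤ.≟ + 0
  ... | yes e | _     = inj₁ e
  ... | no _  | yes e = inj₂ e
  ... | no fu | no gw =
    let bdu , sizeu = suppf u fu ; bdw , sizew = suppg w gw in
    contradiction (≤-trans (⊞-maximum u w) (+-mono-≤ bdu bdw) , trans (⊞-sum u w) (cong₂ _+_ sizeu sizew)) outside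

LinearFamily : ∀ {n} → (Vec ℤ n → Poly ℓ) → Set
LinearFamily F = ∀ v → Linear (λ c → F c v)

D-linear : ∀ {n} {F : Vec ℤ n → Poly ℓ} → LinearFamily F → LinearFamily (λ c → D (F c))
D-linear {F = F} lin v =
  (λ x y → trans (D-cong (λ u → proj₁ (lin u) x y) v) (D-+ (F x) (F y) v)) ,
  (λ a x → trans (D-cong (λ u → proj₂ (lin u) a x) v) (D-* a (F x) v))

U-linear : ∀ {n} m {F : Vec ℤ n → Poly ℓ} → LinearFamily F → LinearFamily (λ c → U m (F c))
U-linear m {F} lin v =
  (λ x y → trans (U-cong m (λ u → proj₁ (lin u) x y) v) (U-+ m (F x) (F y) v)) ,
  (λ a x → trans (U-cong m (λ u → proj₂ (lin u) a x) v) (U-* m a (F x) v))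

⋆-linear : ∀ {n} f {F : Vec ℤ n → Poly ℓ} → LinearFamily F → LinearFamily (λ c → f ⋆ F c)
⋆-linear f {F} lin v =
  (λ x y → trans (⋆-cong {f = f} (λ _ → refl) (λ u → proj₁ (lin u) x y) v) (⋆-+ʳ f (F x) (F y) v)) ,
  (λ a x → trans (⋆-cong {f = f} (λ _ → refl) (λ u → proj₂ (lin u) a x) v) (⋆-*ʳ a f (F x) v))

record HighestWeight (k ℓ m : ℕ) : Set where
  field
    poly      : Poly ℓ
    symmetric : Symmetric poly
    support   : Supported k m poly
    killed    : ∀ v → D poly v ≡ + 0
    leading   : ∃ (Leading poly)

-- A symmetric polynomial is determined by its coefficients at partitions, so being killed by `D`
-- amounts to one equation for each partition of `k − 1` in unknowns indexed by the partitions of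
-- `k`.
highest-weight : ∀ k ℓ m → pPred k ℓ m < p k ℓ m → HighestWeight k ℓ m
highest-weight k ℓ m lt = record
  { poly = f ; symmetric = symmetric-∘sort c ; support = suppf ; killed = killed ; leading = leading }
  where
  open Combination (Vec.≡-dec {n = ℓ} _≟_)
  B = partitions k ℓ m
  equations : List (Vec ℤ (length B) → ℤ)
  equations = map (λ b x → D (combination B x ∘ sort) b) (partitionsPred k ℓ m)
  solution : ∃[ x ] x ≢ zeros × All (λ L → L x ≡ + 0) equations
  solution = nontrivial-solution equations
    (All.map⁺ (All.universal (D-linear (λ v → combination-linear B (sort v))) (partitionsPred k ℓ m)))
    (subst₂ _<_ (sym (trans (length-map (λ b x → D (combination B x ∘ sort) b) (partitionsPred k ℓ m)) (length-partitionsPred k ℓ m)))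
                (sym (length-partitions k ℓ m)) lt)
  x = proj₁ solution
  c f : Poly ℓ
  c = combination B x
  f = c ∘ sort
  suppf : Supported k m f
  suppf = sort-supported c (combination-support B x)
  killed : ∀ v → D f v ≡ + 0
  killed = determinedPred (D f) (symmetric-D f (symmetric-∘sort c)) (D-supported f suppf)
    (All.map⁻ (proj₂ (proj₂ solution)))
  leading : ∃ (Leading f)
  leading with zero-or-leading m f (λ v ne → proj₁ (suppf v ne))
  ... | inj₂ l = l
  ... | inj₁ z = let v , cv≢0 = combination-nonzero (partitions-unique k ℓ m) x (proj₁ (proj₂ solution)) in
    contradiction (trans (cong c (sym (∈-partitions-sort (combination-support B x v cv≢0)))) (z v)) cv≢0

-- Multiplying by a fixed highest weight vector f is injective on highest weight vectors, and
-- f g is never a nonzero element of the image of U; so ker D in degree k₂ and everything in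
-- degree k₁ + k₂ − 1 embed independently into degree k₁ + k₂.
superadditivity : ∀ ℓ m₁ m₂ k₁ k₂ → pPred k₁ ℓ m₁ < p k₁ ℓ m₁ → 2 * (k₁ + k₂) ≤ ℓ * (m₁ + m₂) →
  pPred (k₁ + k₂) ℓ (m₁ + m₂) + p k₂ ℓ m₂ ≤ pPred k₂ ℓ m₂ + p (k₁ + k₂) ℓ (m₁ + m₂)
superadditivity ℓ m₁ m₂ k₁ k₂ lt 2k≤ = subst₂ _≤_ unknowns-count equations-count (dimension-bound equations linear trivial)
  where
  k = k₁ + k₂
  m = m₁ + m₂
  module F = HighestWeight (highest-weight k₁ ℓ m₁ lt)
  f = F.poly
  V = Vec ℕ ℓ
  open Combination {V ⊎ V} (⊎-≡-dec (Vec.≡-dec _≟_) (Vec.≡-dec _≟_))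
  B₁ B₂ : List V
  B₁ = partitionsPred k ℓ m
  B₂ = partitions k₂ ℓ m₂
  B : List (V ⊎ V)
  B = map inj₁ B₁ ++ map inj₂ B₂
  -- The left unknowns are the coefficients of `w` in degree `k − 1`, the right ones those of `g` in
  -- degree `k₂`. The system demands that `D` kill `g` and that the product of `f` and `g`, plus `U`
  -- applied to `w`, vanish.
  w g h : Vec ℤ (length B) → Poly ℓ
  w x v = combination B x (inj₁ (sort v))
  g x v = combination B x (inj₂ (sort v))
  h x v = (f ⋆ g x) v ℤ.+ U m (w x) v
  highest image : V → Vec ℤ (length B) → ℤ
  highest b x = D (g x) b
  image b x = h x b
  equations : List (Vec ℤ (length B) → ℤ)
  equations = map highest (partitionsPred k₂ ℓ m₂) ++ map image (partitions k ℓ m)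

  unknowns-count : length B ≡ pPred k ℓ m + p k₂ ℓ m₂
  unknowns-count = trans (length-++ (map inj₁ B₁)) (cong₂ _+_
    (trans (length-map inj₁ B₁) (length-partitionsPred k ℓ m)) (trans (length-map inj₂ B₂) (length-partitions k₂ ℓ m₂)))
  equations-count : length equations ≡ pPred k₂ ℓ m₂ + p k ℓ m
  equations-count = trans (length-++ (map highest (partitionsPred k₂ ℓ m₂))) (cong₂ _+_
    (trans (length-map highest (partitionsPred k₂ ℓ m₂)) (length-partitionsPred k₂ ℓ m₂))
    (trans (length-map image (partitions k ℓ m)) (length-partitions k ℓ m)))
  linear : All Linear equations
  linear = All.++⁺
    (All.map⁺ (All.universal (D-linear (λ v → combination-linear B (inj₂ (sort v)))) (partitionsPred k₂ ℓ m₂)))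
    (All.map⁺ (All.universal (λ v → linear-+
      (⋆-linear f (λ v → combination-linear B (inj₂ (sort v))) v)
      (U-linear m (λ v → combination-linear B (inj₁ (sort v))) v)) (partitions k ℓ m)))

  B-unique : Unique B
  B-unique = Unique.++⁺ (Unique.map⁺ inj₁-injective (partitionsPred-unique k ℓ m))
    (Unique.map⁺ inj₂-injective (partitions-unique k₂ ℓ m₂)) disjoint
    where
    disjoint : ∀ {z} → ¬ (z ∈ map inj₁ B₁ × z ∈ map inj₂ B₂)
    disjoint (z∈₁ , z∈₂) with ∈-map⁻ inj₁ z∈₁ | ∈-map⁻ inj₂ z∈₂
    ... | _ , _ , refl | _ , _ , ()

  ∈-B₁ : ∀ {v} → inj₁ v ∈ B → v ∈ B₁
  ∈-B₁ v∈ with ∈-++⁻ (map inj₁ B₁) v∈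
  ... | inj₁ v∈₁ with _ , v∈′ , refl ← ∈-map⁻ inj₁ v∈₁ = v∈′
  ... | inj₂ v∈₂ with _ , _ , () ← ∈-map⁻ inj₂ v∈₂
  ∈-B₂ : ∀ {v} → inj₂ v ∈ B → v ∈ B₂
  ∈-B₂ v∈ with ∈-++⁻ (map inj₁ B₁) v∈
  ... | inj₁ v∈₁ with _ , _ , () ← ∈-map⁻ inj₁ v∈₁
  ... | inj₂ v∈₂ with _ , v∈′ , refl ← ∈-map⁻ inj₂ v∈₂ = v∈′

  trivial : ∀ x → All (λ L → L x ≡ + 0) equations → x ≡ zeros
  trivial x solves = combination-injective B-unique x vanish
    where
    w-supp : SupportedPred k m (w x)
    w-supp = sort-supportedPred (combination B x ∘ inj₁) (λ v ne → ∈-B₁ (combination-support B x (inj₁ v) ne))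
    g-supp : Supported k₂ m₂ (g x)
    g-supp = sort-supported (combination B x ∘ inj₂) (λ v ne → ∈-B₂ (combination-support B x (inj₂ v) ne))
    w-symmetric : Symmetric (w x)
    w-symmetric = symmetric-∘sort (combination B x ∘ inj₁)
    g-symmetric : Symmetric (g x)
    g-symmetric = symmetric-∘sort (combination B x ∘ inj₂)
    Dg≡0 : ∀ v → D (g x) v ≡ + 0
    Dg≡0 = determinedPred (D (g x)) (symmetric-D (g x) g-symmetric) (D-supported (g x) g-supp)
      (All.map⁻ (All.++⁻ˡ (map highest (partitionsPred k₂ ℓ m₂)) solves))
    h-supp : Supported k m (h x)
    h-supp v ne with (f ⋆ g x) v ℤ.≟ + 0 | U m (w x) v ℤ.≟ + 0
    ... | no fg≢0 | _      = ⋆-supported f (g x) F.support g-supp v fg≢0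
    ... | yes _  | no U≢0 = U-supported (w x) w-supp v U≢0
    ... | yes e  | yes e′ = contradiction (cong₂ ℤ._+_ e e′) ne
    h≡0 : ∀ v → h x v ≡ + 0
    h≡0 = determined (h x)
      (symmetric-+ (symmetric-⋆ f (g x) F.symmetric g-symmetric) (symmetric-U m (w x) w-symmetric)) h-supp
      (All.map⁻ (All.++⁻ʳ (map highest (partitionsPred k₂ ℓ m₂)) solves))
    Dfg≡0 : ∀ v → D (f ⋆ g x) v ≡ + 0
    Dfg≡0 v = trans (leibniz f (g x) v) (cong₂ ℤ._+_
      (⋆-vanishes (D f) (g x) v (λ u _ _ → inj₁ (F.killed u)))
      (⋆-vanishes f (D (g x)) v (λ _ u _ → inj₂ (Dg≡0 u))))
    -- Applying `D` to the second group of equations removes the product, since `D` kills both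
    -- factors. So `w` is killed by DU and vanishes; then the product vanishes, and `g` by
    -- cancellation.
    DUw≡0 : ∀ v → D (U m (w x)) v ≡ + 0
    DUw≡0 v = trans (sym (ℤ.+-identityˡ _)) (trans (cong (ℤ._+ D (U m (w x)) v) (sym (Dfg≡0 v)))
      (trans (sym (D-+ (f ⋆ g x) (U m (w x)) v)) (trans (D-cong h≡0 v) (D-0 v))))
    w-zero : ∀ k → SupportedPred k m (w x) → 2 * k ≤ ℓ * m → ∀ v → w x v ≡ + 0
    w-zero zero    supp _   v = nonzero-case (w x v) λ ne → contradiction (sym (proj₂ (supp v ne))) 0≢1+n
    w-zero (suc j) supp 2k≤   = DU-injective m j (w x)
      (λ v size → nonzero-case (w x v) λ ne → contradiction (suc-injective (proj₂ (supp v ne))) size)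
      (<-≤-trans (*-monoʳ-< 2 (n<1+n j)) 2k≤) DUw≡0
    w≡0 : ∀ v → w x v ≡ + 0
    w≡0 = w-zero k w-supp 2k≤
    fg≡0 : ∀ v → (f ⋆ g x) v ≡ + 0
    fg≡0 v = trans (sym (ℤ.+-identityʳ _)) (trans (cong (ℤ._+_ ((f ⋆ g x) v)) (sym (trans (U-cong m w≡0 v) (U-0 m v)))) (h≡0 v))
    g≡0 : ∀ v → g x v ≡ + 0
    g≡0 = ⋆-cancel f (g x) (proj₁ F.leading) (proj₂ F.leading) fg≡0
    vanish : ∀ z → z ∈ B → combination B x z ≡ + 0
    vanish (inj₁ v) v∈ = trans (cong (combination B x ∘ inj₁) (sym (∈-partitionsPred-sort {n = k} (∈-B₁ v∈)))) (w≡0 v)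
    vanish (inj₂ v) v∈ = trans (cong (combination B x ∘ inj₂) (sym (∈-partitions-sort (∈-B₂ v∈)))) (g≡0 v)

-- Gaussian coefficients and their symmetry

-- Integer indices free the q-Pascal rules of side conditions and allow the negative shifts of the
-- q-binomial theorem.
pℤ : ℤ → (ℓ m : ℕ) → ℤ
pℤ (+ n)    ℓ m = + p n ℓ m
pℤ -[1+ _ ] ℓ m = + 0

pℤ-negative : ∀ n k ℓ m → n < k → pℤ (+ n ℤ.- + k) ℓ m ≡ + 0
pℤ-negative n k ℓ m n<k with k ∸ n | m<n⇒0<n∸m n<k | trans (ℤ.m-n≡m⊖n n k) (ℤ.⊖-< n<k)
... | suc j | _ | e = cong (λ z → pℤ z ℓ m) e

pℤ-largest-part : ∀ x ℓ m → pℤ x (suc ℓ) (suc m) ≡ pℤ x (suc ℓ) m ℤ.+ pℤ (x ℤ.- + suc m) ℓ (suc m)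
pℤ-largest-part -[1+ n ] ℓ m = refl
pℤ-largest-part (+ n)    ℓ m with n <? suc m
... | yes n<m = trans (cong +_ (p-largest-part-< n ℓ m n<m))
  (sym (trans (cong (ℤ._+_ (+ p n (suc ℓ) m)) (pℤ-negative n (suc m) ℓ (suc m) n<m)) (ℤ.+-identityʳ _)))
... | no  n≮m with k , refl ← m≤n⇒∃[o]m+o≡n (≮⇒≥ n≮m) =
  trans (cong +_ (p-largest-part k ℓ m)) (cong (λ z → + p (suc m + k) (suc ℓ) m ℤ.+ pℤ z ℓ (suc m)) (lem (+ suc m) (+ k)))
  where
  lem : ∀ a b → b ≡ a ℤ.+ b ℤ.- a
  lem = ℤ-solve-∀

δ : ℤ → ℤ
δ (+ 0) = + 1
δ _     = + 0

pℤ-no-parts : ∀ x m → pℤ x 0 m ≡ δ x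
pℤ-no-parts (+ zero)  m = refl
pℤ-no-parts (+ suc n) m = refl
pℤ-no-parts -[1+ n ]  m = refl

pℤ-no-columns : ∀ x ℓ → pℤ x ℓ 0 ≡ δ x
pℤ-no-columns x        zero    = pℤ-no-parts x 0
pℤ-no-columns (+ n)    (suc ℓ) = trans (cong +_ (p-no-columns n ℓ)) (pℤ-no-columns (+ n) ℓ)
pℤ-no-columns -[1+ n ] (suc ℓ) = refl

-- The second q-Pascal rule, obtained without conjugating diagrams: expand by the first rule, apply
-- the induction hypothesis to both terms, exchange the two inner terms and fold back. Transposition
-- exchanges the two rules, whence `pℤ-sym`.
pℤ-number-of-parts : ∀ ℓ m x → pℤ x (suc ℓ) (suc m) ≡ pℤ x ℓ (suc m) ℤ.+ pℤ (x ℤ.- + suc ℓ) (suc ℓ) m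
pℤ-number-of-parts zero zero x = trans (pℤ-largest-part x 0 0) (cong₂ ℤ._+_
  (trans (pℤ-no-columns x 1) (sym (pℤ-no-parts x 1)))
  (trans (pℤ-no-parts (x ℤ.- + 1) 1) (sym (pℤ-no-columns (x ℤ.- + 1) 1))))
pℤ-number-of-parts zero (suc m) x = begin
  pℤ x 1 (suc (suc m))
    ≡⟨ pℤ-largest-part x 0 (suc m) ⟩
  pℤ x 1 (suc m) ℤ.+ pℤ (x ℤ.- + suc (suc m)) 0 (suc (suc m))
    ≡⟨ cong₂ ℤ._+_ (pℤ-number-of-parts zero m x)
         (trans (pℤ-no-parts _ (suc (suc m))) (trans (cong δ (shift x (+ suc m))) (sym (pℤ-no-parts _ (suc m))))) ⟩
  pℤ x 0 (suc m) ℤ.+ pℤ (x ℤ.- + 1) 1 m ℤ.+ pℤ (x ℤ.- + 1 ℤ.- + suc m) 0 (suc m)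
    ≡⟨ ℤ.+-assoc (pℤ x 0 (suc m)) (pℤ (x ℤ.- + 1) 1 m) (pℤ (x ℤ.- + 1 ℤ.- + suc m) 0 (suc m)) ⟩
  pℤ x 0 (suc m) ℤ.+ (pℤ (x ℤ.- + 1) 1 m ℤ.+ pℤ (x ℤ.- + 1 ℤ.- + suc m) 0 (suc m))
    ≡⟨ cong₂ ℤ._+_ (trans (pℤ-no-parts x (suc m)) (sym (pℤ-no-parts x (suc (suc m))))) (sym (pℤ-largest-part (x ℤ.- + 1) 0 m)) ⟩
  pℤ x 0 (suc (suc m)) ℤ.+ pℤ (x ℤ.- + 1) 1 (suc m) ∎
  where
  open ≡-Reasoning
  shift : ∀ x a → x ℤ.- (+ 1 ℤ.+ a) ≡ x ℤ.- + 1 ℤ.- a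
  shift = ℤ-solve-∀
pℤ-number-of-parts (suc ℓ) zero x = begin
  pℤ x (suc (suc ℓ)) 1
    ≡⟨ pℤ-largest-part x (suc ℓ) 0 ⟩
  pℤ x (suc (suc ℓ)) 0 ℤ.+ pℤ (x ℤ.- + 1) (suc ℓ) 1
    ≡⟨ cong₂ ℤ._+_ (trans (pℤ-no-columns x (suc (suc ℓ))) (sym (pℤ-no-columns x (suc ℓ)))) (pℤ-number-of-parts ℓ zero (x ℤ.- + 1)) ⟩
  pℤ x (suc ℓ) 0 ℤ.+ (pℤ (x ℤ.- + 1) ℓ 1 ℤ.+ pℤ (x ℤ.- + 1 ℤ.- + suc ℓ) (suc ℓ) 0)
    ≡⟨ ℤ.+-assoc (pℤ x (suc ℓ) 0) (pℤ (x ℤ.- + 1) ℓ 1) (pℤ (x ℤ.- + 1 ℤ.- + suc ℓ) (suc ℓ) 0) ⟨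
  pℤ x (suc ℓ) 0 ℤ.+ pℤ (x ℤ.- + 1) ℓ 1 ℤ.+ pℤ (x ℤ.- + 1 ℤ.- + suc ℓ) (suc ℓ) 0
    ≡⟨ cong₂ ℤ._+_ (sym (pℤ-largest-part x ℓ 0))
         (trans (pℤ-no-columns _ (suc ℓ)) (trans (cong δ (shift x (+ suc ℓ))) (sym (pℤ-no-columns _ (suc (suc ℓ)))))) ⟩
  pℤ x (suc ℓ) 1 ℤ.+ pℤ (x ℤ.- + suc (suc ℓ)) (suc (suc ℓ)) 0 ∎
  where
  open ≡-Reasoning
  shift : ∀ x a → x ℤ.- + 1 ℤ.- a ≡ x ℤ.- (+ 1 ℤ.+ a)
  shift = ℤ-solve-∀
pℤ-number-of-parts (suc ℓ) (suc m) x = begin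
  pℤ x (2 + ℓ) (2 + m)
    ≡⟨ pℤ-largest-part x (suc ℓ) (suc m) ⟩
  pℤ x (2 + ℓ) (suc m) ℤ.+ pℤ (x ℤ.- + (2 + m)) (suc ℓ) (2 + m)
    ≡⟨ cong₂ ℤ._+_ (pℤ-number-of-parts (suc ℓ) m x) (pℤ-number-of-parts ℓ (suc m) (x ℤ.- + (2 + m))) ⟩
  (a ℤ.+ b) ℤ.+ (c ℤ.+ pℤ (x ℤ.- + (2 + m) ℤ.- + suc ℓ) (suc ℓ) (suc m))
    ≡⟨ cong (λ z → (a ℤ.+ b) ℤ.+ (c ℤ.+ pℤ z (suc ℓ) (suc m))) (shift x (+ ℓ) (+ m)) ⟩
  (a ℤ.+ b) ℤ.+ (c ℤ.+ d)
    ≡⟨ ℤ-interchange a b c d ⟩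
  (a ℤ.+ c) ℤ.+ (b ℤ.+ d)
    ≡⟨ cong₂ ℤ._+_ (pℤ-largest-part x ℓ (suc m)) (pℤ-largest-part (x ℤ.- + (2 + ℓ)) (suc ℓ) m) ⟨
  pℤ x (suc ℓ) (2 + m) ℤ.+ pℤ (x ℤ.- + (2 + ℓ)) (2 + ℓ) (suc m) ∎
  where
  open ≡-Reasoning
  a = pℤ x (suc ℓ) (suc m)
  b = pℤ (x ℤ.- + (2 + ℓ)) (2 + ℓ) m
  c = pℤ (x ℤ.- + (2 + m)) ℓ (2 + m)
  d = pℤ (x ℤ.- + (2 + ℓ) ℤ.- + suc m) (suc ℓ) (suc m)
  shift : ∀ x l m → x ℤ.- (+ 2 ℤ.+ m) ℤ.- (+ 1 ℤ.+ l) ≡ x ℤ.- (+ 2 ℤ.+ l) ℤ.- (+ 1 ℤ.+ m)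
  shift = ℤ-solve-∀

pℤ-sym : ∀ x ℓ m → pℤ x ℓ m ≡ pℤ x m ℓ
pℤ-sym x zero    m       = trans (pℤ-no-parts x m) (sym (pℤ-no-columns x m))
pℤ-sym x (suc ℓ) zero    = trans (pℤ-no-columns x (suc ℓ)) (sym (pℤ-no-parts x (suc ℓ)))
pℤ-sym x (suc ℓ) (suc m) = trans (pℤ-largest-part x ℓ m)
  (trans (cong₂ ℤ._+_ (pℤ-sym x (suc ℓ) m) (pℤ-sym (x ℤ.- + suc m) ℓ (suc m))) (sym (pℤ-number-of-parts m ℓ x)))

p-sym : ∀ n ℓ m → p n ℓ m ≡ p n m ℓ
p-sym n ℓ m = ℤ.+-injective (pℤ-sym (+ n) ℓ m)

pPred-sym : ∀ n ℓ m → pPred n ℓ m ≡ pPred n m ℓ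
pPred-sym zero    ℓ m = refl
pPred-sym (suc n) ℓ m = p-sym n ℓ m

p-zero : ∀ ℓ m → p 0 ℓ m ≡ 1
p-zero zero    m       = p-no-parts 0 m
p-zero (suc ℓ) zero    = trans (p-no-columns 0 ℓ) (p-zero ℓ zero)
p-zero (suc ℓ) (suc m) = trans (p-largest-part-< 0 ℓ m (s≤s z≤n)) (p-zero (suc ℓ) m)

-- Strict unimodality

-- Degree 1 has to be excluded: 0 and 1 have one partition each in any nonempty box.
Strict : (ℓ m : ℕ) → Set
Strict ℓ m = ∀ k → 2 ≤ k → 2 * k ≤ ℓ * m → pPred k ℓ m < p k ℓ m

strict-sym : ∀ {ℓ m} → Strict ℓ m → Strict m ℓ
strict-sym {ℓ} {m} s k 2≤k 2k≤ = subst₂ _<_ (pPred-sym k ℓ m) (p-sym k ℓ m) (s k 2≤k (≤-trans 2k≤ (≤-reflexive (*-comm m ℓ))))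

superadditive-difference : ∀ ℓ m₁ m₂ k₁ k₂ d → pPred k₁ ℓ m₁ < p k₁ ℓ m₁ → 2 * (k₁ + k₂) ≤ ℓ * (m₁ + m₂) →
  pPred k₂ ℓ m₂ + d ≤ p k₂ ℓ m₂ → pPred (k₁ + k₂) ℓ (m₁ + m₂) + d ≤ p (k₁ + k₂) ℓ (m₁ + m₂)
superadditive-difference ℓ m₁ m₂ k₁ k₂ d lt 2k≤ gap = +-cancelˡ-≤ (pPred k₂ ℓ m₂) _ _ (begin
  pPred k₂ ℓ m₂ + (P + d) ≡⟨ lem (pPred k₂ ℓ m₂) P d ⟩
  P + (pPred k₂ ℓ m₂ + d) ≤⟨ +-monoʳ-≤ P gap ⟩
  P + p k₂ ℓ m₂           ≤⟨ superadditivity ℓ m₁ m₂ k₁ k₂ lt 2k≤ ⟩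
  pPred k₂ ℓ m₂ + p (k₁ + k₂) ℓ (m₁ + m₂) ∎)
  where
  open ≤-Reasoning
  P = pPred (k₁ + k₂) ℓ (m₁ + m₂)
  lem : ∀ a b c → a + (b + c) ≡ b + (a + c)
  lem = ℕ-solve-∀

strict-superadditive : ∀ ℓ m₁ m₂ k₁ k₂ → pPred k₁ ℓ m₁ < p k₁ ℓ m₁ → 2 * (k₁ + k₂) ≤ ℓ * (m₁ + m₂) →
  pPred k₂ ℓ m₂ < p k₂ ℓ m₂ → pPred (k₁ + k₂) ℓ (m₁ + m₂) < p (k₁ + k₂) ℓ (m₁ + m₂)
strict-superadditive ℓ m₁ m₂ k₁ k₂ lt 2k≤ gap = ≤-trans (≤-reflexive (+-comm 1 _))
  (superadditive-difference ℓ m₁ m₂ k₁ k₂ 1 lt 2k≤ (≤-trans (≤-reflexive (+-comm (pPred k₂ ℓ m₂) 1)) gap))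

-- Degree 0 corresponds to constant polynomials; multiplying by one enlarges the box and keeps the
-- degree.
zero-strict : ∀ ℓ m → pPred 0 ℓ m < p 0 ℓ m
zero-strict ℓ m = ≤-reflexive (sym (p-zero ℓ m))

half : ∀ n → ∃[ h ] 2 * h ≤ n × n ≤ suc (2 * h)
half zero          = 0 , z≤n , z≤n
half (suc zero)    = 0 , z≤n , ≤-refl
half (suc (suc n)) = let h , lo , hi = half n in
  suc h , ≤-trans (≤-reflexive (*-suc 2 h)) (s≤s (s≤s lo)) , ≤-trans (s≤s (s≤s hi)) (≤-reflexive (cong suc (sym (*-suc 2 h))))

-- A degree in the lower half of the ℓ × m box is kept there and paired with a constant. Any other
-- degree gives about ℓm/2 to that box and the rest to the ℓ × 8 box.
strict-8+ : ∀ {ℓ m} → 8 ≤ ℓ → 8 ≤ m → Strict ℓ 8 → Strict ℓ m → Strict ℓ (8 + m)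
strict-8+ {ℓ} {m} 8≤ℓ 8≤m s₈ sₘ k 2≤k 2k≤ with 2 * k ≤? ℓ * m | half (ℓ * m)
... | yes small | _            = strict-superadditive ℓ 8 m 0 k (zero-strict ℓ 8) 2k≤ (sₘ k 2≤k small)
... | no  large | h , lo , hi  with m≤n⇒∃[o]m+o≡n (*-cancelˡ-< 2 h k (≤-<-trans lo (≰⇒> large)))
... | j , refl = main j 2k≤
  where
  open ≤-Reasoning
  4≤h : 4 ≤ h
  4≤h = ≤-pred (*-cancelˡ-< 2 4 (suc h) (begin
    9              ≤⟨ m≤m+n 9 55 ⟩
    8 * 8          ≤⟨ *-mono-≤ 8≤ℓ 8≤m ⟩
    ℓ * m          ≤⟨ hi ⟩
    suc (2 * h)    <⟨ n<1+n _ ⟩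
    2 + 2 * h      ≡⟨ *-suc 2 h ⟨
    2 * suc h      ∎))
  j-bound : ∀ j → 2 * (suc h + j) ≤ ℓ * (8 + m) → 2 * suc j ≤ ℓ * 8
  j-bound j 2k≤ = begin
    2 * suc j   ≤⟨ *-monoʳ-≤ 2 (≤-pred (*-cancelˡ-< 2 (suc j) (suc (ℓ * 4)) (+-cancelʳ-< (2 * h) _ _ (begin-strict
      2 * suc j + 2 * h        ≡⟨ lem₁ j h ⟩
      2 * (suc h + j)          ≤⟨ 2k≤ ⟩
      ℓ * (8 + m)              ≡⟨ *-distribˡ-+ ℓ 8 m ⟩
      ℓ * 8 + ℓ * m            ≤⟨ +-monoʳ-≤ (ℓ * 8) hi ⟩
      ℓ * 8 + suc (2 * h)      <⟨ +-monoʳ-< (ℓ * 8) (n<1+n (suc (2 * h))) ⟩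
      ℓ * 8 + (2 + 2 * h)      ≡⟨ lem₂ ℓ h ⟩
      2 * suc (ℓ * 4) + 2 * h  ∎)))) ⟩
    2 * (ℓ * 4) ≡⟨ lem₃ ℓ ⟩
    ℓ * 8       ∎
    where
    lem₁ : ∀ j h → 2 * suc j + 2 * h ≡ 2 * (suc h + j)
    lem₁ = ℕ-solve-∀
    lem₂ : ∀ l h → l * 8 + (2 + 2 * h) ≡ 2 * suc (l * 4) + 2 * h
    lem₂ = ℕ-solve-∀
    lem₃ : ∀ l → 2 * (l * 4) ≡ l * 8
    lem₃ = ℕ-solve-∀
  Goal : ℕ → Set
  Goal k = 2 * k ≤ ℓ * (8 + m) → pPred k ℓ (8 + m) < p k ℓ (8 + m)
  main : ∀ j → Goal (suc h + j)
  -- Here `k = suc h`, and the splitting 1 + h would meet the excluded degree 1; it is replaced by 2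
  -- + (h - 1), which is why `h` must not be too small.
  main zero 2k≤ = subst Goal (trans (cong suc (suc-pred h {{>-nonZero (≤-trans (s≤s z≤n) 4≤h)}})) (sym (+-identityʳ (suc h))))
    (λ 2k≤ → strict-superadditive ℓ 8 m 2 (pred h)
      (s₈ 2 ≤-refl (≤-trans (m≤m+n 4 60) (*-monoˡ-≤ 8 8≤ℓ))) 2k≤
      (sₘ (pred h) (≤-trans (n≤1+n 2) (pred-mono-≤ 4≤h)) (≤-trans (*-monoʳ-≤ 2 (pred[n]≤n {h})) lo)))
    2k≤
  main (suc j) 2k≤ = subst Goal (lem j h)
    (λ 2k≤′ → strict-superadditive ℓ 8 m (2 + j) h (s₈ (2 + j) (s≤s (s≤s z≤n)) (j-bound (suc j) 2k≤)) 2k≤′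
      (sₘ h (≤-trans (s≤s (s≤s z≤n)) 4≤h) lo))
    2k≤
    where
    lem : ∀ j h → 2 + j + h ≡ suc h + suc j
    lem = ℕ-solve-∀

-- Tables of Gaussian coefficients for the base boxes

coefficient : List ℕ → ℕ → ℕ
coefficient []      _       = 0
coefficient (c ∷ _) zero    = c
coefficient (_ ∷ L) (suc n) = coefficient L n

add : List ℕ → List ℕ → List ℕ
add []       L       = L
add (c ∷ K)  []      = c ∷ K
add (c ∷ K)  (d ∷ L) = c + d ∷ add K L

coefficient-add : ∀ K L n → coefficient (add K L) n ≡ coefficient K n + coefficient L n
coefficient-add []      L       n       = refl
coefficient-add (c ∷ K) []      n       = sym (+-identityʳ _)
coefficient-add (c ∷ K) (d ∷ L) zero    = refl
coefficient-add (c ∷ K) (d ∷ L) (suc n) = coefficient-add K L n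

coefficient-shift-< : ∀ k L n → n < k → coefficient (replicate k 0 ++ L) n ≡ 0
coefficient-shift-< (suc k) L zero    _         = refl
coefficient-shift-< (suc k) L (suc n) (s≤s n<k) = coefficient-shift-< k L n n<k

coefficient-shift : ∀ k L n → coefficient (replicate k 0 ++ L) (k + n) ≡ coefficient L n
coefficient-shift zero    L n = refl
coefficient-shift (suc k) L n = coefficient-shift k L n

-- The definition of `p` runs through (m + 1)^ℓ vectors, up to 16^15 of them in the base boxes. The
-- finite check therefore uses coefficient lists built by the q-Pascal rule.
Coefficients : List ℕ → (ℓ m : ℕ) → Set
Coefficients L ℓ m = ∀ n → coefficient L n ≡ p n ℓ m

coefficients-one-no-parts : ∀ m → Coefficients (1 ∷ []) 0 m
coefficients-one-no-parts m zero    = refl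
coefficients-one-no-parts m (suc n) = refl

coefficients-one-no-columns : ∀ ℓ → Coefficients (1 ∷ []) ℓ 0
coefficients-one-no-columns zero    n = coefficients-one-no-parts 0 n
coefficients-one-no-columns (suc ℓ) n = trans (coefficients-one-no-columns ℓ n) (sym (p-no-columns n ℓ))

coefficients-pascal : ∀ {K L ℓ m} → Coefficients K (suc ℓ) m → Coefficients L ℓ (suc m) →
  Coefficients (add K (replicate (suc m) 0 ++ L)) (suc ℓ) (suc m)
coefficients-pascal {K} {L} {ℓ} {m} cK cL n with n <? suc m
... | yes n<m = trans (coefficient-add K (replicate (suc m) 0 ++ L) n)
  (trans (cong₂ _+_ (cK n) (coefficient-shift-< (suc m) L n n<m)) (trans (+-identityʳ _) (sym (p-largest-part-< n ℓ m n<m))))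
... | no  n≮m with k , refl ← m≤n⇒∃[o]m+o≡n (≮⇒≥ n≮m) =
  trans (coefficient-add K (replicate (suc m) 0 ++ L) n)
  (trans (cong₂ _+_ (cK n) (trans (coefficient-shift (suc m) L k) (cL k))) (sym (p-largest-part k ℓ m)))

data Row (ℓ m : ℕ) : List (List ℕ) → Set where
  []  : Row ℓ m []
  _∷_ : ∀ {L Ls} → Coefficients L ℓ m → Row ℓ (suc m) Ls → Row ℓ m (L ∷ Ls)

-- Scans the row of height ℓ while carrying the entry of height ℓ + 1 just computed: width m + 1
-- needs the new entry of width m and the old one of width m + 1.
extend : ℕ → List ℕ → List (List ℕ) → List (List ℕ)
extend m K []       = []
extend m K (L ∷ Ls) = let M = add K (replicate (suc m) 0 ++ L) in M ∷ extend (suc m) M Ls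

extend-row : ∀ {ℓ m K Ls} → Coefficients K (suc ℓ) m → Row ℓ (suc m) Ls → Row (suc ℓ) (suc m) (extend m K Ls)
extend-row             cK []        = []
extend-row {ℓ} {m} {K} cK (_∷_ {L} cL r) = let cM = coefficients-pascal {K} {L} {ℓ} {m} cK cL in cM ∷ extend-row cM r

next : List (List ℕ) → List (List ℕ)
next []       = []
next (_ ∷ Ls) = (1 ∷ []) ∷ extend 0 (1 ∷ []) Ls

row : (ℓ width : ℕ) → List (List ℕ)
row zero    w = replicate w (1 ∷ [])
row (suc ℓ) w = next (row ℓ w)

row-correct : ∀ ℓ w → Row ℓ 0 (row ℓ w)
row-correct zero    w = go 0 w
  where
  go : ∀ m w → Row 0 m (replicate w (1 ∷ []))
  go m zero    = []
  go m (suc w) = coefficients-one-no-parts m ∷ go (suc m) w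
row-correct (suc ℓ) w with row ℓ w | row-correct ℓ w
... | []     | []    = []
... | _ ∷ Ls | _ ∷ r = coefficients-one-no-columns (suc ℓ) ∷ extend-row (coefficients-one-no-columns (suc ℓ)) r

increasing : ℕ → List ℕ → Bool
increasing zero    L           = true
increasing (suc h) []          = false
increasing (suc h) (c ∷ [])    = false
increasing (suc h) (c ∷ d ∷ L) = (c <ᵇ d) ∧ increasing h (d ∷ L)

increasing-sound : ∀ h L → increasing h L ≡ true → ∀ i → i < h → coefficient L i < coefficient L (suc i)
increasing-sound (suc h) (c ∷ d ∷ L) ok zero    _         = <ᵇ⇒< c d (Equivalence.from T-≡ (∧-conicalˡ (c <ᵇ d) _ ok))
increasing-sound (suc h) (c ∷ d ∷ L) ok (suc i) (s≤s i<h) = increasing-sound h (d ∷ L) (∧-conicalʳ (c <ᵇ d) _ ok) i i<h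

-- The coefficient in degree 0 is dropped because it equals the one in degree 1; one comparison
-- fewer remains up to the middle.
increasing-from-1 : (ℓ m : ℕ) → List ℕ → Bool
increasing-from-1 ℓ m []      = false
increasing-from-1 ℓ m (_ ∷ L) = increasing (⌊ ℓ * m /2⌋ ∸ 1) L

strict-sound : ∀ {ℓ m} L → Coefficients L ℓ m → increasing-from-1 ℓ m L ≡ true → Strict ℓ m
strict-sound {ℓ} {m} (c ∷ L) co ok (suc (suc i)) _ 2k≤ = subst₂ _<_ (co (suc i)) (co (suc (suc i)))
  (increasing-sound (⌊ ℓ * m /2⌋ ∸ 1) L ok i (∸-monoˡ-≤ 1 (≤-trans (≤-reflexive (double (2 + i))) (⌊n/2⌋-mono 2k≤))))
  where
  double : ∀ k → k ≡ ⌊ 2 * k /2⌋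
  double k = trans (n≡⌊n+n/2⌋ k) (cong (λ z → ⌊ k + z /2⌋) (sym (+-identityʳ k)))
strict-sound (c ∷ L) co ok (suc zero) (s≤s ()) _

increasing-row : (ℓ m : ℕ) → List (List ℕ) → Bool
increasing-row ℓ m []       = true
increasing-row ℓ m (L ∷ Ls) = increasing-from-1 ℓ m L ∧ increasing-row ℓ (suc m) Ls

drop-row : ∀ k {ℓ m Ls} → Row ℓ m Ls → Row ℓ (k + m) (drop k Ls)
drop-row zero    r       = r
drop-row (suc k) []      = []
drop-row (suc k) {ℓ} {m} (_∷_ {Ls = Ls} _ r) = subst (λ i → Row ℓ i (drop k Ls)) (+-suc k m) (drop-row k r)

strict-row : ∀ {ℓ m Ls} → Row ℓ m Ls → increasing-row ℓ m Ls ≡ true → ∀ i → i < length Ls → Strict ℓ (m + i)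
strict-row {ℓ} {m} (_∷_ {L} c r) ok zero    _         =
  subst (Strict ℓ) (sym (+-identityʳ m)) (strict-sound L c (∧-conicalˡ (increasing-from-1 ℓ m L) _ ok))
strict-row {ℓ} {m} (_∷_ {L} c r) ok (suc i) (s≤s i<n) =
  subst (Strict ℓ) (sym (+-suc m i)) (strict-row r (∧-conicalʳ (increasing-from-1 ℓ m L) _ ok) i i<n)

strict-8-to-15 : ∀ i j → i < 8 → j < 8 → Strict (8 + i) (8 + j)
-- A row of length 16 covers the widths 0 to 15; dropping eight entries leaves 8 to 15.
strict-8-to-15 i j i<8 j<8 = strict-row (drop-row 8 (row-correct (8 + i) 16)) (proj₁ (checked i i<8)) j
  (≤-trans j<8 (≤-reflexive (sym (proj₂ (checked i i<8)))))
  where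
  Checked : ℕ → Set
  Checked i = increasing-row (8 + i) 8 (drop 8 (row (8 + i) 16)) ≡ true × length (drop 8 (row (8 + i) 16)) ≡ 8
  checked : ∀ i → i < 8 → Checked i
  checked 0 _ = refl , refl
  checked 1 _ = refl , refl
  checked 2 _ = refl , refl
  checked 3 _ = refl , refl
  checked 4 _ = refl , refl
  checked 5 _ = refl , refl
  checked 6 _ = refl , refl
  checked 7 _ = refl , refl
  checked (suc (suc (suc (suc (suc (suc (suc (suc i)))))))) i<8 = contradiction i<8 (m+n≮m 8 i)

strict-from-base : ∀ ℓ → 8 ≤ ℓ → (∀ i → i < 8 → Strict ℓ (8 + i)) → ∀ m → 8 ≤ m → Strict ℓ m
strict-from-base ℓ 8≤ℓ base = <-rec (λ m → 8 ≤ m → Strict ℓ m) step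
  where
  step : ∀ m → (∀ {m′} → m′ < m → 8 ≤ m′ → Strict ℓ m′) → 8 ≤ m → Strict ℓ m
  step m ih 8≤m with m≤n⇒∃[o]m+o≡n 8≤m
  ... | i , refl with i <? 8
  ...   | yes i<8 = base i i<8
  ...   | no  i≮8 = strict-8+ 8≤ℓ (≮⇒≥ i≮8) (base 0 (s≤s z≤n)) (ih (m<n+m i (s≤s z≤n)) (≮⇒≥ i≮8))

strict-unimodality : ∀ ℓ m → 8 ≤ ℓ → 8 ≤ m → Strict ℓ m
strict-unimodality ℓ m 8≤ℓ 8≤m = strict-sym (strict-from-base m 8≤m small-ℓ ℓ 8≤ℓ)
  where
  small-ℓ : ∀ i → i < 8 → Strict m (8 + i)
  small-ℓ i i<8 = strict-sym (strict-from-base (8 + i) (m≤m+n 8 i) (λ j → strict-8-to-15 i j i<8) m 8≤m)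

-- The q-binomial theorem Π (1 + z qⁱ) = Σⱼ zʲ q^(j(j−1)/2) [N over j]_q at z = q⁻ᶜ

triangle : ℕ → ℕ
triangle zero    = 0
triangle (suc j) = triangle j + j

triangle-double : ∀ j → 2 * triangle j + j ≡ j * j
triangle-double zero    = refl
triangle-double (suc j) = trans (lem₁ (triangle j) j) (trans (cong (λ z → z + 2 * j + 1) (triangle-double j)) (lem₂ j))
  where
  lem₁ : ∀ t j → 2 * (t + j) + suc j ≡ 2 * t + j + 2 * j + 1
  lem₁ = ℕ-solve-∀
  lem₂ : ∀ j → j * j + 2 * j + 1 ≡ suc j * suc j
  lem₂ = ℕ-solve-∀

-- The coefficient of q^τ in the summand of index `j` of the q-binomial expansion at z = q^(-c),
-- that is, in q^(j(j-1)/2 - cj) times a Gaussian coefficient.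
shifted : (c : ℕ) → ℤ → ℕ → ℕ → ℤ
shifted c τ j m = pℤ (τ ℤ.+ (+ c ℤ.* + j ℤ.- + triangle j)) j m

-- The coefficient of q^τ in Π (1 + q^(i−c)) over i < N.
centred : (c N : ℕ) → ℤ → ℤ
centred c N τ = antidiagonal (shifted c τ) N

-- Sums a Pascal-type rule along a diagonal: `X` collects the neighbours with `m` lowered, `Y` those
-- with `j` lowered, and each end of the diagonal has only one of them.
anti-pascal : ∀ (T X Y : ℕ → ℕ → ℤ) N → T 0 (suc N) ≡ X 0 N → T (suc N) 0 ≡ Y N 0 →
  (∀ j m → suc (j + m) ≡ N → T (suc j) (suc m) ≡ X (suc j) m ℤ.+ Y j (suc m)) →
  antidiagonal T (suc N) ≡ antidiagonal X N ℤ.+ antidiagonal Y N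
anti-pascal T X Y N first last interior = begin
  T 0 (suc N) ℤ.+ antidiagonal (λ a → T (suc a)) N
    ≡⟨ cong₂ ℤ._+_ first (trans (anti-cong N pointwise) (anti-+ Z Y N)) ⟩
  X 0 N ℤ.+ (antidiagonal Z N ℤ.+ antidiagonal Y N)
    ≡⟨ ℤ.+-assoc (X 0 N) (antidiagonal Z N) (antidiagonal Y N) ⟨
  X 0 N ℤ.+ antidiagonal Z N ℤ.+ antidiagonal Y N
    ≡⟨ cong (ℤ._+ antidiagonal Y N) (sum-X N) ⟩
  antidiagonal X N ℤ.+ antidiagonal Y N ∎
  where
  open ≡-Reasoning
  Z : ℕ → ℕ → ℤ
  Z a zero    = + 0
  Z a (suc b) = X (suc a) b
  pointwise : ∀ a b → a + b ≡ N → T (suc a) b ≡ Z a b ℤ.+ Y a b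
  pointwise a zero    e = subst (λ i → T (suc i) 0 ≡ + 0 ℤ.+ Y i 0) (trans (sym e) (+-identityʳ a)) (trans last (sym (ℤ.+-identityˡ _)))
  pointwise a (suc b) e = interior a b (trans (sym (+-suc a b)) e)
  sum-X : ∀ N → X 0 N ℤ.+ antidiagonal Z N ≡ antidiagonal X N
  sum-X zero    = ℤ.+-identityʳ _
  sum-X (suc N) = cong (ℤ._+_ (X 0 (suc N))) (trans (anti-last Z N) (ℤ.+-identityʳ _))

-- Multiplication by the new factor 1 + q^(N - c).
centred-suc : ∀ c N τ → centred c (suc N) τ ≡ centred c N τ ℤ.+ centred c N (τ ℤ.- (+ N ℤ.- + c))
centred-suc c N τ = anti-pascal (shifted c τ) (shifted c τ) (shifted c (τ ℤ.- (+ N ℤ.- + c))) N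
  (trans (pℤ-no-parts x₀ (suc N)) (sym (pℤ-no-parts x₀ N)))
  (trans (pℤ-no-columns _ (suc N)) (trans (cong δ (trans (position N) (drop-0 N))) (sym (pℤ-no-columns _ N))))
  interior
  where
  x₀ = τ ℤ.+ (+ c ℤ.* + 0 ℤ.- + 0)
  position : ∀ j → τ ℤ.+ (+ c ℤ.* + suc j ℤ.- + triangle (suc j)) ≡ τ ℤ.+ (+ c ℤ.+ + c ℤ.* + j ℤ.- + triangle j ℤ.- + j)
  position j = lem τ (+ c) (+ j) (+ triangle j)
    where
    lem : ∀ τ c j t → τ ℤ.+ (c ℤ.* (+ 1 ℤ.+ j) ℤ.- (t ℤ.+ j)) ≡ τ ℤ.+ (c ℤ.+ c ℤ.* j ℤ.- t ℤ.- j)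
    lem = ℤ-solve-∀
  drop-0 : ∀ j → τ ℤ.+ (+ c ℤ.+ + c ℤ.* + j ℤ.- + triangle j ℤ.- + j) ≡ τ ℤ.- (+ j ℤ.- + c) ℤ.+ (+ c ℤ.* + j ℤ.- + triangle j)
  drop-0 j = lem τ (+ c) (+ j) (+ triangle j)
    where
    lem : ∀ τ c j t → τ ℤ.+ (c ℤ.+ c ℤ.* j ℤ.- t ℤ.- j) ≡ τ ℤ.- (j ℤ.- c) ℤ.+ (c ℤ.* j ℤ.- t)
    lem = ℤ-solve-∀
  interior : ∀ j m → suc (j + m) ≡ N → shifted c τ (suc j) (suc m) ≡
    shifted c τ (suc j) m ℤ.+ shifted c (τ ℤ.- (+ N ℤ.- + c)) j (suc m)
  interior j m refl = trans (pℤ-largest-part (τ ℤ.+ (+ c ℤ.* + suc j ℤ.- + triangle (suc j))) j m)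
    (cong (λ z → shifted c τ (suc j) m ℤ.+ pℤ z j (suc m))
      (trans (cong (ℤ._- + suc m) (position j)) (lem τ (+ c) (+ j) (+ triangle j) (+ m))))
    where
    lem : ∀ τ c j t m → τ ℤ.+ (c ℤ.+ c ℤ.* j ℤ.- t ℤ.- j) ℤ.- (+ 1 ℤ.+ m) ≡
      τ ℤ.- (+ 1 ℤ.+ (j ℤ.+ m) ℤ.- c) ℤ.+ (c ℤ.* j ℤ.- t)
    lem = ℤ-solve-∀

centred-0 : ∀ c τ → centred c 0 τ ≡ δ τ
centred-0 c τ = trans (pℤ-no-parts (τ ℤ.+ (+ c ℤ.* + 0 ℤ.- + 0)) 0) (cong δ (lem τ (+ c)))
  where
  lem : ∀ τ c → τ ℤ.+ (c ℤ.* + 0 ℤ.- + 0) ≡ τ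
  lem = ℤ-solve-∀

subset-sums : ℕ → List ℕ
subset-sums zero    = 0 ∷ []
subset-sums (suc n) = subset-sums n ++ map (_+_ (suc n)) (subset-sums n)

sumOver : (ℕ → ℤ) → List ℕ → ℤ
sumOver F []      = + 0
sumOver F (x ∷ L) = F x ℤ.+ sumOver F L

sumOver-cong : ∀ {F G} → (∀ x → F x ≡ G x) → ∀ L → sumOver F L ≡ sumOver G L
sumOver-cong e []      = refl
sumOver-cong e (x ∷ L) = cong₂ ℤ._+_ (e x) (sumOver-cong e L)

sumOver-++ : ∀ F K L → sumOver F (K ++ L) ≡ sumOver F K ℤ.+ sumOver F L
sumOver-++ F []      L = sym (ℤ.+-identityˡ _)
sumOver-++ F (x ∷ K) L = trans (cong (ℤ._+_ (F x)) (sumOver-++ F K L)) (sym (ℤ.+-assoc (F x) (sumOver F K) (sumOver F L)))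

sumOver-map : ∀ F (h : ℕ → ℕ) L → sumOver F (map h L) ≡ sumOver (F ∘ h) L
sumOver-map F h []      = refl
sumOver-map F h (x ∷ L) = cong (ℤ._+_ (F (h x))) (sumOver-map F h L)

sumOver-+ : ∀ F G L → sumOver (λ x → F x ℤ.+ G x) L ≡ sumOver F L ℤ.+ sumOver G L
sumOver-+ F G []      = refl
sumOver-+ F G (x ∷ L) = trans (cong (ℤ._+_ (F x ℤ.+ G x)) (sumOver-+ F G L)) (ℤ-interchange (F x) (G x) (sumOver F L) (sumOver G L))

sumOver-subset-sums : ∀ F n → sumOver F (subset-sums (suc n)) ≡ sumOver (λ x → F x ℤ.+ F (suc n + x)) (subset-sums n)
sumOver-subset-sums F n = trans (sumOver-++ F (subset-sums n) (map (_+_ (suc n)) (subset-sums n)))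
  (trans (cong (ℤ._+_ (sumOver F (subset-sums n))) (sumOver-map F (_+_ (suc n)) (subset-sums n)))
    (sym (sumOver-+ F (F ∘ (_+_ (suc n))) (subset-sums n))))

-- Splits off the factors of weights −k, …, −1.
centred-low : ∀ k i τ → centred (k + i) (k + i) τ ≡ sumOver (λ y → centred (k + i) i (τ ℤ.+ + y)) (subset-sums k)
centred-low k i τ = go k i τ refl
  where
  n = k + i
  go : ∀ k i τ → k + i ≡ n → centred n n τ ≡ sumOver (λ y → centred n i (τ ℤ.+ + y)) (subset-sums k)
  go zero    i τ refl = sym (trans (ℤ.+-identityʳ _) (cong (centred n n) (ℤ.+-identityʳ τ)))
  go (suc k) i τ e = trans (go k (suc i) τ (trans (+-suc k i) e))
    (trans (sumOver-cong step (subset-sums k)) (sym (sumOver-subset-sums (λ y → centred n i (τ ℤ.+ + y)) k)))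
    where
    step : ∀ y → centred n (suc i) (τ ℤ.+ + y) ≡ centred n i (τ ℤ.+ + y) ℤ.+ centred n i (τ ℤ.+ + (suc k + y))
    step y = trans (centred-suc n i (τ ℤ.+ + y)) (cong (λ z → centred n i (τ ℤ.+ + y) ℤ.+ centred n i z)
      (trans (cong (λ z → τ ℤ.+ + y ℤ.- (+ i ℤ.- + z)) (sym e)) (lem τ (+ y) (+ i) (+ k))))
      where
      lem : ∀ τ y i k → τ ℤ.+ y ℤ.- (i ℤ.- (+ 1 ℤ.+ k ℤ.+ i)) ≡ τ ℤ.+ (+ 1 ℤ.+ k ℤ.+ y)
      lem = ℤ-solve-∀

-- Splits off the factors of weights 1, …, k.
centred-high : ∀ n k τ → centred n (k + suc n) τ ≡ sumOver (λ x → centred n (suc n) (τ ℤ.- + x)) (subset-sums k)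
centred-high n zero    τ = sym (trans (ℤ.+-identityʳ _) (cong (centred n (suc n)) (ℤ.+-identityʳ τ)))
centred-high n (suc k) τ = trans (centred-suc n (k + suc n) τ)
  (trans (cong₂ ℤ._+_ (centred-high n k τ) (centred-high n k (τ ℤ.- (+ (k + suc n) ℤ.- + n))))
  (trans (sym (sumOver-+ (λ x → centred n (suc n) (τ ℤ.- + x)) (λ x → centred n (suc n) (τ ℤ.- (+ (k + suc n) ℤ.- + n) ℤ.- + x)) (subset-sums k)))
  (trans (sumOver-cong (λ x → cong (λ z → centred n (suc n) (τ ℤ.- + x) ℤ.+ centred n (suc n) z) (lem τ (+ x) (+ k) (+ n))) (subset-sums k))
    (sym (sumOver-subset-sums (λ x → centred n (suc n) (τ ℤ.- + x)) k)))))
  where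
  lem : ∀ τ x k n → τ ℤ.- (k ℤ.+ (+ 1 ℤ.+ n) ℤ.- n) ℤ.- x ≡ τ ℤ.- (+ 1 ℤ.+ k ℤ.+ x)
  lem = ℤ-solve-∀

multiplicity : List ℕ → ℕ → ℕ
multiplicity L i = count (i ≡ᵇ_) L

δ-⊖ : ∀ x y → δ (y ℤ.⊖ x) ≡ + (if x ≡ᵇ y then 1 else 0)
δ-⊖ zero    zero    = refl
δ-⊖ zero    (suc y) = refl
δ-⊖ (suc x) zero    = refl
δ-⊖ (suc x) (suc y) = trans (cong δ (ℤ.[1+m]⊖[1+n]≡m⊖n y x)) (δ-⊖ x y)

sumOver-δ : ∀ x L → sumOver (λ y → δ (ℤ.- + x ℤ.+ + y)) L ≡ + multiplicity L x
sumOver-δ x []      = refl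
sumOver-δ x (y ∷ L) = trans (cong₂ ℤ._+_
  (trans (cong δ (trans (ℤ.+-comm (ℤ.- + x) (+ y)) (ℤ.m-n≡m⊖n y x))) (δ-⊖ x y)) (sumOver-δ x L))
  (sym (ℤ.pos-+ (if x ≡ᵇ y then 1 else 0) (multiplicity L x)))

listSum : (ℕ → ℕ) → List ℕ → ℕ
listSum F []      = 0
listSum F (x ∷ L) = F x + listSum F L

centred-middle : ∀ n τ → centred n n τ ≡ sumOver (λ y → δ (τ ℤ.+ + y)) (subset-sums n)
centred-middle n τ = trans (subst (λ m → centred m m τ ≡ sumOver (λ y → centred m 0 (τ ℤ.+ + y)) (subset-sums n))
    (+-identityʳ n) (centred-low n 0 τ))
  (sumOver-cong (λ y → centred-0 n (τ ℤ.+ + y)) (subset-sums n))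

-- The weights are -n, ..., n. Weight 0 contributes the factor 2, and the total -h arises when the
-- chosen negative weights outweigh the chosen positive ones by `h`. The result is twice the
-- autocorrelation of the subset-sum counts at lag `h`.
centred-correlation : ∀ n h → centred n (n + suc n) (ℤ.- + h) ≡
  + (2 * listSum (λ x → multiplicity (subset-sums n) (h + x)) (subset-sums n))
centred-correlation n h = trans (centred-high n n (ℤ.- + h)) (go (subset-sums n))
  where
  s = multiplicity (subset-sums n)
  low : ∀ x → centred n n (ℤ.- + h ℤ.- + x) ≡ + s (h + x)
  low x = trans (centred-middle n (ℤ.- + h ℤ.- + x))
    (trans (cong (λ z → sumOver (λ y → δ (z ℤ.+ + y)) (subset-sums n)) (sym (ℤ.neg-distrib-+ (+ h) (+ x))))
      (sumOver-δ (h + x) (subset-sums n)))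
  double : ∀ x → centred n (suc n) (ℤ.- + h ℤ.- + x) ≡ + (2 * s (h + x))
  double x = trans (centred-suc n n (ℤ.- + h ℤ.- + x))
    (trans (cong₂ ℤ._+_ (low x) (trans (cong (centred n n) (lem (ℤ.- + h ℤ.- + x) (+ n))) (low x)))
      (cong (λ z → + (s (h + x) + z)) (sym (+-identityʳ (s (h + x))))))
    where
    lem : ∀ a n → a ℤ.- (n ℤ.- n) ≡ a
    lem = ℤ-solve-∀
  go : ∀ L → sumOver (λ x → centred n (suc n) (ℤ.- + h ℤ.- + x)) L ≡ + (2 * listSum (λ x → s (h + x)) L)
  go []      = refl
  go (x ∷ L) = trans (cong₂ ℤ._+_ (double x) (go L)) (cong +_ (sym (*-distribˡ-+ 2 (s (h + x)) (listSum (λ x → s (h + x)) L))))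

-- A large difference in the middle of some box

rangeSum : ℕ → (ℕ → ℕ) → ℕ
rangeSum zero    F = 0
rangeSum (suc R) F = rangeSum R F + F R

rangeSum-cong : ∀ {F G} R → (∀ i → F i ≡ G i) → rangeSum R F ≡ rangeSum R G
rangeSum-cong zero    e = refl
rangeSum-cong (suc R) e = cong₂ _+_ (rangeSum-cong R e) (e R)

rangeSum-+ : ∀ F G R → rangeSum R (λ i → F i + G i) ≡ rangeSum R F + rangeSum R G
rangeSum-+ F G zero    = refl
rangeSum-+ F G (suc R) = trans (cong (_+ (F R + G R)) (rangeSum-+ F G R)) (lem (rangeSum R F) (rangeSum R G) (F R) (G R))
  where
  lem : ∀ a b c d → a + b + (c + d) ≡ a + c + (b + d)
  lem = ℕ-solve-∀

rangeSum-≤ : ∀ F B R → (∀ i → i < R → F i ≤ B) → rangeSum R F ≤ R * B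
rangeSum-≤ F B zero    _ = z≤n
rangeSum-≤ F B (suc R) h = ≤-trans (+-mono-≤ (rangeSum-≤ F B R (λ i i<R → h i (m≤n⇒m≤1+n i<R))) (h R ≤-refl)) (≤-reflexive (+-comm (R * B) B))

term≤rangeSum : ∀ F i R → i < R → F i ≤ rangeSum R F
term≤rangeSum F i (suc R) (s≤s i≤R) with m≤n⇒m<n∨m≡n i≤R
... | inj₁ i<R  = ≤-trans (term≤rangeSum F i R i<R) (m≤m+n _ (F R))
... | inj₂ refl = m≤n+m (F R) (rangeSum R F)

≡ᵇ-≢ : ∀ {i x} → i ≢ x → (i ≡ᵇ x) ≡ false
≡ᵇ-≢ {i} {x} i≢x with i ≡ᵇ x in eq
... | false = refl
... | true  = contradiction (≡ᵇ⇒≡ i x (Equivalence.from T-≡ eq)) i≢x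

indicator : ℕ → ℕ → ℕ
indicator x i = if i ≡ᵇ x then 1 else 0

indicator-≢ : ∀ {i x} → i ≢ x → indicator x i ≡ 0
indicator-≢ i≢x = cong (if_then 1 else 0) (≡ᵇ-≢ i≢x)

rangeSum-indicator-≥ : ∀ (F : ℕ → ℕ) x R → R ≤ x → rangeSum R (λ i → indicator x i * F i) ≡ 0
rangeSum-indicator-≥ F x zero    _   = refl
rangeSum-indicator-≥ F x (suc R) R<x =
  cong₂ _+_ (rangeSum-indicator-≥ F x R (<⇒≤ R<x)) (cong (_* F R) (indicator-≢ (<⇒≢ R<x)))

rangeSum-indicator : ∀ (F : ℕ → ℕ) x R → x < R → rangeSum R (λ i → indicator x i * F i) ≡ F x
rangeSum-indicator F x (suc R) (s≤s x≤R) with m≤n⇒m<n∨m≡n x≤R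
... | inj₁ x<R  = trans (cong₂ _+_ (rangeSum-indicator F x R x<R) (cong (_* F R) (indicator-≢ (≢-sym (<⇒≢ x<R))))) (+-identityʳ (F x))
... | inj₂ refl = trans (cong₂ _+_ (rangeSum-indicator-≥ F R R ≤-refl)
  (cong (λ b → (if b then 1 else 0) * F R) (Equivalence.to T-≡ (≡⇒≡ᵇ R R refl)))) (+-identityʳ (F R))

listSum-multiplicity : ∀ F R L → All (_< R) L → listSum F L ≡ rangeSum R (λ i → multiplicity L i * F i)
listSum-multiplicity F R []      []         = sym (zero-sum R)
  where
  zero-sum : ∀ R → rangeSum R (λ _ → 0) ≡ 0
  zero-sum zero    = refl
  zero-sum (suc R) = cong (_+ 0) (zero-sum R)
listSum-multiplicity F R (x ∷ L) (x<R ∷ L<R) = sym (trans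
  (rangeSum-cong R (λ i → *-distribʳ-+ (F i) (indicator x i) (multiplicity L i)))
  (trans (rangeSum-+ (λ i → indicator x i * F i) (λ i → multiplicity L i * F i) R)
    (cong₂ _+_ (rangeSum-indicator F x R x<R) (sym (listSum-multiplicity F R L L<R)))))

multiplicity-outside : ∀ R L → All (_< R) L → multiplicity L R ≡ 0
multiplicity-outside R []      []          = refl
multiplicity-outside R (x ∷ L) (x<R ∷ L<R) = cong₂ _+_ (indicator-≢ (≢-sym (<⇒≢ x<R))) (multiplicity-outside R L L<R)

subset-sums-bounded : ∀ n → All (_< suc n * suc n) (subset-sums n)
subset-sums-bounded zero    = s≤s z≤n ∷ []
subset-sums-bounded (suc n) = All.++⁺
  (All.map (λ x< → <-≤-trans x< (*-mono-≤ (n≤1+n (suc n)) (n≤1+n (suc n)))) (subset-sums-bounded n))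
  (All.map⁺ (All.map (λ x< → <-≤-trans (+-monoʳ-< (suc n) x<) (≤-trans (m≤m+n _ (2 + n)) (≤-reflexive (lem n)))) (subset-sums-bounded n)))
  where
  lem : ∀ n → suc n + suc n * suc n + (2 + n) ≡ (2 + n) * (2 + n)
  lem = ℕ-solve-∀

length-subset-sums : ∀ n → length (subset-sums n) ≡ 2 ^ n
length-subset-sums zero    = refl
length-subset-sums (suc n) = trans (length-++ (subset-sums n)) (cong₂ _+_ (length-subset-sums n)
  (trans (length-map (_+_ (suc n)) (subset-sums n)) (trans (length-subset-sums n) (sym (+-identityʳ (2 ^ n))))))

square-of-distance : ∀ a b → a * a + b * b ≡ 2 * (a * b) + ∣ a - b ∣ * ∣ a - b ∣
square-of-distance a b with ≤-total a b
... | inj₁ a≤b with d , refl ← m≤n⇒∃[o]m+o≡n a≤b rewrite ∣m-m+n∣≡n a d = lem a d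
  where
  lem : ∀ a d → a * a + (a + d) * (a + d) ≡ 2 * (a * (a + d)) + d * d
  lem = ℕ-solve-∀
... | inj₂ b≤a with d , refl ← m≤n⇒∃[o]m+o≡n b≤a rewrite ∣-∣-comm (b + d) b | ∣m-m+n∣≡n b d = lem b d
  where
  lem : ∀ b d → (b + d) * (b + d) + b * b ≡ 2 * ((b + d) * b) + d * d
  lem = ℕ-solve-∀

module Steps (s : ℕ → ℕ) where

  squares products steps : ℕ → ℕ
  squares  R = rangeSum R (λ i → s i * s i)
  products R = rangeSum R (λ i → s i * s (suc i))
  steps    R = rangeSum R (λ i → ∣ s i - s (suc i) ∣ * ∣ s i - s (suc i) ∣)

  telescope : ∀ R → 2 * products R + steps R + s 0 * s 0 ≡ 2 * squares R + s R * s R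
  telescope zero    = refl
  telescope (suc R) = begin
    2 * (products R + s R * s (suc R)) + (steps R + d * d) + s 0 * s 0
      ≡⟨ lem₁ (products R) (s R * s (suc R)) (steps R) (d * d) (s 0 * s 0) ⟩
    2 * products R + steps R + s 0 * s 0 + (2 * (s R * s (suc R)) + d * d)
      ≡⟨ cong₂ _+_ (telescope R) (sym (square-of-distance (s R) (s (suc R)))) ⟩
    2 * squares R + s R * s R + (s R * s R + s (suc R) * s (suc R))
      ≡⟨ lem₂ (squares R) (s R * s R) (s (suc R) * s (suc R)) ⟩
    2 * (squares R + s R * s R) + s (suc R) * s (suc R) ∎
    where
    open ≡-Reasoning
    d = ∣ s R - s (suc R) ∣
    lem₁ : ∀ p a x d z → 2 * (p + a) + (x + d) + z ≡ 2 * p + x + z + (2 * a + d)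
    lem₁ = ℕ-solve-∀
    lem₂ : ∀ q a b → 2 * q + a + (a + b) ≡ 2 * (q + a) + b
    lem₂ = ℕ-solve-∀

  steep-or-flat : ∀ e R → (∃[ i ] i < R × s (suc i) + e < s i) ⊎ (∀ i → i < R → s i ≤ s (suc i) + e)
  steep-or-flat e zero    = inj₂ (λ _ ())
  steep-or-flat e (suc R) with steep-or-flat e R | s (suc R) + e <? s R
  ... | inj₁ (i , i<R , steep) | _      = inj₁ (i , m≤n⇒m≤1+n i<R , steep)
  ... | inj₂ _    | yes steep           = inj₁ (R , ≤-refl , steep)
  ... | inj₂ flat | no ¬steep           = inj₂ λ i i<1+R →
    [ flat i , (λ { refl → ≮⇒≥ ¬steep }) ]′ (m≤n⇒m<n∨m≡n (≤-pred i<1+R))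

  -- If no descent exceeded `e`, counting back from `s R ≡ 0` would bound every value by `R * e` and
  -- the total by `R * (R * e)`. So some descent exceeds `e`, and its square alone suffices.
  steps-bound : ∀ e R → s R ≡ 0 → R * (R * e) < rangeSum R s → e * e ≤ steps R
  steps-bound e R sR≡0 large with steep-or-flat e R
  ... | inj₁ (i , i<R , steep) = ≤-trans (*-mono-≤ e≤ e≤) (term≤rangeSum (λ i → ∣ s i - s (suc i) ∣ * ∣ s i - s (suc i) ∣) i R i<R)
    where
    e≤ : e ≤ ∣ s i - s (suc i) ∣
    e≤ = ≤-trans (m+n≤o⇒m≤o∸n e (≤-trans (≤-reflexive (+-comm e (s (suc i)))) (<⇒≤ steep))) (m∸n≤∣m-n∣ (s i) (s (suc i)))
  ... | inj₂ flat = contradiction large (≤⇒≯ (rangeSum-≤ s (R * e) R (λ i i<R →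
      ≤-trans (height (R ∸ i) i (m+[n∸m]≡n (<⇒≤ i<R))) (*-monoˡ-≤ e (m∸n≤m R i)))))
    where
    height : ∀ k i → i + k ≡ R → s i ≤ k * e
    height zero    i i≡R = ≤-reflexive (trans (cong s (trans (sym (+-identityʳ i)) i≡R)) sR≡0)
    height (suc k) i i+k≡R = ≤-trans (flat i (≤-trans (m<m+n i (s≤s z≤n)) (≤-reflexive i+k≡R)))
      (≤-trans (+-monoˡ-≤ e (height k (suc i) (trans (sym (+-suc i k)) i+k≡R))) (≤-reflexive (+-comm (k * e) e)))

pigeonhole : ∀ F G B N → antidiagonal G N ℤ.+ + suc N ℤ.* B ℤ.< antidiagonal F N →
  ∃[ j ] ∃[ m ] j + m ≡ N × G j m ℤ.+ B ℤ.< F j m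
pigeonhole F G B zero    lt = 0 , 0 , refl , subst (λ z → G 0 0 ℤ.+ z ℤ.< F 0 0) (ℤ.*-identityˡ B) lt
pigeonhole F G B (suc N) lt with G 0 (suc N) ℤ.+ B ℤ.<? F 0 (suc N)
... | yes found = 0 , suc N , refl , found
... | no  ¬here with antidiagonal (λ a → G (suc a)) N ℤ.+ + suc N ℤ.* B ℤ.<? antidiagonal (λ a → F (suc a)) N
...   | yes rest = let j , m , e , found = pigeonhole (λ a → F (suc a)) (λ a → G (suc a)) B N rest in suc j , m , cong suc e , found
...   | no  ¬rest = contradiction lt (ℤ.≤⇒≯ (ℤ.≤-trans (ℤ.+-mono-≤ (ℤ.≮⇒≥ ¬here) (ℤ.≮⇒≥ ¬rest))
    (ℤ.≤-reflexive (lem (G 0 (suc N)) B (antidiagonal (λ a → G (suc a)) N) (+ N)))))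
  where
  lem : ∀ g b a n → g ℤ.+ b ℤ.+ (a ℤ.+ (+ 1 ℤ.+ n) ℤ.* b) ≡ g ℤ.+ a ℤ.+ (+ 2 ℤ.+ n) ℤ.* b
  lem = ℤ-solve-∀

centred-gap : ∀ n e → let R = suc n * suc n in R * (R * e) < 2 ^ n →
  centred n (n + suc n) (ℤ.- + 1) ℤ.+ + (e * e) ℤ.≤ centred n (n + suc n) (+ 0)
centred-gap n e large = subst₂ ℤ._≤_ (cong (ℤ._+ + (e * e)) (sym (centred-correlation n 1))) (sym (centred-correlation n 0))
  (ℤ.+≤+ (begin
    2 * listSum (λ x → s (suc x)) L + e * e        ≡⟨ cong (λ z → 2 * z + e * e) (listSum-multiplicity (λ x → s (suc x)) R L L<R) ⟩
    2 * products R + e * e                         ≤⟨ +-monoʳ-≤ (2 * products R) (steps-bound e R sR≡0 (<-≤-trans large (≤-reflexive (sym total)))) ⟩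
    2 * products R + steps R                       ≤⟨ m≤m+n _ (s 0 * s 0) ⟩
    2 * products R + steps R + s 0 * s 0           ≡⟨ telescope R ⟩
    2 * squares R + s R * s R                      ≡⟨ cong (λ z → 2 * squares R + z * z) sR≡0 ⟩
    2 * squares R + 0                              ≡⟨ +-identityʳ _ ⟩
    2 * squares R                                  ≡⟨ cong (2 *_) (listSum-multiplicity s R L L<R) ⟨
    2 * listSum s L                                ∎))
  where
  open ≤-Reasoning
  L = subset-sums n
  R = suc n * suc n
  s = multiplicity L
  open Steps s
  L<R : All (_< R) L
  L<R = subset-sums-bounded n
  sR≡0 : s R ≡ 0
  sR≡0 = multiplicity-outside R L L<R
  total : rangeSum R s ≡ 2 ^ n
  total = trans (rangeSum-cong R (λ i → sym (*-identityʳ (s i)))) (trans (sym (listSum-multiplicity (λ _ → 1) R L L<R))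
    (trans (listSum-1 L) (length-subset-sums n)))
    where
    listSum-1 : ∀ L → listSum (λ _ → 1) L ≡ length L
    listSum-1 []      = refl
    listSum-1 (x ∷ L) = cong suc (listSum-1 L)

-- The reason for z = q^(-n) with N = 2n + 1: the shift places the middle degree jm/2 of every
-- summand at q^0, so all the middle differences are compared at once. In particular jm is even.
middle : ∀ n j m → j + m ≡ n + suc n → 2 * (n * j) ≡ 2 * triangle j + j * m
middle n j m e = +-cancelʳ-≡ j _ _ (begin
  2 * (n * j) + j              ≡⟨ lem₁ n j ⟩
  j * (n + suc n)              ≡⟨ cong (j *_) e ⟨
  j * (j + m)                  ≡⟨ *-distribˡ-+ j j m ⟩
  j * j + j * m                ≡⟨ cong (_+ j * m) (triangle-double j) ⟨
  2 * triangle j + j + j * m   ≡⟨ lem₂ (2 * triangle j) j (j * m) ⟩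
  2 * triangle j + j * m + j   ∎)
  where
  open ≡-Reasoning
  lem₁ : ∀ n j → 2 * (n * j) + j ≡ j * (n + suc n)
  lem₁ = ℕ-solve-∀
  lem₂ : ∀ a b c → a + b + c ≡ a + c + b
  lem₂ = ℕ-solve-∀

pℤ-pred : ∀ k ℓ m → pℤ (ℤ.- + 1 ℤ.+ + k) ℓ m ≡ + pPred k ℓ m
pℤ-pred zero    ℓ m = refl
pℤ-pred (suc k) ℓ m = refl

large-difference : ∀ n e B → let R = suc n * suc n in R * (R * e) < 2 ^ n → suc (n + suc n) * B < e * e →
  ∃[ j ] ∃[ m ] ∃[ k ] j + m ≡ n + suc n × 2 * k ≡ j * m × pPred k j m + B < p k j m
large-difference n e B large small with pigeonhole (shifted n (+ 0)) (shifted n (ℤ.- + 1)) (+ B) (n + suc n)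
  (ℤ.<-≤-trans (ℤ.+-monoʳ-< (centred n (n + suc n) (ℤ.- + 1))
    (ℤ.≤-<-trans (ℤ.≤-reflexive (sym (ℤ.pos-* (suc (n + suc n)) B))) (ℤ.+<+ small))) (centred-gap n e large))
... | j , m , j+m , lt = j , m , k , j+m , 2k≡ , drop-+ (subst₂ ℤ._<_
    (cong (ℤ._+ + B) (trans (cong (λ z → pℤ (ℤ.- + 1 ℤ.+ z) j m) position) (pℤ-pred k j m)))
    (cong (λ z → pℤ (+ 0 ℤ.+ z) j m) position) lt)
  where
  k = n * j ∸ triangle j
  triangle≤ : triangle j ≤ n * j
  triangle≤ = *-cancelˡ-≤ 2 (≤-trans (m≤m+n (2 * triangle j) (j * m)) (≤-reflexive (sym (middle n j m j+m))))
  2k≡ : 2 * k ≡ j * m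
  2k≡ = trans (*-distribˡ-∸ 2 (n * j) (triangle j))
    (trans (cong (_∸ 2 * triangle j) (middle n j m j+m)) (m+n∸m≡n (2 * triangle j) (j * m)))
  position : + n ℤ.* + j ℤ.- + triangle j ≡ + k
  position = trans (cong (ℤ._- + triangle j) (sym (ℤ.pos-* n j))) (trans (ℤ.m-n≡m⊖n (n * j) (triangle j)) (ℤ.⊖-≥ triangle≤))
  drop-+ : ∀ {a b} → + a ℤ.< + b → a < b
  drop-+ (ℤ.+<+ lt) = lt

-- Exponential growth

-- Each `p n ℓ m` is at most a binomial coefficient, and 2^m times that is a single term of (1 +
-- 2)^(ℓ + m). The induction follows the q-Pascal rule.
2^m*p≤3^[ℓ+m] : ∀ n ℓ m → 2 ^ m * p n ℓ m ≤ 3 ^ (ℓ + m)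
2^m*p≤3^[ℓ+m] n zero m = ≤-trans (*-monoʳ-≤ (2 ^ m) (p≤1 n)) (≤-trans (≤-reflexive (*-identityʳ (2 ^ m))) (^-monoˡ-≤ m (n≤1+n 2)))
  where
  p≤1 : ∀ n → p n 0 m ≤ 1
  p≤1 zero    = ≤-refl
  p≤1 (suc n) = z≤n
2^m*p≤3^[ℓ+m] n (suc ℓ) zero = ≤-trans (≤-reflexive (cong (1 *_) (p-no-columns n ℓ)))
  (≤-trans (2^m*p≤3^[ℓ+m] n ℓ zero) (m≤m+n (3 ^ (ℓ + 0)) _))
2^m*p≤3^[ℓ+m] n (suc ℓ) (suc m) = begin
  2 ^ suc m * p n (suc ℓ) (suc m)                        ≤⟨ *-monoʳ-≤ (2 ^ suc m) split ⟩
  2 ^ suc m * (p n (suc ℓ) m + p (n ∸ suc m) ℓ (suc m))  ≡⟨ lem₁ (2 ^ m) (p n (suc ℓ) m) (p (n ∸ suc m) ℓ (suc m)) ⟩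
  2 * (2 ^ m * p n (suc ℓ) m) + 2 ^ suc m * p (n ∸ suc m) ℓ (suc m)
    ≤⟨ +-mono-≤ (*-monoʳ-≤ 2 (2^m*p≤3^[ℓ+m] n (suc ℓ) m)) (2^m*p≤3^[ℓ+m] (n ∸ suc m) ℓ (suc m)) ⟩
  2 * 3 ^ (suc ℓ + m) + 3 ^ (ℓ + suc m)                  ≡⟨ cong (λ z → 2 * 3 ^ z + 3 ^ (ℓ + suc m)) (sym (+-suc ℓ m)) ⟩
  2 * 3 ^ (ℓ + suc m) + 3 ^ (ℓ + suc m)                  ≡⟨ lem₂ (3 ^ (ℓ + suc m)) ⟩
  3 ^ (suc ℓ + suc m)                                    ∎
  where
  open ≤-Reasoning
  lem₁ : ∀ a x y → 2 * a * (x + y) ≡ 2 * (a * x) + 2 * a * y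
  lem₁ = ℕ-solve-∀
  lem₂ : ∀ a → 2 * a + a ≡ 3 * a
  lem₂ = ℕ-solve-∀
  -- For `n < suc m` truncated subtraction adds a spurious term, which is harmless in an upper
  -- bound.
  split : p n (suc ℓ) (suc m) ≤ p n (suc ℓ) m + p (n ∸ suc m) ℓ (suc m)
  split with n <? suc m
  ... | yes n<m = ≤-trans (≤-reflexive (p-largest-part-< n ℓ m n<m)) (m≤m+n _ _)
  ... | no  n≮m with k , refl ← m≤n⇒∃[o]m+o≡n (≮⇒≥ n≮m) =
    ≤-reflexive (trans (p-largest-part k ℓ m) (cong (λ z → p (suc m + k) (suc ℓ) m + p z ℓ (suc m)) (sym (m+n∸m≡n m k))))

parity : ∀ j → (∃[ i ] j ≡ 2 * i) ⊎ (∃[ i ] j ≡ suc (2 * i))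
parity zero    = inj₁ (0 , refl)
parity (suc j) with parity j
... | inj₁ (i , refl) = inj₂ (i , refl)
... | inj₂ (i , refl) = inj₁ (suc i , sym (*-suc 2 i))

-- The height is even so that the middle degree stays an integer when the width changes. The slack 8
-- leaves room for complementary strips to which `strict-unimodality` applies.
record LargeBox (t Δ : ℕ) : Set where
  field
    i K k      : ℕ
    large      : pPred k (2 * i) K + Δ ≤ p k (2 * i) K
    at-middle  : 2 * k ≡ 2 * i * K
    total      : 2 * i + K ≡ suc (8 * t)
    not-long   : 2 * i + 8 ≤ 6 * t
    not-wide   : K + 8 ≤ 6 * t

2^-* : ∀ a b → 2 ^ a * 2 ^ b ≡ 2 ^ (a + b)
2^-* a b = sym (^-distribˡ-+-* 2 a b)

2^-< : ∀ {a b} → a < b → 2 ^ a < 2 ^ b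
2^-< = ^-monoʳ-< 2 (s≤s (s≤s z≤n))

2^-≤ : ∀ {a b} → a ≤ b → 2 ^ a ≤ 2 ^ b
2^-≤ = ^-monoʳ-≤ 2

3^[8t+1]≤2^[13t+2] : ∀ t → 3 ^ suc (8 * t) ≤ 2 ^ (13 * t + 2)
3^[8t+1]≤2^[13t+2] t = begin
  3 * 3 ^ (8 * t)      ≡⟨ cong (3 *_) (^-*-assoc 3 8 t) ⟨
  3 * (3 ^ 8) ^ t      ≤⟨ *-mono-≤ (n≤1+n 3) (^-monoˡ-≤ t (≤ᵇ⇒≤ (3 ^ 8) (2 ^ 13) tt)) ⟩
  4 * (2 ^ 13) ^ t     ≡⟨ cong (4 *_) (^-*-assoc 2 13 t) ⟩
  4 * 2 ^ (13 * t)     ≡⟨ *-comm 4 (2 ^ (13 * t)) ⟩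
  2 ^ (13 * t) * 2 ^ 2 ≡⟨ 2^-* (13 * t) 2 ⟩
  2 ^ (13 * t + 2)     ∎
  where open ≤-Reasoning

-- A difference exceeding 2ᵇ forces a box to be far from degenerate.
width-bound : ∀ {k J K t b} → pPred k J K + 2 ^ b < p k J K → J + K ≡ suc (8 * t) → 7 * t + 9 ≤ b → K + 8 ≤ 6 * t
width-bound {k} {J} {K} {t} {b} gap total room with K + 8 ≤? 6 * t
... | yes ok = ok
... | no ¬ok = contradiction (begin-strict
  2 ^ (K + b)            ≡⟨ 2^-* K b ⟨
  2 ^ K * 2 ^ b          <⟨ *-monoʳ-< (2 ^ K) {{m^n≢0 2 K}} (≤-<-trans (m≤n+m (2 ^ b) (pPred k J K)) gap) ⟩
  2 ^ K * p k J K        ≤⟨ 2^m*p≤3^[ℓ+m] k J K ⟩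
  3 ^ (J + K)            ≡⟨ cong (3 ^_) total ⟩
  3 ^ suc (8 * t)        ≤⟨ 3^[8t+1]≤2^[13t+2] t ⟩
  2 ^ (13 * t + 2)       ≤⟨ 2^-≤ exponent ⟩
  2 ^ (K + b)            ∎) (n≮n _)
  where
  open ≤-Reasoning
  -- A width violating the claim is at least 6t - 7, and 7t + 9 is exactly what is missing from
  -- there to 13t + 2.
  exponent : 13 * t + 2 ≤ K + b
  exponent = +-cancelʳ-≤ 8 _ _ (begin
    13 * t + 2 + 8            ≡⟨ lem₁ t ⟩
    suc (6 * t) + (7 * t + 9) ≤⟨ +-mono-≤ (≰⇒> ¬ok) room ⟩
    K + 8 + b                 ≡⟨ lem₂ K b ⟩
    K + b + 8                 ∎)
    where
    lem₁ : ∀ t → 13 * t + 2 + 8 ≡ suc (6 * t) + (7 * t + 9)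
    lem₁ = ℕ-solve-∀
    lem₂ : ∀ K b → K + 8 + b ≡ K + b + 8
    lem₂ = ℕ-solve-∀

square-bound : ∀ {N n} r g → N ≤ 2 ^ r → suc (r + r + (r + r + g)) ≤ n → N * N * (N * N * 2 ^ g) < 2 ^ n
square-bound {N} {n} r g N≤ r-bound = begin-strict
  N * N * (N * N * 2 ^ g)                 ≤⟨ *-mono-≤ (*-mono-≤ N≤ N≤) (*-monoˡ-≤ (2 ^ g) (*-mono-≤ N≤ N≤)) ⟩
  2 ^ r * 2 ^ r * (2 ^ r * 2 ^ r * 2 ^ g) ≡⟨ cong (λ z → z * (z * 2 ^ g)) (2^-* r r) ⟩
  2 ^ (r + r) * (2 ^ (r + r) * 2 ^ g)     ≡⟨ trans (cong (2 ^ (r + r) *_) (2^-* (r + r) g)) (2^-* (r + r) (r + r + g)) ⟩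
  2 ^ (r + r + (r + r + g))               <⟨ 2^-< r-bound ⟩
  2 ^ n                                   ∎
  where open ≤-Reasoning

double-bound : ∀ {N} r g b → N ≤ 2 ^ r → suc (suc r + b) ≤ g + g → (N + N) * 2 ^ b < 2 ^ g * 2 ^ g
double-bound {N} r g b N≤ b-bound = begin-strict
  (N + N) * 2 ^ b         ≤⟨ *-monoˡ-≤ (2 ^ b) (≤-trans (+-mono-≤ N≤ N≤) (≤-reflexive (cong (_+_ (2 ^ r)) (sym (+-identityʳ (2 ^ r)))))) ⟩
  2 ^ suc r * 2 ^ b       ≡⟨ 2^-* (suc r) b ⟩
  2 ^ (suc r + b)         <⟨ 2^-< b-bound ⟩
  2 ^ (g + g)             ≡⟨ 2^-* g g ⟨
  2 ^ g * 2 ^ g           ∎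
  where open ≤-Reasoning

even-box : ∀ t b i J K k → J ≡ 2 * i → pPred k J K + 2 ^ b < p k J K → 2 * k ≡ J * K → J + K ≡ suc (8 * t) →
  J + 8 ≤ 6 * t → K + 8 ≤ 6 * t → LargeBox t (2 ^ b)
even-box t b i _ K k refl gap mid total J≤ K≤ = record
  { i = i ; K = K ; k = k ; large = <⇒≤ gap ; at-middle = mid ; total = total ; not-long = J≤ ; not-wide = K≤ }

odd-sum : ∀ {t J K i j} → J + K ≡ suc (8 * t) → J ≡ suc (2 * i) → K ≡ suc (2 * j) → ⊥
odd-sum {t} {i = i} {j} total refl refl = even≢odd (suc (i + j)) (4 * t) (trans (lem i j) (trans total (cong suc (*-assoc 2 4 t))))
  where
  lem : ∀ i j → 2 * suc (i + j) ≡ suc (2 * i) + suc (2 * j)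
  lem = ℕ-solve-∀

-- The sides have an odd sum, so one of them is even, and transposing makes it the height. The width
-- bound, applied to the box and to its transpose, limits both sides.
orient : ∀ t b J K k → J + K ≡ suc (8 * t) → 2 * k ≡ J * K → pPred k J K + 2 ^ b < p k J K → 7 * t + 9 ≤ b → LargeBox t (2 ^ b)
orient t b J K k total mid gap room = by-parity (parity J) (parity K)
  where
  total′ : K + J ≡ suc (8 * t)
  total′ = trans (+-comm K J) total
  gap′ : pPred k K J + 2 ^ b < p k K J
  gap′ = subst₂ (λ u v → u + 2 ^ b < v) (pPred-sym k J K) (p-sym k J K) gap
  J≤ : J + 8 ≤ 6 * t
  J≤ = width-bound {k} {K} {J} {t} {b} gap′ total′ room
  K≤ : K + 8 ≤ 6 * t
  K≤ = width-bound {k} {J} {K} {t} {b} gap total room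
  by-parity : (∃[ i ] J ≡ 2 * i) ⊎ (∃[ i ] J ≡ suc (2 * i)) → (∃[ i ] K ≡ 2 * i) ⊎ (∃[ i ] K ≡ suc (2 * i)) → LargeBox t (2 ^ b)
  by-parity (inj₁ (i , J≡)) _               = even-box t b i J K k J≡ gap mid total J≤ K≤
  by-parity (inj₂ _)        (inj₁ (i , K≡)) = even-box t b i K J k K≡ gap′ (trans mid (*-comm J K)) total′ K≤ J≤
  by-parity (inj₂ (i , J≡)) (inj₂ (j , K≡)) = ⊥-elim (odd-sum {t} {i = i} {j} total J≡ K≡)

-- Here n = 4t. Subset sums lie below (n + 1)² ≤ 2^(2r), so 4r + g < n yields a descent of at least
-- 2^g. Its square, shared among 2(n + 1) ≤ 2^(r+1) summands, leaves one of them more than 2^b.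
large-box : ∀ t r g b → suc (4 * t) ≤ 2 ^ r → suc (r + r + (r + r + g)) ≤ 4 * t → suc (suc r + b) ≤ g + g →
  7 * t + 9 ≤ b → LargeBox t (2 ^ b)
large-box t r g b n<2^r r-bound b-bound room =
  let J , K , k , total , mid , gap = large-difference (4 * t) (2 ^ g) (2 ^ b) (square-bound r g n<2^r r-bound) (double-bound r g b n<2^r b-bound)
  in orient t b J K k (trans total (lem t)) mid gap room
  where
  lem : ∀ t → 4 * t + suc (4 * t) ≡ suc (8 * t)
  lem = ℕ-solve-∀

-- From one large box to all sufficiently high boxes

superadditive-difference-ℓ : ∀ m ℓ₁ ℓ₂ k₁ k₂ d → pPred k₁ ℓ₁ m < p k₁ ℓ₁ m → 2 * (k₁ + k₂) ≤ (ℓ₁ + ℓ₂) * m →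
  pPred k₂ ℓ₂ m + d ≤ p k₂ ℓ₂ m → pPred (k₁ + k₂) (ℓ₁ + ℓ₂) m + d ≤ p (k₁ + k₂) (ℓ₁ + ℓ₂) m
superadditive-difference-ℓ m ℓ₁ ℓ₂ k₁ k₂ d lt 2k≤ gap = subst₂ (λ u v → u + d ≤ v)
  (pPred-sym (k₁ + k₂) m (ℓ₁ + ℓ₂)) (p-sym (k₁ + k₂) m (ℓ₁ + ℓ₂))
  (superadditive-difference m ℓ₁ ℓ₂ k₁ k₂ d
    (subst₂ _<_ (pPred-sym k₁ ℓ₁ m) (p-sym k₁ ℓ₁ m) lt)
    (≤-trans 2k≤ (≤-reflexive (*-comm (ℓ₁ + ℓ₂) m)))
    (subst₂ (λ u v → u + d ≤ v) (pPred-sym k₂ ℓ₂ m) (p-sym k₂ ℓ₂ m) gap))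

-- Both enlargements multiply by a constant polynomial in the complementary strip.
difference-monotone : ∀ {ℓ ℓ′ m m′} k d → ℓ′ ≤ ℓ → m′ ≤ m → 2 * k ≤ ℓ′ * m′ →
  pPred k ℓ′ m′ + d ≤ p k ℓ′ m′ → pPred k ℓ m + d ≤ p k ℓ m
difference-monotone {ℓ} {ℓ′} {m} {m′} k d ℓ′≤ℓ m′≤m 2k≤ gap =
  subst (λ l → pPred k l m + d ≤ p k l m) (m∸n+n≡m ℓ′≤ℓ)
    (superadditive-difference-ℓ m (ℓ ∸ ℓ′) ℓ′ 0 k d (zero-strict (ℓ ∸ ℓ′) m)
      (≤-trans 2k≤ (*-mono-≤ (m≤n+m ℓ′ (ℓ ∸ ℓ′)) m′≤m))
      (subst (λ l → pPred k ℓ′ l + d ≤ p k ℓ′ l) (m∸n+n≡m m′≤m)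
        (superadditive-difference ℓ′ (m ∸ m′) m′ 0 k d (zero-strict ℓ′ (m ∸ m′))
          (≤-trans 2k≤ (*-monoʳ-≤ ℓ′ (m≤n+m m′ (m ∸ m′)))) gap)))

-- A large difference in the middle of a box of even height can be enlarged to the middle of a wider
-- box, and from there to all sizes near the middle of a higher one.
enlarge : ∀ {t Δ ℓ m κ} → LargeBox t Δ → 6 * t ≤ ℓ → ℓ ≤ m → 2 * κ ≤ ℓ * m → ℓ * m < 2 * κ + 2 * m →
  pPred κ ℓ m + Δ ≤ p κ ℓ m
enlarge {t} {Δ} {ℓ} {m} {κ} box 6t≤ℓ ℓ≤m 2κ≤ ℓm< =
  subst₂ (λ κ ℓ → pPred κ ℓ m + Δ ≤ p κ ℓ m) k₂+k′ (m∸n+n≡m (<⇒≤ J<ℓ))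
    (superadditive-difference-ℓ m (ℓ ∸ J) J k₂ k′ Δ
      (strict-unimodality (ℓ ∸ J) m 8≤ℓ-J 8≤m k₂ 2≤k₂ 2k₂≤)
      (≤-trans (≤-reflexive (cong (2 *_) k₂+k′)) (≤-trans 2κ≤ (≤-reflexive (cong (_* m) (sym (m∸n+n≡m (<⇒≤ J<ℓ)))))))
      wide)
  where
  open LargeBox box
  open ≤-Reasoning
  J = 2 * i
  8+J≤ℓ : 8 + J ≤ ℓ
  8+J≤ℓ = ≤-trans (≤-reflexive (+-comm 8 J)) (≤-trans not-long 6t≤ℓ)
  8+K≤m : 8 + K ≤ m
  8+K≤m = ≤-trans (≤-reflexive (+-comm 8 K)) (≤-trans not-wide (≤-trans 6t≤ℓ ℓ≤m))
  J<ℓ : J < ℓ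
  J<ℓ = ≤-trans (m≤n+m (suc J) 7) (≤-trans (≤-reflexive (+-suc 7 J)) 8+J≤ℓ)
  8≤ℓ-J : 8 ≤ ℓ ∸ J
  8≤ℓ-J = m+n≤o⇒m≤o∸n 8 8+J≤ℓ
  8≤m-K : 8 ≤ m ∸ K
  8≤m-K = m+n≤o⇒m≤o∸n 8 8+K≤m
  8≤m : 8 ≤ m
  8≤m = ≤-trans (m≤m+n 8 K) 8+K≤m
  8≤J : 8 ≤ J
  8≤J = +-cancelʳ-≤ K 8 J (begin
    8 + K         ≡⟨ +-comm 8 K ⟩
    K + 8         ≤⟨ not-wide ⟩
    6 * t         ≤⟨ *-monoˡ-≤ t (m≤m+n 6 2) ⟩
    8 * t         ≤⟨ n≤1+n _ ⟩
    suc (8 * t)   ≡⟨ total ⟨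
    J + K         ∎)
  K≤m : K ≤ m
  K≤m = ≤-trans (m≤n+m K 8) 8+K≤m
  -- Exactly half of J(m - K), as J is even; together with `k` it gives the middle degree of the J ×
  -- m box.
  k₁ = i * (m ∸ K)
  k′ = k₁ + k
  2k₁ : 2 * k₁ ≡ J * (m ∸ K)
  2k₁ = sym (*-assoc 2 i (m ∸ K))
  2k′ : 2 * k′ ≡ J * m
  2k′ = trans (*-distribˡ-+ 2 k₁ k) (trans (cong₂ _+_ 2k₁ at-middle)
    (trans (sym (*-distribˡ-+ J (m ∸ K) K)) (cong (J *_) (m∸n+n≡m K≤m))))
  wide : pPred k′ J m + Δ ≤ p k′ J m
  wide = subst (λ m → pPred k′ J m + Δ ≤ p k′ J m) (m∸n+n≡m K≤m)
    (superadditive-difference J (m ∸ K) K k₁ k Δ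
      (strict-unimodality J (m ∸ K) 8≤J 8≤m-K k₁ 2≤k₁ (≤-reflexive 2k₁))
      (≤-reflexive (trans 2k′ (cong (J *_) (sym (m∸n+n≡m K≤m))))) large)
    where
    2≤k₁ : 2 ≤ k₁
    2≤k₁ = *-cancelˡ-≤ 2 (≤-trans (m≤m+n 4 60) (≤-trans (*-mono-≤ 8≤J 8≤m-K) (≤-reflexive (sym 2k₁))))
  -- Since 2κ falls short of ℓm by less than 2m and ℓ - J ≥ 8, at least 6m remains over Jm. Hence
  -- the degree `k₂` left for the strip of height ℓ - J avoids 0 and 1.
  Jm+4≤2κ : J * m + 4 ≤ 2 * κ
  Jm+4≤2κ = +-cancelʳ-≤ (2 * m) _ _ (begin
    J * m + 4 + 2 * m     ≡⟨ lem₁ (J * m) (2 * m) ⟩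
    4 + J * m + 2 * m     ≤⟨ +-monoˡ-≤ (2 * m) (+-monoˡ-≤ (J * m) (≤-trans (m≤m+n 4 44) (*-monoʳ-≤ 6 8≤m))) ⟩
    6 * m + J * m + 2 * m ≡⟨ lem₂ J m ⟩
    (8 + J) * m           ≤⟨ *-monoˡ-≤ m 8+J≤ℓ ⟩
    ℓ * m                 ≤⟨ <⇒≤ ℓm< ⟩
    2 * κ + 2 * m         ∎)
    where
    lem₁ : ∀ a b → a + 4 + b ≡ 4 + a + b
    lem₁ = ℕ-solve-∀
    lem₂ : ∀ J m → 6 * m + J * m + 2 * m ≡ (8 + J) * m
    lem₂ = ℕ-solve-∀
  k₂ = κ ∸ k′
  k′+2≤κ : 2 + k′ ≤ κ
  k′+2≤κ = *-cancelˡ-≤ 2 (≤-trans (≤-reflexive (trans (*-distribˡ-+ 2 2 k′) (trans (cong (_+_ 4) 2k′) (+-comm 4 (J * m))))) Jm+4≤2κ)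
  k₂+k′ : k₂ + k′ ≡ κ
  k₂+k′ = m∸n+n≡m (≤-trans (m≤n+m k′ 2) k′+2≤κ)
  2≤k₂ : 2 ≤ k₂
  2≤k₂ = m+n≤o⇒m≤o∸n 2 k′+2≤κ
  2k₂≤ : 2 * k₂ ≤ (ℓ ∸ J) * m
  2k₂≤ = begin
    2 * k₂                ≡⟨ *-distribˡ-∸ 2 κ k′ ⟩
    2 * κ ∸ 2 * k′        ≡⟨ cong (2 * κ ∸_) 2k′ ⟩
    2 * κ ∸ J * m         ≤⟨ ∸-monoˡ-≤ (J * m) 2κ≤ ⟩
    ℓ * m ∸ J * m         ≡⟨ *-distribʳ-∸ m ℓ J ⟨
    (ℓ ∸ J) * m           ∎

-- Choice of the parameters

36r+85≤2^r : ∀ r → 36 * (9 + r) + 85 ≤ 2 ^ (9 + r)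
36r+85≤2^r zero    = ≤ᵇ⇒≤ (36 * 9 + 85) (2 ^ 9) tt
36r+85≤2^r (suc r) = begin
  36 * (9 + suc r) + 85                               ≤⟨ m≤m+n _ (36 * (9 + r) + 49) ⟩
  36 * (9 + suc r) + 85 + (36 * (9 + r) + 49)         ≡⟨ lem r ⟩
  2 * (36 * (9 + r) + 85)                             ≤⟨ *-monoʳ-≤ 2 (36r+85≤2^r r) ⟩
  2 * 2 ^ (9 + r)                                     ∎
  where
  open ≤-Reasoning
  lem : ∀ r → 36 * (9 + suc r) + 85 + (36 * (9 + r) + 49) ≡ 2 * (36 * (9 + r) + 85)
  lem = ℕ-solve-∀

Parameters : ℕ → Set
Parameters ℓ = ∃[ t ] ∃[ r ] ∃[ g ] ∃[ b ] suc (4 * t) ≤ 2 ^ r × suc (r + r + (r + r + g)) ≤ 4 * t ×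
  suc (suc r + b) ≤ g + g × 7 * t + 9 ≤ b × 6 * t ≤ ℓ × suc ℓ ≤ b

-- t = 9 r + 13 + x with r = 9 + y and x < 9, and g and b make the second and third inequality equalities.
parameters : ∀ ℓ → 564 ≤ ℓ → Parameters ℓ
parameters ℓ 564≤ℓ = t , 9 + y , g , b , n<2^r y , ≤-reflexive (lem₁ y x) , ≤-reflexive (lem₂ y x) ,
  ≤-trans (m≤m+n (7 * t + 9) x) (≤-reflexive (lem₃ y x)) , 6t≤ℓ , ℓ<b
  where
  -- With g = 4t - 4r - 1 and b = 2g - r - 2 = 8t - 9r - 4, the condition 7t + 9 ≤ b becomes t ≥ 9r
  -- + 13. Together with 4t + 1 ≤ 2^r this is first solvable at r = 9, where the least t is 94, and
  -- 564 = 6 · 94.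
  q = ℓ / 6
  y = (q ∸ 94) / 9
  x = (q ∸ 94) % 9
  t = 94 + (x + y * 9)
  g = 339 + 4 * x + 32 * y
  b = 667 + 8 * x + 63 * y
  lem₁ : ∀ y x → suc (9 + y + (9 + y) + (9 + y + (9 + y) + (339 + 4 * x + 32 * y))) ≡ 4 * (94 + (x + y * 9))
  lem₁ = ℕ-solve-∀
  lem₂ : ∀ y x → suc (suc (9 + y) + (667 + 8 * x + 63 * y)) ≡ 339 + 4 * x + 32 * y + (339 + 4 * x + 32 * y)
  lem₂ = ℕ-solve-∀
  lem₃ : ∀ y x → 7 * (94 + (x + y * 9)) + 9 + x ≡ 667 + 8 * x + 63 * y
  lem₃ = ℕ-solve-∀
  94≤q : 94 ≤ q
  94≤q = /-monoˡ-≤ 6 564≤ℓ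
  t≡q : t ≡ q
  t≡q = trans (cong (_+_ 94) (sym (m≡m%n+[m/n]*n (q ∸ 94) 9))) (m+[n∸m]≡n 94≤q)
  ℓ≡ : ℓ ≡ ℓ % 6 + 6 * t
  ℓ≡ = trans (m≡m%n+[m/n]*n ℓ 6) (cong (_+_ (ℓ % 6)) (trans (*-comm q 6) (cong (6 *_) (sym t≡q))))
  6t≤ℓ : 6 * t ≤ ℓ
  6t≤ℓ = ≤-trans (m≤n+m (6 * t) (ℓ % 6)) (≤-reflexive (sym ℓ≡))
  -- With x at most 8, 4t + 1 is at most 36r + 85, and 2^r exceeds this from r = 9 on.
  n<2^r : ∀ y → suc (4 * (94 + (x + y * 9))) ≤ 2 ^ (9 + y)
  n<2^r y = ≤-trans (s≤s (*-monoʳ-≤ 4 (+-monoʳ-≤ 94 (+-monoˡ-≤ (y * 9) (≤-pred (m%n<n (q ∸ 94) 9))))))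
    (≤-trans (≤-reflexive (lem y)) (36r+85≤2^r y))
    where
    lem : ∀ y → suc (4 * (94 + (8 + y * 9))) ≡ 36 * (9 + y) + 85
    lem = ℕ-solve-∀
  ℓ<b : suc ℓ ≤ b
  ℓ<b = ≤-trans (≤-reflexive (cong suc ℓ≡)) (≤-trans (+-monoˡ-≤ (6 * t) (m%n<n ℓ 6))
    (≤-trans (m≤m+n (6 + 6 * t) (97 + 2 * x + 9 * y)) (≤-reflexive (lem y x))))
    where
    lem : ∀ y x → 6 + 6 * (94 + (x + y * 9)) + (97 + 2 * x + 9 * y) ≡ 667 + 8 * x + 63 * y
    lem = ℕ-solve-∀

exponential : ∀ {ℓ m κ} → 564 ≤ ℓ → ℓ ≤ m → 2 * κ ≤ ℓ * m → ℓ * m < 2 * κ + 2 * m →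
  pPred κ ℓ m + 2 ^ suc ℓ ≤ p κ ℓ m
exponential {ℓ} {m} {κ} 564≤ℓ ℓ≤m 2κ≤ ℓm< = conclude (parameters ℓ 564≤ℓ)
  where
  conclude : Parameters ℓ → pPred κ ℓ m + 2 ^ suc ℓ ≤ p κ ℓ m
  conclude (t , r , g , b , n<2^r , r-bound , b-bound , room , 6t≤ℓ , ℓ<b) =
    ≤-trans (+-monoʳ-≤ (pPred κ ℓ m) (2^-≤ ℓ<b)) (enlarge (large-box t r g b n<2^r r-bound b-bound room) 6t≤ℓ ℓ≤m 2κ≤ ℓm<)

-- Reduction to degrees near the middle, and the constant

least : (P : ℕ → Set) → (∀ n → Dec (P n)) → ¬ P 0 → ∀ n → P n → ∃[ c ] suc c ≤ n × ¬ P c × P (suc c)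
least P P? ¬P0 zero    P0 = contradiction P0 ¬P0
least P P? ¬P0 (suc n) Pn with P? n
... | no ¬Pn  = n , ≤-refl , ¬Pn , Pn
... | yes Pn′ = let c , c≤n , ¬Pc , Pc = least P P? ¬P0 n Pn′ in c , m≤n⇒m≤1+n c≤n , ¬Pc , Pc

-- `tight` puts `k` within m′ of the middle of the smaller box, the range treated by `enlarge`;
-- `scale` says that ℓ′ is at least √s, so a difference exponential in ℓ′ is large enough.
record Frame (ℓ m k : ℕ) : Set where
  field
    ℓ′ m′    : ℕ
    ℓ′≤ℓ     : ℓ′ ≤ ℓ
    m′≤m     : m′ ≤ m
    ℓ′≤m′    : ℓ′ ≤ m′
    contains : 2 * k ≤ ℓ′ * m′
    tight    : ℓ′ * m′ < 2 * k + 2 * m′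
    scale    : (2 * k) ⊓ (ℓ * ℓ) ≤ ℓ′ * ℓ′

-- The smallest square for 2k ≤ ℓ², the narrowest box of height ℓ otherwise.
frame : ∀ ℓ m k → ℓ ≤ m → 1 ≤ k → 2 * k ≤ ℓ * m → Frame ℓ m k
frame ℓ m (suc j) ℓ≤m _ 2k≤ with 2 * suc j ≤? ℓ * ℓ
... | yes 2k≤ℓℓ with least (λ c → 2 * suc j ≤ c * c) (λ c → 2 * suc j ≤? c * c) (λ ()) ℓ 2k≤ℓℓ
...   | c , c<ℓ , c²<2k , 2k≤c′ = record
  { ℓ′ = suc c ; m′ = suc c ; ℓ′≤ℓ = c<ℓ ; m′≤m = ≤-trans c<ℓ ℓ≤m ; ℓ′≤m′ = ≤-refl ; contains = 2k≤c′
  ; tight = ≤-trans (s≤s (≤-trans (n≤1+n _) (≤-reflexive (lem c)))) (+-monoˡ-≤ (2 * suc c) (≰⇒> c²<2k))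
  ; scale = ≤-trans (m⊓n≤m _ _) 2k≤c′ }
  where
  lem : ∀ c → suc (suc c * suc c) ≡ c * c + 2 * suc c
  lem = ℕ-solve-∀
frame ℓ m (suc j) ℓ≤m _ 2k≤ | no ℓℓ<2k with least (λ c → 2 * suc j ≤ ℓ * c) (λ c → 2 * suc j ≤? ℓ * c)
                                (λ 2k≤0 → contradiction (≤-trans 2k≤0 (≤-reflexive (*-zeroʳ ℓ))) λ ()) m 2k≤
... | c , c<m , ℓc<2k , 2k≤ℓc′ = record
  { ℓ′ = ℓ ; m′ = suc c ; ℓ′≤ℓ = ≤-refl ; m′≤m = c<m ; ℓ′≤m′ = ℓ≤c′ ; contains = 2k≤ℓc′
  ; tight = ≤-trans (s≤s (≤-reflexive (trans (*-suc ℓ c) (+-comm ℓ (ℓ * c)))))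
      (+-mono-≤ (≰⇒> ℓc<2k) (≤-trans ℓ≤c′ (m≤m+n (suc c) _)))
  ; scale = m⊓n≤n _ _ }
  where
  ℓ≤c′ : ℓ ≤ suc c
  ℓ≤c′ = ≮⇒≥ λ c′<ℓ → ℓℓ<2k (≤-trans 2k≤ℓc′ (*-monoʳ-≤ ℓ (<⇒≤ c′<ℓ)))

-- The rational number above √s is the integer `a`, with denominator 1. Strictness comes from
-- `s ^ 9`, which is at least 2.
bound-holds : ∀ {x y s v a} → y < x → 2 ≤ s → s < a * a → 2 ^ a ≤ v * (x ∸ y) → BoundHolds 1 v x y s
bound-holds {x} {y} {s} {v} {a} y<x 2≤s s<aa 2^a≤ = y<x , a , 1 , ≤-refl ,
  ≤-trans (s≤s (≤-reflexive (*-identityʳ s))) s<aa , (begin-strict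
    1 ^ 4 * 2 ^ (4 * a) ≡⟨ trans (*-identityˡ (2 ^ (4 * a))) (trans (cong (2 ^_) (*-comm 4 a)) (sym (^-*-assoc 2 a 4))) ⟩
    (2 ^ a) ^ 4         ≤⟨ ^-monoˡ-≤ 4 2^a≤ ⟩
    z ^ 4               <⟨ m<m*n (z ^ 4) (s ^ 9) {{m^n≢0 z 4 {{>-nonZero (≤-trans (m^n>0 2 a) 2^a≤)}}}} 2≤s^9 ⟩
    z ^ 4 * s ^ 9       ∎)
  where
  open ≤-Reasoning
  z = v * (x ∸ y)
  2≤s^9 : 2 ≤ s ^ 9
  2≤s^9 = ≤-trans (m≤m+n 2 510) (^-monoˡ-≤ 9 2≤s)

lower-bound : ∀ v → (∀ ℓ → ℓ < 564 → 2 ^ suc ℓ ≤ v) → 1 ≤ v → ∀ ℓ m k → 8 ≤ ℓ → ℓ ≤ m → 2 ≤ k → 2 * k ≤ ℓ * m →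
  BoundHolds 1 v (p k ℓ m) (pPred k ℓ m) ((2 * k) ⊓ (ℓ * ℓ))
lower-bound v v-large 1≤v ℓ m k 8≤ℓ ℓ≤m 2≤k 2k≤ =
  bound-holds {p k ℓ m} {pPred k ℓ m} {(2 * k) ⊓ (ℓ * ℓ)} {v} {suc ℓ′} positive 2≤s s< difference
  where
  open Frame (frame ℓ m k ℓ≤m (<⇒≤ 2≤k) 2k≤)
  positive : pPred k ℓ m < p k ℓ m
  positive = strict-unimodality ℓ m 8≤ℓ (≤-trans 8≤ℓ ℓ≤m) k 2≤k 2k≤
  2≤s : 2 ≤ (2 * k) ⊓ (ℓ * ℓ)
  2≤s = ⊓-glb (≤-trans 2≤k (m≤m+n k (k + 0))) (≤-trans (m≤m+n 2 62) (*-mono-≤ 8≤ℓ 8≤ℓ))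
  s< : (2 * k) ⊓ (ℓ * ℓ) < suc ℓ′ * suc ℓ′
  s< = ≤-<-trans scale (*-mono-< (n<1+n ℓ′) (n<1+n ℓ′))
  difference : 2 ^ suc ℓ′ ≤ v * (p k ℓ m ∸ pPred k ℓ m)
  difference with ℓ′ <? 564
  -- Only positivity of the difference in the original box enters here; the size of `v` supplies the
  -- power of 2.
  ... | yes small = ≤-trans (v-large ℓ′ small) (≤-trans (≤-reflexive (sym (*-identityʳ v))) (*-monoʳ-≤ v (m<n⇒0<n∸m positive)))
  ... | no  large = ≤-trans (m+n≤o⇒m≤o∸n (2 ^ suc ℓ′) (≤-trans (≤-reflexive (+-comm (2 ^ suc ℓ′) (pPred k ℓ m)))
      (difference-monotone k (2 ^ suc ℓ′) ℓ′≤ℓ m′≤m contains (exponential (≮⇒≥ large) ℓ′≤m′ contains tight))))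
    (≤-trans (≤-reflexive (sym (*-identityˡ _))) (*-monoˡ-≤ (p k ℓ m ∸ pPred k ℓ m) 1≤v))

theorem1p3 : Σ ℕ (λ u → Σ ℕ (λ v → (1 ≤ u) × (1 ≤ v) ×
    ((ℓ m k : ℕ) → 8 ≤ ℓ → ℓ ≤ m → 2 ≤ k → 2 * k ≤ ℓ * m →
    BoundHolds u v (p k ℓ m) (p (k ∸ 1) ℓ m) ((2 * k) ⊓ (ℓ * ℓ)))))
theorem1p3 = conclude (power-bound 564)
  where
  -- The resulting constant is A = 1/v = 2^(-564).
  power-bound : ∀ n → ∃[ v ] 1 ≤ v × (∀ ℓ → ℓ < n → 2 ^ suc ℓ ≤ v)
  power-bound n = 2 ^ n , m^n>0 2 n , λ _ → 2^-≤
  conclude : ∃[ v ] 1 ≤ v × (∀ ℓ → ℓ < 564 → 2 ^ suc ℓ ≤ v) → _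
  conclude (v , 1≤v , v-large) = 1 , v , ≤-refl , 1≤v , λ { ℓ m (suc k) → lower-bound v v-large 1≤v ℓ m (suc k) }
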